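{- Let $k\ge 1$ and $n\ge k+2$ be integers. Then $$ g_k(n)= \max\left\{ \left\lfloor\frac{(k+1)n}{2}\right\rfloor,\; \max_{\substack{a\in\mathbb Z\\ \left\lfloor (k+1)/2\right\rfloor+1\le a\le k+1}} \left\{ a(n-a)+ \left\lfloor\frac{a(k+1-a)}{2}\right\rfloor \right\} \right\}. $$
   Context: All graphs are finite and simple. A chord of a cycle $C$ in a graph $G$ is an edge of $G$ joining two vertices of $C$ that are not consecutive on $C$. For integers $k\ge1$ and $n\ge k+2$, $g_k(n)$ denotes the maximum number of edges in an $n$-vertex graph containing no cycle $C$ with a vertex (of $C$) incident with at least $k$ chords of $C$. -}

module Defs where

open import Data.Fin using (Fin; toℕ; _<?_)
open import Data.Fin.Properties using (_≟_)
open import Data.List using (length; filter; map; upTo; allFin; cartesianProduct)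
open import Data.List.Extrema.Nat using (max)
open import Data.Nat using (ℕ; suc; _+_; _≤_; _≤?_)
open import Data.Nat.DivMod using (_mod_)
open import Data.Product using (Σ-syntax; ∃-syntax; _×_; _,_)
open import Data.Sum using (_⊎_)
open import Function.Definitions using (Injective)
open import Level using (0ℓ)
open import Relation.Binary.Core using (Rel)
open import Relation.Binary.Definitions using (Decidable; Irreflexive; Symmetric)
open import Relation.Binary.PropositionalEquality using (_≡_)
open import Relation.Nullary using (¬_; ¬?; _×-dec_; _⊎-dec_)

-- Finite simple graphs on the vertex set Fin n.  Decidability of adjacency is
-- what allows edges and chords to be counted constructively.
record Graph (n : ℕ) : Set₁ where
  infix 4 _~_ _~?_
  field
    _~_      : Rel (Fin n) 0ℓ
    ~-sym    : Symmetric _~_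
    ~-irrefl : Irreflexive _≡_ _~_
    _~?_     : Decidable _~_

-- Each edge {u , v} is counted once, as the pair with u < v.
∣E_∣ : ∀ {n} → Graph n → ℕ
∣E_∣ {n} G =
  length (filter (λ (u , v) → (u <? v) ×-dec (u ~? v))
                 (cartesianProduct (allFin n) (allFin n)))
  where open Graph G

next : ∀ {m} → Fin (suc m) → Fin (suc m)
next {m} i = suc (toℕ i) mod suc m

-- A cycle of length 3 + m, given by a cyclic enumeration of its (distinct)
-- vertices.
record Cycle {n : ℕ} (G : Graph n) : Set where
  open Graph G
  field
    m         : ℕ
    vertex    : Fin (3 + m) → Fin n
    injective : Injective _≡_ _≡_ vertex
    adjacent  : ∀ i → vertex i ~ vertex (next i)

module _ {n : ℕ} {G : Graph n} (C : Cycle G) where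
  open Graph G
  open Cycle C

  Consecutive : Rel (Fin (3 + m)) 0ℓ
  Consecutive i j = j ≡ next i ⊎ i ≡ next j

  -- The case i ≡ j needs no separate exclusion, since _~_ is irreflexive.
  Chord : Rel (Fin (3 + m)) 0ℓ
  Chord i j = vertex i ~ vertex j × ¬ Consecutive i j

  chord? : Decidable Chord
  chord? i j = (vertex i ~? vertex j) ×-dec ¬? ((j ≟ next i) ⊎-dec (i ≟ next j))

  -- The number of chords of C incident with the vertex at position i: as
  -- `vertex` is injective, each such chord has exactly one other end j.
  chordsAt : Fin (3 + m) → ℕ
  chordsAt i = length (filter (chord? i) (allFin (3 + m)))

HasCycleWithChords : ∀ {n} → ℕ → Graph n → Set
HasCycleWithChords k G = Σ[ C ∈ Cycle G ] ∃[ i ] k ≤ chordsAt C i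

-- g[ k , n ]≡ e  says that g_k(n) = e: the maximum exists and equals e.
g[_,_]≡_ : ℕ → ℕ → ℕ → Set₁
g[ k , n ]≡ e =
  (Σ[ G ∈ Graph n ] (¬ HasCycleWithChords k G × ∣E G ∣ ≡ e)) ×
  (∀ (G : Graph n) → ¬ HasCycleWithChords k G → ∣E G ∣ ≤ e)

infix 4 g[_,_]≡_

-- The maximum of f a over lo ≤ a ≤ hi.  The base value 0 of `max` is returned
-- for an empty range and is otherwise immaterial.
max[_⋯_] : ℕ → ℕ → (ℕ → ℕ) → ℕ
max[ lo ⋯ hi ] f = max 0 (map f (filter (lo ≤?_) (upTo (suc hi))))

{-# OPTIONS --safe #-}
module Submission where

-- Write K = k + 1.  A vertex of a cycle C has at most K neighbours on C, since each but
-- two of them gives a chord.  By induction on the number of vertices we may assume that no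
-- vertex separates G.  Let C be a longest cycle, with c = 2a + ε vertices, and delete the
-- other vertices one by one, always one of smallest degree; let d be the largest degree
-- met.  From the graph met with minimum degree d one obtains a path of t vertices off C
-- which starts next to some u on C and whose end x has ν ≥ 1 neighbours on C other than u,
-- with d ≤ s := ν + t.  As C is longest, 2s ≤ c, and rotating C along this path shows that
-- s vertices of C, near u and after the neighbours of x, have average degree about a in
-- C, while the others have degree at most K.  So the r vertices off C and those on C yield
--     2e ≤ 2rs + (c − s)K + sa + ε,
-- which is linear in s for 0 ≤ s ≤ a: one end gives Kn, the other 2a(n − a) + a(K − a).
-- If 2d ≤ K, then 2e ≤ 2rd + cK suffices, and so it does if a ≥ K, since d ≤ K.
--
-- Conversely, K-regular graphs (up to one vertex), and complete bipartite graphs with a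
-- (K − a)-regular graph on the class of size a, attain the bounds: a cycle through the
-- latter class contains at most a vertices of the other, independent, class.

-- Bounding the degree sum 2e instead of e keeps floors out of the induction. Deleting vertices of
-- smallest degree serves twice: each deletion costs at most d edges, and at the worst moment every
-- remaining vertex off C has degree at least d, so the end x of a path that cannot be prolonged
-- there has d neighbours on the path or on C. The obstacle is that u may be the only neighbour of x
-- on C; then rotating C along the path yields nothing. The absence of a separating vertex helps
-- once more: the path is rerouted through x and all its neighbours so that it starts next to
-- another vertex of C. It then has at least d vertices. The average a comes from pairs of vertices
-- whose degrees on C add up to at most c, by a crossing argument as in Ore's theorem. The case
-- distinction on 2d gives K < 2d ≤ 2s ≤ 2a, which is the lower end of the range of a. The induction
-- derives a contradiction from failure of the bound, so that longest cycles and maximal paths are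
-- chosen under a double negation; the final inequality is decidable.

open import Defs
open import Data.Bool using (Bool; true; false; T; _∧_; if_then_else_)
open import Data.Bool.Properties using (T-∧)
open import Data.Empty using (⊥; ⊥-elim)
open import Data.Fin using (Fin; zero; suc; toℕ; fromℕ; inject₁) renaming (_<?_ to _<?ᶠ_)
open import Data.Fin.Properties using (_≟_; toℕ-injective; toℕ-fromℕ; toℕ-fromℕ<; toℕ-inject₁; toℕ<n) renaming (<-cmp to <-cmpᶠ)
open import Data.Fin.Relation.Unary.Top using (view; ‵fromℕ; ‵inject₁)
open import Data.List using (List; []; _∷_; _++_; length; take; drop; initLast; _∷ʳ′_; lookup; allFin; filter; map; tabulate; cartesianProduct; upTo)
open import Data.List.Extrema.Nat using (xs≤max; argmax-sel)
open import Data.List.Membership.Propositional using (_∈_; _∉_)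
open import Data.List.Membership.Propositional.Properties using (∈-∃++; ∈-++⁺ˡ; ∈-++⁺ʳ; ∈-++⁻; ∈-lookup; ∈-map⁺; ∈-map⁻; ∈-filter⁺; ∈-filter⁻; ∈-upTo⁺; ∈-upTo⁻)
open import Data.List.Properties using (length-++; ++-assoc; ++-identityʳ; take++drop≡id; length-take; length-tabulate; tabulate-lookup; map-tabulate)
open import Data.List.Relation.Binary.Permutation.Propositional using (_↭_; refl; prep; swap; ↭-refl; ↭-sym; ↭-trans) renaming (trans to transᵖ)
open import Data.List.Relation.Binary.Permutation.Propositional.Properties using (shift; ↭-length; ∈-resp-↭; ++-comm)
open import Data.List.Relation.Unary.All using () renaming (lookup to All-lookup)
open import Data.List.Relation.Unary.Any using (here; there)
open import Data.Nat using (ℕ; zero; suc; _+_; _*_; _∸_; _≤_; _<_; _⊔_; ∣_-_∣; z≤n; s≤s; _≤ᵇ_; _≤?_; _<?_; ⌊_/2⌋; ⌈_/2⌉) renaming (_≟_ to _≟ℕ_)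
open import Data.Nat.DivMod using (_%_; m%n<n; m<n⇒m%n≡m; n%n≡0)
open import Data.Nat.Properties hiding (_≟_; _≤?_; _<?_)
open import Data.Nat.Tactic.RingSolver using (solve-∀)
open import Data.Product using (Σ; ∃-syntax; _×_; _,_; proj₁; proj₂)
open import Data.Sum using (_⊎_; inj₁; inj₂)
open import Data.Vec using (Vec; []; _∷_; zipWith; replicate)
open import Data.Vec.N-ary using (N-ary; _$ⁿ_; ∀ⁿ; curryⁿ)
open import Function using (_∘_; id)
open import Function.Bundles using (module Equivalence)
open import Function.Definitions using (Injective)
open import Relation.Binary.Definitions using (tri<; tri≈; tri>)
open import Relation.Binary.PropositionalEquality using (_≡_; _≢_; refl; sym; trans; cong; cong₂; subst; subst₂)
open import Relation.Nullary using (¬_; Dec; yes; no; does; _×-dec_; _⊎-dec_)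
open import Relation.Nullary.Decidable using (decidable-stable)
open import Relation.Unary using (Decidable)
import Data.Vec as Vec

-- A checker for linear arithmetic over ℕ: a sequent is valid if, coefficient
-- by coefficient, the sum of its hypotheses l ≤ r entails its conclusion.

infixl 6 _:+_
data Expr (m : ℕ) : Set where
  var  : Fin m → Expr m
  con  : ℕ → Expr m
  _:+_ : Expr m → Expr m → Expr m

infix 5 _:≤_ _:≡_
data Hyp (m : ℕ) : Set where
  _:≤_ _:≡_ : Expr m → Expr m → Hyp m

infixr 4 _⇒_
infix 4 ⊢_
data Sequent (m : ℕ) : Set where
  ⊢_  : Hyp m → Sequent m
  _⇒_ : Hyp m → Sequent m → Sequent m

⟦_⟧ : ∀ {m} → Expr m → Vec ℕ m → ℕ
⟦ var i ⟧  ρ = Vec.lookup ρ i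
⟦ con k ⟧  ρ = k
⟦ a :+ b ⟧ ρ = ⟦ a ⟧ ρ + ⟦ b ⟧ ρ

⟦_⟧ʰ : ∀ {m} → Hyp m → Vec ℕ m → Set
⟦ a :≤ b ⟧ʰ ρ = ⟦ a ⟧ ρ ≤ ⟦ b ⟧ ρ
⟦ a :≡ b ⟧ʰ ρ = ⟦ a ⟧ ρ ≡ ⟦ b ⟧ ρ

⟦_⟧ˢ : ∀ {m} → Sequent m → Vec ℕ m → Set
⟦ ⊢ h ⟧ˢ   ρ = ⟦ h ⟧ʰ ρ
⟦ h ⇒ s ⟧ˢ ρ = ⟦ h ⟧ʰ ρ → ⟦ s ⟧ˢ ρ

Poly : ℕ → Set
Poly m = Vec ℕ (suc m)

value : ∀ {m} → Vec ℕ m → Vec ℕ m → ℕ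
value []      []      = 0
value (a ∷ p) (x ∷ ρ) = a * x + value p ρ

_⊞_ : ∀ {m} → Vec ℕ m → Vec ℕ m → Vec ℕ m
_⊞_ = zipWith _+_

unit : ∀ {m} → Fin m → Vec ℕ m
unit {suc m} zero    = 1 ∷ replicate m 0
unit {suc m} (suc i) = 0 ∷ unit i

coeffs : ∀ {m} → Expr m → Poly m
coeffs {m} (var i)  = 0 ∷ unit i
coeffs {m} (con k)  = k ∷ replicate m 0
coeffs {m} (a :+ b) = coeffs a ⊞ coeffs b

value-0 : ∀ {m} (ρ : Vec ℕ m) → value (replicate m 0) ρ ≡ 0
value-0 []      = refl
value-0 (x ∷ ρ) = value-0 ρ

value-unit : ∀ {m} i (ρ : Vec ℕ m) → value (unit i) ρ ≡ Vec.lookup ρ i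
value-unit zero    (x ∷ ρ) = trans (cong (x + 0 +_) (value-0 ρ)) (trans (+-identityʳ _) (+-identityʳ x))
value-unit (suc i) (x ∷ ρ) = value-unit i ρ

value-⊞ : ∀ {m} (p q ρ : Vec ℕ m) → value (p ⊞ q) ρ ≡ value p ρ + value q ρ
value-⊞ []      []      []      = refl
value-⊞ (a ∷ p) (b ∷ q) (x ∷ ρ) = trans (cong ((a + b) * x +_) (value-⊞ p q ρ))
    (arr a b x (value p ρ) (value q ρ))
  where
  arr : ∀ a b x v w → (a + b) * x + (v + w) ≡ a * x + v + (b * x + w)
  arr = solve-∀

value-coeffs : ∀ {m} (e : Expr m) ρ → value (coeffs e) (1 ∷ ρ) ≡ ⟦ e ⟧ ρ
value-coeffs (var i)  ρ = value-unit i ρ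
value-coeffs (con k)  ρ = trans (cong (k * 1 +_) (value-0 ρ)) (trans (+-identityʳ _) (*-identityʳ k))
value-coeffs (a :+ b) ρ = trans (value-⊞ (coeffs a) (coeffs b) (1 ∷ ρ))
    (cong₂ _+_ (value-coeffs a ρ) (value-coeffs b ρ))

dominated : ∀ {m} → Vec ℕ m → Vec ℕ m → Bool
dominated []      []      = true
dominated (a ∷ p) (b ∷ q) = (a ≤ᵇ b) ∧ dominated p q

dominated-sound : ∀ {m} (p q ρ : Vec ℕ m) → T (dominated p q) → value p ρ ≤ value q ρ
dominated-sound []      []      []      _ = ≤-refl
dominated-sound (a ∷ p) (b ∷ q) (x ∷ ρ) t with s , t′ ← Equivalence.to T-∧ t =
  +-mono-≤ (*-monoˡ-≤ x (≤ᵇ⇒≤ a b s)) (dominated-sound p q ρ t′)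

-- check L R s: the hypotheses met so far add up to L ≤ R.
check : ∀ {m} → Poly m → Poly m → Sequent m → Bool
check L R (a :≤ b ⇒ s) = check (coeffs a ⊞ L) (coeffs b ⊞ R) s
check L R (a :≡ b ⇒ s) = check (coeffs a ⊞ L) (coeffs b ⊞ R) s
check L R (⊢ a :≤ b)   = dominated (coeffs a ⊞ R) (coeffs b ⊞ L)
check L R (⊢ a :≡ b)   = false

add-sound : ∀ {m} (a b : Expr m) {L R} ρ → ⟦ a ⟧ ρ ≤ ⟦ b ⟧ ρ → value L (1 ∷ ρ) ≤ value R (1 ∷ ρ) →
            value (coeffs a ⊞ L) (1 ∷ ρ) ≤ value (coeffs b ⊞ R) (1 ∷ ρ)
add-sound a b {L} {R} ρ a≤b L≤R
  rewrite value-⊞ (coeffs a) L (1 ∷ ρ) | value-⊞ (coeffs b) R (1 ∷ ρ) | value-coeffs a ρ | value-coeffs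
      b ρ =
  +-mono-≤ a≤b L≤R

check-sound : ∀ {m} L R (s : Sequent m) ρ → T (check L R s) → value L (1 ∷ ρ) ≤ value R (1 ∷ ρ) → ⟦ s ⟧ˢ
    ρ
check-sound L R (a :≤ b ⇒ s) ρ t L≤R a≤b = check-sound _ _ s ρ t (add-sound a b ρ a≤b L≤R)
check-sound L R (a :≡ b ⇒ s) ρ t L≤R a≡b = check-sound _ _ s ρ t (add-sound a b ρ (≤-reflexive a≡b) L≤R)
check-sound L R (⊢ a :≤ b) ρ t L≤R = +-cancelʳ-≤ (value L (1 ∷ ρ)) _ _ (begin
  ⟦ a ⟧ ρ + value L (1 ∷ ρ)                 ≤⟨ +-monoʳ-≤ (⟦ a ⟧ ρ) L≤R ⟩
  ⟦ a ⟧ ρ + value R (1 ∷ ρ)                 ≡⟨ eq a R ⟨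
  value (coeffs a ⊞ R) (1 ∷ ρ)              ≤⟨ dominated-sound (coeffs a ⊞ R) (coeffs b ⊞ L) (1 ∷ ρ) t ⟩
  value (coeffs b ⊞ L) (1 ∷ ρ)              ≡⟨ eq b L ⟩
  ⟦ b ⟧ ρ + value L (1 ∷ ρ)                 ∎)
  where
  open ≤-Reasoning
  eq : ∀ e P → value (coeffs e ⊞ P) (1 ∷ ρ) ≡ ⟦ e ⟧ ρ + value P (1 ∷ ρ)
  eq e P = trans (value-⊞ (coeffs e) P (1 ∷ ρ)) (cong (_+ value P (1 ∷ ρ)) (value-coeffs e ρ))

variables : ∀ m → Vec (Expr m) m
variables m = Vec.map var (Vec.allFin m)

-- Each hypothesis enters with coefficient one, and an equation l ≡ r only as l ≤ r; hence the
-- repeated hypotheses and the oriented equations at the calls. Products are passed as variables.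
linear : ∀ m (f : N-ary m (Expr m) (Sequent m)) {t : T (check (replicate _ 0) (replicate _ 0)
    (f $ⁿ variables m))} →
         ∀ⁿ m (curryⁿ {n = m} (⟦ f $ⁿ variables m ⟧ˢ))
linear m f {t} = go m (λ ρ → check-sound _ _ (f $ⁿ variables m) ρ t (≤-reflexive refl))
  where
  go : ∀ k {P : Vec ℕ k → Set} → (∀ ρ → P ρ) → ∀ⁿ k (curryⁿ {n = k} P)
  go zero    p = p []
  go (suc k) p x = go k λ ρ → p (x ∷ ρ)

1≰0 : ¬ 1 ≤ 0
1≰0 ()

infixr 7 _⊕_
_⊕_ : ∀ {a b c d} → a ≤ b → c ≤ d → a + c ≤ b + d
_⊕_ = +-mono-≤

-- Sums and walks

∑ : {A : Set} → (A → ℕ) → List A → ℕ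
∑ g []      = 0
∑ g (x ∷ l) = g x + ∑ g l

module _ {A : Set} where

  ∑-++ : ∀ (g : A → ℕ) l m → ∑ g (l ++ m) ≡ ∑ g l + ∑ g m
  ∑-++ g []      m = refl
  ∑-++ g (x ∷ l) m = trans (cong (g x +_) (∑-++ g l m)) (sym (+-assoc (g x) (∑ g l) (∑ g m)))

  ∑-++₃ : ∀ (g : A → ℕ) a b c → ∑ g (a ++ b ++ c) ≡ ∑ g a + (∑ g b + ∑ g c)
  ∑-++₃ g a b c = trans (∑-++ g a (b ++ c)) (cong (∑ g a +_) (∑-++ g b c))

  ∑-++₄ : ∀ (g : A → ℕ) a b c d → ∑ g (a ++ b ++ c ++ d) ≡ ∑ g a + (∑ g b + (∑ g c + ∑ g d))
  ∑-++₄ g a b c d = trans (∑-++ g a (b ++ c ++ d)) (cong (∑ g a +_) (∑-++₃ g b c d))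

  length-∑ : ∀ (l : List A) → length l ≡ ∑ (λ _ → 1) l
  length-∑ []      = refl
  length-∑ (x ∷ l) = cong suc (length-∑ l)

  length-++₄ : ∀ (a b c d : List A) → length (a ++ b ++ c ++ d) ≡ length
      a + (length b + (length c + length d))
  length-++₄ a b c d = trans (length-++ a) (cong (length a +_)
      (trans (length-++ b) (cong (length b +_) (length-++ c))))

  ∑-↭ : ∀ (g : A → ℕ) {l m} → l ↭ m → ∑ g l ≡ ∑ g m
  ∑-↭ g refl = refl
  ∑-↭ g (prep x p) = cong (g x +_) (∑-↭ g p)
  ∑-↭ g (swap x y p) rewrite ∑-↭ g p = assoc-comm (g x) (g y) _
    where
    assoc-comm : ∀ a b c → a + (b + c) ≡ b + (a + c)
    assoc-comm = solve-∀
  ∑-↭ g (transᵖ p q) = trans (∑-↭ g p) (∑-↭ g q)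

  ∑-mono : ∀ {g h : A → ℕ} l → (∀ {x} → x ∈ l → g x ≤ h x) → ∑ g l ≤ ∑ h l
  ∑-mono []      le = z≤n
  ∑-mono (x ∷ l) le = le (here refl) ⊕ ∑-mono l λ x∈l → le (there x∈l)

  ∑-cong : ∀ {g h : A → ℕ} l → (∀ {x} → x ∈ l → g x ≡ h x) → ∑ g l ≡ ∑ h l
  ∑-cong []      eq = refl
  ∑-cong (x ∷ l) eq = cong₂ _+_ (eq (here refl)) (∑-cong l λ x∈l → eq (there x∈l))

  ∑-+ : ∀ (g h : A → ℕ) l → ∑ (λ x → g x + h x) l ≡ ∑ g l + ∑ h l
  ∑-+ g h []      = refl
  ∑-+ g h (x ∷ l) rewrite ∑-+ g h l = interchange (g x) (h x) (∑ g l) (∑ h l)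
    where
    interchange : ∀ a b c d → a + b + (c + d) ≡ a + c + (b + d)
    interchange = solve-∀

  ∑-* : ∀ (b : ℕ) (g : A → ℕ) l → ∑ (λ x → b * g x) l ≡ b * ∑ g l
  ∑-* b g []      = sym (*-zeroʳ b)
  ∑-* b g (x ∷ l) = trans (cong (b * g x +_) (∑-* b g l)) (sym (*-distribˡ-+ b (g x) (∑ g l)))

  ∑-const : ∀ (b : ℕ) (l : List A) → ∑ (λ _ → b) l ≡ length l * b
  ∑-const b []      = refl
  ∑-const b (x ∷ l) = cong (b +_) (∑-const b l)

  ∑-≤ : ∀ {g : A → ℕ} {b} l → (∀ {x} → x ∈ l → g x ≤ b) → ∑ g l ≤ length l * b
  ∑-≤ {b = b} l le = ≤-trans (∑-mono l le) (≤-reflexive (∑-const b l))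

  ∑-≡0 : ∀ {g : A → ℕ} l → (∀ {x} → x ∈ l → g x ≡ 0) → ∑ g l ≡ 0
  ∑-≡0 l eq = trans (∑-cong l eq) (trans (∑-const 0 l) (*-zeroʳ (length l)))

  ∈⇒≤∑ : ∀ (g : A → ℕ) {x l} → x ∈ l → g x ≤ ∑ g l
  ∈⇒≤∑ g (here refl)     = m≤m+n _ _
  ∈⇒≤∑ g (there {y} x∈l) = ≤-trans (∈⇒≤∑ g x∈l) (m≤n+m _ (g y))

∑-swap : ∀ {A B : Set} (g : A → B → ℕ) l m →
         ∑ (λ x → ∑ (g x) m) l ≡ ∑ (λ y → ∑ (λ x → g x y) l) m
∑-swap g []      m = sym (∑-≡0 m λ _ → refl)
∑-swap g (x ∷ l) m = trans (cong (∑ (g x) m +_) (∑-swap g l m))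
                           (sym (∑-+ (g x) (λ y → ∑ (λ x → g x y) l) m))

-- Indicators, multiplicities and walks in a graph

𝟙 : ∀ {P : Set} → Dec P → ℕ
𝟙 p? = if does p? then 1 else 0

module _ {P : Set} where

  𝟙≤1 : (p? : Dec P) → 𝟙 p? ≤ 1
  𝟙≤1 (yes _) = s≤s z≤n
  𝟙≤1 (no _)  = z≤n

  𝟙-yes : (p? : Dec P) → P → 𝟙 p? ≡ 1
  𝟙-yes (yes _) p = refl
  𝟙-yes (no ¬p) p = ⊥-elim (¬p p)

  𝟙-no : (p? : Dec P) → ¬ P → 𝟙 p? ≡ 0
  𝟙-no (yes p) ¬p = ⊥-elim (¬p p)
  𝟙-no (no _)  ¬p = refl

  𝟙-pos : (p? : Dec P) → 1 ≤ 𝟙 p? → P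
  𝟙-pos (yes p) _ = p

𝟙-cong : ∀ {P Q : Set} (p? : Dec P) (q? : Dec Q) → (P → Q) → (Q → P) → 𝟙 p? ≡ 𝟙 q?
𝟙-cong (yes p) q? f g = sym (𝟙-yes q? (f p))
𝟙-cong (no ¬p) q? f g = sym (𝟙-no q? λ q → ¬p (g q))

module _ {n : ℕ} where

  δ : Fin n → Fin n → ℕ
  δ z w = 𝟙 (z ≟ w)

  δ-refl : ∀ z → δ z z ≡ 1
  δ-refl z = 𝟙-yes (z ≟ z) refl

  cnt : Fin n → List (Fin n) → ℕ
  cnt z = ∑ (δ z)

  ∈⇒cnt : ∀ {z l} → z ∈ l → 1 ≤ cnt z l
  ∈⇒cnt {z} z∈l = ≤-trans (≤-reflexive (sym (δ-refl z))) (∈⇒≤∑ (δ z) z∈l)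

  cnt⇒∈ : ∀ {z} l → 1 ≤ cnt z l → z ∈ l
  cnt⇒∈ {z} (x ∷ l) le with z ≟ x
  ... | yes refl = here refl
  ... | no _     = there (cnt⇒∈ l le)

  infix 4 _⊑_
  -- Inclusion of multisets. For a duplicate-free `m` it says at once that `l` has no repetition and
  -- lies in `m`; in this form disjointness is a linear inequality between multiplicities.
  _⊑_ : List (Fin n) → List (Fin n) → Set
  l ⊑ m = ∀ z → cnt z l ≤ cnt z m

  ⊑⇒∈ : ∀ {l m z} → l ⊑ m → z ∈ l → z ∈ m
  ⊑⇒∈ {m = m} {z} l⊑m z∈l = cnt⇒∈ m (≤-trans (∈⇒cnt z∈l) (l⊑m z))

module Walks {n : ℕ} (G : Graph n) where

  open Graph G

  V : Set
  V = Fin n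

  N : V → V → ℕ
  N u v = 𝟙 (u ~? v)

  N≤1 : ∀ u v → N u v ≤ 1
  N≤1 u v = 𝟙≤1 (u ~? v)

  N-adj : ∀ {u v} → u ~ v → N u v ≡ 1
  N-adj {u} {v} = 𝟙-yes (u ~? v)

  N-nonadj : ∀ {u v} → ¬ u ~ v → N u v ≡ 0
  N-nonadj {u} {v} = 𝟙-no (u ~? v)

  N-pos : ∀ {u v} → 1 ≤ N u v → u ~ v
  N-pos {u} {v} = 𝟙-pos (u ~? v)

  N-irrefl : ∀ v → N v v ≡ 0
  N-irrefl v = N-nonadj (~-irrefl refl)

  N-sym : ∀ u v → N u v ≡ N v u
  N-sym u v with u ~? v
  ... | yes u~v = sym (N-adj (~-sym u~v))
  ... | no ¬u~v = sym (N-nonadj λ v~u → ¬u~v (~-sym v~u))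

  ~⇒≢ : ∀ {u v} → u ~ v → u ≢ v
  ~⇒≢ u~v refl = ~-irrefl refl u~v

  -- A walk from u to v; the list holds its vertices except the last one, v.
  -- So composition of walks is _++_, and a closed walk without repetition,
  -- Walk u l u, is a cycle with vertex list l (or an edge, if length l ≡ 2).
  data Walk : V → List V → V → Set where
    []  : ∀ {v} → Walk v [] v
    _∷_ : ∀ {u v l w} → u ~ v → Walk v l w → Walk u (u ∷ l) w

  infixr 5 _⋯_
  _⋯_ : ∀ {u l v m w} → Walk u l v → Walk v m w → Walk u (l ++ m) w
  []      ⋯ q = q
  (e ∷ p) ⋯ q = e ∷ (p ⋯ q)

  edge : ∀ {u v} → u ~ v → Walk u (u ∷ []) v
  edge e = e ∷ []

  split : ∀ {u v} l {m} → Walk u (l ++ m) v → ∃[ w ] (Walk u l w × Walk w m v)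
  split []      p       = _ , [] , p
  split (x ∷ l) (e ∷ p) with w , q , r ← split l p = w , e ∷ q , r

  head≡ : ∀ {u v w l} → Walk u (w ∷ l) v → w ≡ u
  head≡ (_ ∷ _) = refl

  uncons-walk : ∀ {u v w l} → Walk u (w ∷ l) v → ∃[ y ] (u ~ y × Walk y l v)
  uncons-walk (e ∷ p) = _ , e , p

  splitAt∈ : ∀ {u v l w} → Walk u l v → w ∈ l →
             ∃[ l₁ ] ∃[ l₂ ] (l ≡ l₁ ++ w ∷ l₂ × Walk u l₁ w × Walk w (w ∷ l₂) v)
  splitAt∈ p w∈l with l₁ , l₂ , refl ← ∈-∃++ w∈l with _ , q , r ← split l₁ p with refl ← head≡ r
    = l₁ , l₂ , refl , q , r

  lastNbr : ∀ x m → 1 ≤ ∑ (N x) m → ∃[ m₁ ] ∃[ v ] ∃[ m₂ ] (m ≡ m₁ ++ v ∷ m₂ × x ~ v × ∑ (N x) m₂ ≡ 0)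
  lastNbr x (y ∷ m) le with 1 ≤? ∑ (N x) m
  ... | yes le′ with m₁ , v , m₂ , refl , x~v , eq ← lastNbr x m le′ = y ∷ m₁ , v , m₂ , refl , x~v , eq
  ... | no ¬le′ = [] , y , m , refl ,
    N-pos (subst (1 ≤_) (trans (cong (N x y +_) (n<1⇒n≡0 (≰⇒> ¬le′))) (+-identityʳ _)) le) , n<1⇒n≡0
        (≰⇒> ¬le′)

  -- A walk omits its last vertex, so reversal exchanges u for v in the list. Stating this for every
  -- weight g covers multiplicities and degree sums alike.
  reverse-walk : ∀ {u l v} → Walk u l v →
                 ∃[ l′ ] (Walk v l′ u × length l′ ≡ length l × (∀ g → ∑ g l′ + g u ≡ ∑ g l + g v))
  reverse-walk []                              = [] , [] , refl , λ _ → refl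
  reverse-walk (_∷_ {u} {v} {l} {w} e p) with l′ , p′ , len , eq ← reverse-walk p =
    l′ ++ v ∷ [] , p′ ⋯ edge (~-sym e) ,
    trans (length-++ l′) (trans (+-comm (length l′) 1) (cong suc len)) ,
    λ g → trans (cong (_+ g u) (∑-++ g l′ (v ∷ [])))
      (trans (arr₁ (∑ g l′) (g v) (g u)) (trans (cong (g u +_) (eq g)) (arr₂ (g u) (∑ g l) (g w))))
    where
    arr₁ : ∀ a b c → a + (b + 0) + c ≡ c + (a + b)
    arr₁ = solve-∀
    arr₂ : ∀ a b c → a + (b + c) ≡ a + b + c
    arr₂ = solve-∀

  -- Sum over the edges of the walk: their tails run through `l`, their heads through `l` with s
  -- removed and v added.
  ∑-pairs : ∀ (h g : V → ℕ) κ {s l v} → Walk s l v →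
            (∀ l₁ {x y l₂} → l ≡ l₁ ++ x ∷ l₂ → Walk s l₁ x → x ~ y → Walk y l₂ v → h x + g y ≤ κ) →
            ∑ h l + (∑ g l + g v) ≤ length l * κ + g s
  ∑-pairs h g κ []                           pr = ≤-refl
  ∑-pairs h g κ (_∷_ {s} {w} {l} {v} e p) pr =
    linear 8 (λ hs hl gs gl gv k lk gw → hs :+ gw :≤ k ⇒ hl :+ (gl :+ gv) :≤ lk :+ gw ⇒
                                         ⊢ hs :+ hl :+ (gs :+ gl :+ gv) :≤ k :+ lk :+ gs)
      (h s) (∑ h l) (g s) (∑ g l) (g v) κ (length l * κ) (g w)
      (pr [] refl [] e p) (∑-pairs h g κ p λ l₁ eq q e′ r → pr (s ∷ l₁) (cong (s ∷_) eq) (e ∷ q) e′ r)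

-- Degree sums of two vertices across a bridge of a longest cycle

module Longest {n : ℕ} (G : Graph n) (U C : List (Fin n))
  (longest : ∀ {v l} → Walks.Walk G v l v → l ⊑ U → length l ≤ length C) where

  open Graph G
  open Walks G

  -- A cycle u ⋯ s ⋯ v ⋯ s′ ⋯ u with vertex list C, together with a path E
  -- from u to v which is internally disjoint from C and has more inner vertices
  -- than lie between u and s and between v and s′ altogether.
  record Bridge (u v s s′ : V) : Set where
    field
      {I A J B E} : List V
      pI     : Walk u (u ∷ I) s
      pA     : Walk s A v
      pJ     : Walk v (v ∷ J) s′
      pB     : Walk s′ B u
      pE     : Walk u E v
      ∑C     : ∀ g → ∑ g C ≡ g u + ∑ g I + (∑ g A + (g v + ∑ g J + ∑ g B))
      length-C : length C ≡ suc (length I) + (length A + (suc (length J) + length B))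
      long   : suc (length I) + suc (length J) ≤ length E
      inside : ∀ z → cnt z E + cnt z C ≤ cnt z U + δ z u

  open Bridge

  -- This symmetry exchanges the roles of s and s′, so each exclusion below is proved for one side
  -- only.
  flip : ∀ {u v s s′} → Bridge u v s s′ → Bridge v u s′ s
  flip {u} {v} b with E′ , pE′ , len , eq ← reverse-walk (pE b) = record
    { pI = pJ b ; pA = pB b ; pJ = pI b ; pB = pA b ; pE = pE′
    ; ∑C = λ g → trans (∑C b g) (arr (g u) (∑ g (I b)) (∑ g (A b)) (g v) (∑ g (J b)) (∑ g (B b)))
    ; length-C = trans (length-C b) (arr 1 (length (I b)) (length (A b)) 1 (length (J b))
        (length (B b)))
    ; long = subst (suc (length (J b)) + suc (length (I b)) ≤_) (sym len)
               (≤-trans (≤-reflexive (+-comm (suc (length (J b))) _)) (long b))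
    ; inside = λ z → linear 6 (λ E′ C E v U u → E′ :+ u :≡ E :+ v ⇒
        E :+ C :≤ U :+ u ⇒ ⊢ E′ :+ C :≤ U :+ v)
        (cnt z E′) (cnt z C) (cnt z (E b)) (δ z v) (cnt z U) (δ z u) (eq (δ z)) (inside b z) }
    where
    arr : ∀ u I A v J B → u + I + (A + (v + J + B)) ≡ v + J + (B + (u + I + A))
    arr = solve-∀

  -- Otherwise take A from s to v, E back to u, then B and J₂ backwards to w, and return to s. This
  -- cycle omits only I and J₁, which together are shorter than the inside of E.
  no-jump : ∀ {u v s s′} (b : Bridge u v s s′) J₁ {w J₂} → J b ≡ J₁ ++ J₂ →
            Walk w J₂ s′ → ¬ s ~ w
  no-jump {u} {v} {s} b J₁ {w} {J₂} eqJ r s~w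
    with E′ , pE′ , lenE , eqE ← reverse-walk (pE b)
       | F , pF , lenF , eqF ← reverse-walk (r ⋯ pB b)
    = 1≰0 (linear 10 (λ x A E′ F E C I J J₂ B → A :+ (E′ :+ (F :+ con 1)) :≡ x ⇒ x :≤ C ⇒
             con 1 :+ I :+ (con 1 :+ J) :≤ E ⇒ C :≡ con 1 :+ I :+ (A :+ (con 1 :+ J :+ B)) ⇒
             E :≡ E′ ⇒ J₂ :+ B :≡ F ⇒ ⊢ con 1 :≤ con 0)
             (length cycle) (length (A b)) (length E′) (length F) (length (E b)) (length C)
                 (length (I b))
             (length (J b)) (length J₂) (length (B b))
             (sym (length-++₄ (A b) E′ F (w ∷ []))) (longest closed inU) (long b) (length-C b)
             (sym lenE) (sym (trans lenF (length-++ J₂))))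
    where
    cycle : List V
    cycle = A b ++ E′ ++ F ++ w ∷ []
    closed : Walk s cycle s
    closed = pA b ⋯ pE′ ⋯ pF ⋯ edge (~-sym s~w)
    inU : cycle ⊑ U
    inU z = linear 15 (λ x A E′ F w E C U u v I J₁ J₂ J B → x :≡ A :+ (E′ :+ (F :+ (w :+ con 0))) ⇒
        E′ :+ u :≡ E :+ v ⇒ F :+ w :≡ J₂ :+ B :+ u ⇒ E :+ C :≤ U :+ u ⇒
        u :+ I :+ (A :+ (v :+ J :+ B)) :≡ C ⇒ J₁ :+ J₂ :≡ J ⇒ ⊢ x :≤ U)
      (cnt z cycle) (cnt z (A b)) (cnt z E′) (cnt z F) (δ z w) (cnt z (E b)) (cnt z C) (cnt z U) (δ z u)
          (δ z v)
      (cnt z (I b)) (cnt z J₁) (cnt z J₂) (cnt z (J b)) (cnt z (B b))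
      (∑-++₄ (δ z) (A b) E′ F (w ∷ [])) (eqE (δ z)) (trans (eqF (δ z))
          (cong (_+ δ z u) (∑-++ (δ z) J₂ (B b))))
      (inside b z) (sym (∑C b (δ z))) (sym (trans (cong (cnt z) eqJ) (∑-++ (δ z) J₁ J₂)))

  -- Otherwise A₁ from s to x, the edge to s′, then B, E, A₂ backwards to y and the edge to s form a
  -- cycle that omits only I and J.
  no-crossing : ∀ {u v s s′} (b : Bridge u v s s′) A₁ {x y A₂} → A b ≡ A₁ ++ x ∷ A₂ →
                Walk s A₁ x → Walk y A₂ v → s′ ~ x → ¬ s ~ y
  no-crossing {u} {v} {s} {s′} b A₁ {x} {y} {A₂} eqA q r s′~x s~y
    with F , pF , lenF , eqF ← reverse-walk r
    = 1≰0 (linear 10 (λ l A₁ B E F A₂ C A I J → A₁ :+ (con 1 :+ B :+ (E :+ (F :+ con 1))) :≡ l ⇒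
        l :≤ C ⇒
             con 1 :+ I :+ (con 1 :+ J) :≤ E ⇒ C :≡ con 1 :+ I :+ (A :+ (con 1 :+ J :+ B)) ⇒
             A₂ :≡ F ⇒ A :≡ A₁ :+ (con 1 :+ A₂) ⇒ ⊢ con 1 :≤ con 0)
             (length cycle) (length A₁) (length (B b)) (length (E b)) (length F) (length A₂) (length C)
             (length (A b)) (length (I b)) (length (J b))
             (sym (trans (length-++₄ A₁ (x ∷ B b) (E b) (F ++ y ∷ []))
                 (cong (λ k → length A₁ + (suc (length (B b)) + (length (E b) + k))) (length-++ F))))
                 (longest closed inU) (long b) (length-C b)
             (sym lenF) (trans (cong length eqA) (length-++ A₁)))
    where
    cycle : List V
    cycle = A₁ ++ x ∷ B b ++ E b ++ F ++ y ∷ []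
    closed : Walk s cycle s
    closed = q ⋯ (~-sym s′~x ∷ (pB b ⋯ pE b ⋯ pF ⋯ edge (~-sym s~y)))
    inU : cycle ⊑ U
    inU z = linear 16 (λ l t A₁ x B E F y A₂ v U u C A I J → l :≡ A₁ :+ (x :+ B :+ (E :+ t)) ⇒
        t :≡ F :+ (y :+ con 0) ⇒
        F :+ y :≡ A₂ :+ v ⇒ E :+ C :≤ U :+ u ⇒ u :+ I :+ (A :+ (v :+ J :+ B)) :≡ C ⇒
        A₁ :+ (x :+ A₂) :≡ A ⇒ ⊢ l :≤ U)
      (cnt z cycle) (cnt z (F ++ y ∷ [])) (cnt z A₁) (δ z x) (cnt z (B b)) (cnt z (E b)) (cnt z F)
          (δ z y) (cnt z A₂) (δ z v)
      (cnt z U) (δ z u) (cnt z C) (cnt z (A b)) (cnt z (I b)) (cnt z (J b))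
      (∑-++₄ (δ z) A₁ (x ∷ B b) (E b) (F ++ y ∷ [])) (∑-++ (δ z) F (y ∷ [])) (eqF (δ z)) (inside b z)
          (sym (∑C b (δ z)))
      (sym (trans (cong (cnt z) eqA) (∑-++ (δ z) A₁ (x ∷ A₂))))

  deg : V → ℕ
  deg w = ∑ (N w) C

  J-nonadj : ∀ {u v s s′} (b : Bridge u v s s′) → ∑ (N s) (J b) ≡ 0
  J-nonadj {s = s} b = ∑-≡0 (J b) λ {w} w∈J → N-nonadj (nonadj w∈J)
    where
    nonadj : ∀ {w} → w ∈ J b → ¬ s ~ w
    nonadj w∈J with pJ b
    ... | _ ∷ p with J₁ , J₂ , eq , _ , r ← splitAt∈ p w∈J = no-jump b J₁ eq r

  -- For each edge of the arc, its tail is not adjacent to s′ or its head is not adjacent to s. The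
  -- boundary term of `∑-pairs` vanishes since s is not adjacent to itself.
  A-pairs : ∀ {u v s s′} (b : Bridge u v s s′) →
            ∑ (N s′) (A b) + (∑ (N s) (A b) + N s v) ≤ length (A b)
  A-pairs {u} {v} {s} {s′} b = ≤-trans (∑-pairs (N s′) (N s) 1 (pA b) pair)
      (≤-reflexive (trans (cong (length (A b) * 1 +_) (N-irrefl s))
          (trans (+-identityʳ _) (*-identityʳ _))))
    where
    pair : ∀ l₁ {x y l₂} → A b ≡ l₁ ++ x ∷ l₂ → Walk s l₁ x → x ~ y → Walk y l₂ v → N s′ x + N s y ≤ 1
    pair l₁ {x} {y} eq q _ r with s′ ~? x
    ... | no _     = N≤1 s y
    ... | yes s′~x = ≤-reflexive (cong (1 +_) (N-nonadj (no-crossing b l₁ eq q r s′~x)))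

  -- The arcs A and B, with v and u as neighbours of s and s′ respectively, contribute at most their
  -- lengths. What remains is u and I for s, and v and J for s′, since s has no neighbour in J and
  -- s′ none in I.
  bridge-deg-sum : ∀ {u v s s′} → Bridge u v s s′ → deg s + deg s′ ≤ length C
  bridge-deg-sum {u} {v} {s} {s′} b = linear 19
    (λ ds ds′ c su sI sA sv sJ sB ru rI rA rv rJ rB i a j b →
      rA :+ (sA :+ sv) :≤ a ⇒ sB :+ (rB :+ ru) :≤ b ⇒ sJ :≡ con 0 ⇒ rI :≡ con 0 ⇒
      su :≤ con 1 ⇒ sI :≤ i ⇒ rv :≤ con 1 ⇒ rJ :≤ j ⇒
      ds :≡ su :+ sI :+ (sA :+ (sv :+ sJ :+ sB)) ⇒ ds′ :≡ ru :+ rI :+ (rA :+ (rv :+ rJ :+ rB)) ⇒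
      con 1 :+ i :+ (a :+ (con 1 :+ j :+ b)) :≡ c ⇒ ⊢ ds :+ ds′ :≤ c)
    (deg s) (deg s′) (length C) (N s u) (∑ (N s) (I b)) (∑ (N s) (A b)) (N s v) (∑ (N s) (J b))
        (∑ (N s) (B b))
    (N s′ u) (∑ (N s′) (I b)) (∑ (N s′) (A b)) (N s′ v) (∑ (N s′) (J b)) (∑ (N s′) (B b))
    (length (I b)) (length (A b)) (length (J b)) (length (B b))
    (A-pairs b) (A-pairs (flip b)) (J-nonadj b) (J-nonadj (flip b))
    (N≤1 s u) (N-count s (I b)) (N≤1 s′ v) (N-count s′ (J b)) (∑C b (N s)) (∑C b (N s′))
        (sym (length-C b))
    where
    N-count : ∀ w l → ∑ (N w) l ≤ length l
    N-count w l = ≤-trans (∑-≤ l λ _ → N≤1 w _) (≤-reflexive (*-identityʳ _))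

-- The degree sum of a longest cycle

-- The head of `T` is matched with the last entry of `Q`, so the offsets in each pair add up to k -
-- 1, the most that a path with k inner vertices may bypass.
∑-pair : ∀ {A : Set} (D : A → ℕ) c k T Q → length T ≡ k → length Q ≡ k →
         (∀ T₁ {s T₂} Q₁ {s′ Q₂} → T ≡ T₁ ++ s ∷ T₂ → Q ≡ Q₁ ++ s′ ∷ Q₂ →
            suc (length T₁ + length Q₁) ≡ k → D s + D s′ ≤ c) →
         ∑ D T + ∑ D Q ≤ k * c
∑-pair D c zero    []      []  _    _    _    = z≤n
∑-pair D c (suc k) (s ∷ T) Q   lenT lenQ pair with initLast Q
... | Q₁ ∷ʳ′ s′ = linear 7 (λ ds ds′ T Q₁ c kc Q → Q :≡ Q₁ :+ (ds′ :+ con 0) ⇒ ds :+ ds′ :≤ c ⇒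
    T :+ Q₁ :≤ kc ⇒
                           ⊢ ds :+ T :+ Q :≤ c :+ kc)
      (D s) (D s′) (∑ D T) (∑ D Q₁) c (k * c) (∑ D (Q₁ ++ s′ ∷ []))
      (∑-++ D Q₁ (s′ ∷ [])) (pair [] Q₁ refl refl (cong suc lenQ₁))
      (∑-pair D c k T Q₁ (suc-injective lenT) lenQ₁ λ T₁ Q₂ {s″} {Q₃} eqT eqQ len →
        pair (s ∷ T₁) Q₂ (cong (s ∷_) eqT) (trans (cong (_++ s′ ∷ []) eqQ)
            (++-assoc Q₂ (s″ ∷ Q₃) (s′ ∷ [])))
             (cong suc len))
  where
  lenQ₁ : length Q₁ ≡ k
  lenQ₁ = suc-injective (trans (trans (+-comm 1 _) (sym (length-++ Q₁))) lenQ)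

splitLength : ∀ {A : Set} k (l : List A) → k ≤ length l → ∃[ a ] ∃[ b ] (l ≡ a ++ b × length a ≡ k)
splitLength k l le = take k l , drop k l , sym (take++drop≡id k l) , trans (length-take k l)
    (m≤n⇒m⊓n≡m le)

module Config {n : ℕ} (G : Graph n) (U : List (Fin n)) (u : Fin n) (l : List (Fin n)) (x : Fin n)
    (τ : List (Fin n))
  (closed : Walks.Walk G u (u ∷ l) u)
  (longest : ∀ {v m} → Walks.Walk G v m v → m ⊑ U → length m ≤ length (u ∷ l))
  (tail : Walks.Walk G x (x ∷ τ) u)
  (outside : ∀ z → cnt z (x ∷ τ) + cnt z (u ∷ l) ≤ cnt z U)
  (attached : 1 ≤ ∑ (Walks.N G x) l) where

  open Graph G
  open Walks G
  open Longest G U (u ∷ l) longest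

  t ν c : ℕ
  t = length (x ∷ τ)
  ν = ∑ (N x) l
  c = length (u ∷ l)

  ear : ∀ {v} → x ~ v → ∃[ E ] (Walk u E v × length E ≡ suc t × ∀ g → ∑ g E ≡ g u + ∑ g (x ∷ τ))
  ear {v} x~v with E , pE , len , eq ← reverse-walk tail =
    E ++ x ∷ [] , pE ⋯ edge x~v , trans (length-++ E) (trans (+-comm (length E) 1) (cong suc len)) ,
    λ g → trans (∑-++ g E (x ∷ [])) (trans (cong (∑ g E +_) (+-identityʳ (g x)))
      (trans (eq g) (+-comm (∑ g (x ∷ τ)) (g u))))

  -- Replacing the arc P by the t vertices of the ear must not lengthen the cycle.
  gap-before : ∀ {P w S} → l ≡ P ++ S → Walk w S u → x ~ w → t ≤ length P
  gap-before {P} {w} {S} eq q x~w with E , pE , len , ∑E ← ear x~w =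
    linear 6 (λ SE S E c P t → S :+ E :≡ SE ⇒ SE :≤ con 1 :+ c ⇒ con 1 :+ t :≡ E ⇒
        c :≡ P :+ S ⇒ ⊢ t :≤ P)
      (length (S ++ E)) (length S) (length E) (length l) (length P) t
      (sym (length-++ S)) (longest (q ⋯ pE) inU) (sym len) (trans (cong length eq) (length-++ P))
    where
    inU : S ++ E ⊑ U
    inU z = linear 8 (λ SE S E u τ P l U → SE :≡ S :+ E ⇒ E :≡ u :+ τ ⇒ P :+ S :≡ l ⇒
        τ :+ (u :+ l) :≤ U ⇒ ⊢ SE :≤ U)
      (cnt z (S ++ E)) (cnt z S) (cnt z E) (δ z u) (cnt z (x ∷ τ)) (cnt z P) (cnt z l) (cnt z U)
      (∑-++ (δ z) S E) (∑E (δ z)) (sym (trans (cong (cnt z) eq) (∑-++ (δ z) P S))) (outside z)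

  gap-after : ∀ {P w S} → l ≡ P ++ w ∷ S → Walk u (u ∷ P) w → x ~ w → t ≤ length S
  gap-after {P} {w} {S} eq p x~w =
    linear 5 (λ X P t l S → con 1 :+ P :+ (con 1 :+ t) :≡ X ⇒ X :≤ con 1 :+ l ⇒
        l :≡ P :+ (con 1 :+ S) ⇒ ⊢ t :≤ S)
      (length (u ∷ P ++ w ∷ x ∷ τ)) (length P) t (length l) (length S)
      (sym (cong suc (length-++ P))) (longest (p ⋯ (~-sym x~w ∷ tail)) inU)
          (trans (cong length eq) (length-++ P))
    where
    inU : u ∷ P ++ w ∷ x ∷ τ ⊑ U
    inU z = linear 8 (λ X P w τ u l S U → X :≡ P :+ (w :+ τ) ⇒ P :+ (w :+ S) :≡ l ⇒
        τ :+ (u :+ l) :≤ U ⇒ ⊢ u :+ X :≤ U)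
      (cnt z (P ++ w ∷ x ∷ τ)) (cnt z P) (δ z w) (cnt z (x ∷ τ)) (δ z u) (cnt z l) (cnt z S) (cnt z U)
      (∑-++ (δ z) P _) (sym (trans (cong (cnt z) eq) (∑-++ (δ z) P (w ∷ S)))) (outside z)

  -- Otherwise x could be inserted between p and q.
  isolated : ∀ {P p S q} → u ∷ l ≡ P ++ p ∷ S → Walk u P p → Walk q S u → x ~ p → ¬ x ~ q
  isolated {P} {p} {S} {q} eq r r′ x~p x~q = 1≰0
    (linear 4 (λ X P S c → P :+ (con 2 :+ S) :≡ X ⇒ X :≤ c ⇒ c :≡ P :+ (con 1 :+ S) ⇒ ⊢ con 1 :≤ con 0)
      (length (P ++ p ∷ x ∷ S)) (length P) (length S) c
      (sym (length-++ P)) (longest (r ⋯ (~-sym x~p ∷ x~q ∷ r′)) inU)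
          (trans (cong length eq) (length-++ P)))
    where
    inU : P ++ p ∷ x ∷ S ⊑ U
    inU z = linear 8 (λ X P p x S C τ U → X :≡ P :+ (p :+ (x :+ S)) ⇒ P :+ (p :+ S) :≡ C ⇒
        x :+ τ :+ C :≤ U ⇒ ⊢ X :≤ U)
      (cnt z (P ++ p ∷ x ∷ S)) (cnt z P) (δ z p) (δ z x) (cnt z S) (cnt z (u ∷ l)) (cnt z τ) (cnt z U)
      (∑-++ (δ z) P _) (sym (trans (cong (cnt z) eq) (∑-++ (δ z) P (p ∷ S)))) (outside z)

  bridge-tail : ∀ {I s A v J s′ B} → u ∷ l ≡ (u ∷ I) ++ A ++ (v ∷ J) ++ B → Walk u (u ∷ I) s → Walk s A
      v →
                Walk v (v ∷ J) s′ → Walk s′ B u → x ~ v → suc (length I + length J) ≤ t → deg s + deg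
                    s′ ≤ c
  bridge-tail {I} {s} {A} {v} {J} {s′} {B} eq pI pA pJ pB x~v short with E , pE , len , ∑E ← ear
      x~v = bridge-deg-sum {u} {v} {s} {s′} record
    { pI = pI ; pA = pA ; pJ = pJ ; pB = pB ; pE = pE
    ; ∑C = λ g → trans (cong (∑ g) eq) (∑-++₄ g (u ∷ I) A (v ∷ J) B)
    ; length-C = trans (cong length eq) (length-++₄ (u ∷ I) A (v ∷ J) B)
    ; long = linear 4 (λ i j t E → con 1 :+ (i :+ j) :≤ t ⇒ con 1 :+ t :≡ E ⇒ ⊢ con
        1 :+ i :+ (con 1 :+ j) :≤ E)
               (length I) (length J) t (length E) short (sym len)
    ; inside = λ z → linear 5 (λ E u τ C U → E :≡ u :+ τ ⇒ τ :+ C :≤ U ⇒ ⊢ E :+ C :≤ U :+ u)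
               (cnt z E) (δ z u) (cnt z (x ∷ τ)) (cnt z (u ∷ l)) (cnt z U) (∑E (δ z)) (outside z) }

  -- The path p, x, p′ has a single inner vertex. This is enough since q and q′ follow p and p′
  -- immediately, so both bypassed arcs are empty.
  bridge-x : ∀ {p q A p′ q′ B} → (∀ g → ∑ g (u ∷ l) ≡ g p + (∑ g A + (g p′ + ∑ g B))) → p ~ q → Walk q A
      p′ →
             p′ ~ q′ → Walk q′ B p → x ~ p → x ~ p′ → deg q + deg q′ ≤ c
  bridge-x {p} {q} {A} {p′} {q′} {B} ∑C p~q pA p′~q′ pB x~p x~p′ = bridge-deg-sum {p} {p′} {q} {q′}
      record
    { pI = edge p~q ; pA = pA ; pJ = edge p′~q′ ; pB = pB ; pE = ~-sym x~p ∷ edge x~p′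
    ; ∑C = λ g → trans (∑C g) (arr (g p) (∑ g A) (g p′) (∑ g B))
    ; length-C = trans (length-∑ (u ∷ l)) (trans (∑C (λ _ → 1))
        (cong₂ (λ i j → suc (i + suc j)) (sym (length-∑ A)) (sym (length-∑ B))))
    ; long = ≤-refl
    ; inside = λ z → linear 5 (λ p x τ C U → x :+ τ :+ C :≤ U ⇒ ⊢ p :+ (x :+ con 0) :+ C :≤ U :+ p)
        (δ z p) (δ z x) (cnt z τ) (cnt z (u ∷ l)) (cnt z U) (outside z) }
    where
    arr : ∀ p A p′ B → p + (A + (p′ + B)) ≡ p + 0 + (A + (p′ + 0 + B))
    arr = solve-∀

  split-eq : ∀ {a b m} m₁ {m₂} → m ≡ m₁ ++ m₂ → Walk a m b → ∃[ w ] (Walk a m₁ w × Walk w m₂ b)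
  split-eq m₁ refl p = split m₁ p

  -- A neighbour of x among the first t vertices would be too close to u for `gap-before`.
  free-start : ∀ {P w S} → l ≡ P ++ S → Walk w S u → x ~ w →
           ∃[ T ] ∃[ Y ] (P ≡ T ++ Y × length T ≡ t × ∑ (N x) T ≡ 0)
  free-start {P} {w} {S} eq q x~w with T , Y , eqP , len ← splitLength t P (gap-before eq q x~w) =
    T , Y , eqP , len , ∑-≡0 T λ y∈T → N-nonadj (nonadj y∈T)
    where
    tail-walk : ∃[ w ] Walk w (T ++ Y ++ S) u
    tail-walk with _ , _ , r ← uncons-walk closed = _ , subst (λ m → Walk _ m u)
        (trans eq (trans (cong (_++ S) eqP) (++-assoc T Y S))) r
    nonadj : ∀ {y} → y ∈ T → ¬ x ~ y
    nonadj {y} y∈T x~y with _ , r ← tail-walk with _ , rT , rYS ← split T r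
      with T₁ , T₂ , eqT , _ , r₂ ← splitAt∈ rT y∈T = <-irrefl refl
          (≤-trans (s≤s (gap-before eq′ (r₂ ⋯ rYS) x~y)) (lt))
      where
      eq′ : l ≡ T₁ ++ (y ∷ T₂) ++ Y ++ S
      eq′ = trans eq (trans (cong (_++ S) (trans eqP (cong (_++ Y) eqT)))
              (trans (cong (_++ S) (++-assoc T₁ (y ∷ T₂) Y)) (trans (++-assoc T₁ ((y ∷ T₂) ++ Y) S)
                (cong (T₁ ++_) (++-assoc (y ∷ T₂) Y S)))))
      lt : suc (length T₁) ≤ t
      lt = linear 4 (λ T₁ T₂ T t → T₁ :+ (con 1 :+ T₂) :≡ T ⇒ T :≡ t ⇒ ⊢ con 1 :+ T₁ :≤ t) (length T₁)
          (length T₂) (length T) t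
             (sym (trans (cong length eqT) (length-++ T₁))) len

  module Count (K a ε : ℕ) (ε≤1 : ε ≤ 1) (c≡ : c ≡ a + a + ε) (a<K : a < K)
               (deg≤K : ∀ w → w ∈ u ∷ l → deg w ≤ K) where

    deg≤c : ∀ w → deg w ≤ c
    deg≤c w = ≤-trans (∑-≤ (u ∷ l) λ _ → N≤1 w _) (≤-reflexive (*-identityʳ c))

    -- Raising the degrees of the neighbours of x to K makes the end terms of ∑-pairs
    -- cancel when the last vertex of a stretch is a neighbour of x.
    deg⁺ : V → ℕ
    deg⁺ w with x ~? w
    ... | yes _ = K
    ... | no _  = deg w

    deg≤deg⁺ : ∀ {w} → w ∈ u ∷ l → deg w ≤ deg⁺ w
    deg≤deg⁺ {w} w∈C with x ~? w
    ... | yes _ = deg≤K w w∈C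
    ... | no _  = ≤-refl

    deg⁺≤K : ∀ {w} → w ∈ u ∷ l → deg⁺ w ≤ K
    deg⁺≤K {w} w∈C with x ~? w
    ... | yes _ = ≤-refl
    ... | no _  = deg≤K w w∈C

    deg⁺-nbr : ∀ {w} → x ~ w → deg⁺ w ≡ K
    deg⁺-nbr {w} x~w with x ~? w
    ... | yes _   = refl
    ... | no ¬x~w = ⊥-elim (¬x~w x~w)

    deg⁺-nonnbr : ∀ {w} → ¬ x ~ w → deg⁺ w ≡ deg w
    deg⁺-nonnbr {w} ¬x~w with x ~? w
    ... | yes x~w = ⊥-elim (¬x~w x~w)
    ... | no _    = refl

    -- Each neighbour of x on the stretch saves κ = K − b at its successor.
    stretch : ∀ {Y s v} b κ → b + κ ≡ K → Walk s Y v → (∀ {w} → w ∈ Y ++ v ∷ [] → w ∈ u ∷ l) →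
              (∀ Y₁ {p q Y₂} → Y ≡ Y₁ ++ p ∷ Y₂ → Walk s Y₁ p → p ~ q → Walk q Y₂ v → x ~ p →
                 ¬ x ~ q × deg q ≤ b) →
              κ * ∑ (N x) Y + (∑ deg Y + deg⁺ v) ≤ length Y * K + deg⁺ s
    stretch {Y} {s} {v} b κ b+κ p Y⊆C after =
      linear 6 (λ κN d d⁺ v r h → κN :≡ h ⇒ d :≤ d⁺ ⇒ h :+ (d⁺ :+ v) :≤ r ⇒ ⊢ κN :+ (d :+ v) :≤ r)
        (κ * ∑ (N x) Y) (∑ deg Y) (∑ deg⁺ Y) (deg⁺ v) (length Y * K + deg⁺ s) (∑ (λ w → κ * N x w) Y)
        (sym (∑-* κ (N x) Y)) (∑-mono Y λ w∈Y → deg≤deg⁺ (Y⊆C (∈-++⁺ˡ w∈Y)))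
        (∑-pairs (λ w → κ * N x w) deg⁺ K p pair)
      where
      ∈C : ∀ Y₁ {p q Y₂} → Y ≡ Y₁ ++ p ∷ Y₂ → Walk q Y₂ v → q ∈ u ∷ l
      ∈C Y₁ {p} {q} refl [] = Y⊆C (subst (q ∈_) (sym (++-assoc Y₁ (p ∷ []) (q ∷ [])))
          (∈-++⁺ʳ Y₁ (there (here refl))))
      ∈C Y₁ {p} {q} refl (_ ∷ _) = Y⊆C (∈-++⁺ˡ (∈-++⁺ʳ Y₁ (there (here refl))))
      pair : ∀ Y₁ {p q Y₂} → Y ≡ Y₁ ++ p ∷ Y₂ → Walk s Y₁ p → p ~ q → Walk q Y₂ v → κ * N x p + deg⁺
          q ≤ K
      pair Y₁ {p} {q} eq r e r′ with x ~? p
      ... | no ¬x~p = ≤-trans (≤-reflexive (cong (_+ deg⁺ q) (*-zeroʳ κ))) (deg⁺≤K (∈C Y₁ eq r′))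
      ... | yes x~p with ¬x~q , le ← after Y₁ eq r e r′ x~p rewrite deg⁺-nonnbr ¬x~q =
        linear 4 (λ κ q b K → b :+ κ :≡ K ⇒ q :≤ b ⇒ ⊢ κ :+ q :≤ K) (κ * 1) (deg q) b K
          (trans (cong (b +_) (*-identityʳ κ)) b+κ) le

    -- The degree sum on the cycle is at most (c − s)K + sa + ε for s = ν + t.
    Goal : Set
    Goal = ∑ deg (u ∷ l) + (ν + t) * K ≤ c * K + (ν + t) * a + ε

    -- If the successor b of v has degree > a, the first t vertices after u and all other
    -- successors of neighbours of x have degree ≤ c − deg b.
    module BigSuccessor {T Y R : List V} {v b a′ : V} (eq : l ≡ T ++ Y ++ v ∷ R) (lenT : length T ≡ t)
        (NT : ∑ (N x) T ≡ 0)
        (pT : Walk u (u ∷ T) a′) (pY : Walk a′ Y v) (v~b : v ~ b) (pR : Walk b R u) (x~v : x ~ v)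
        (a<deg : a < deg b) where

      b₀ κ νY νR : ℕ
      b₀ = c ∸ deg b
      κ  = K ∸ b₀
      νY = ∑ (N x) Y
      νR = ∑ (N x) R

      deg+b₀ : deg b + b₀ ≡ c
      deg+b₀ = m+[n∸m]≡n (deg≤c b)

      b₀≤a : b₀ ≤ a
      b₀≤a = linear 5 (λ b b₀ c a ε → b :+ b₀ :≡ c ⇒ con 1 :+ a :≤ b ⇒ c :≡ a :+ a :+ ε ⇒ ε :≤ con
          1 ⇒ ⊢ b₀ :≤ a)
               (deg b) b₀ c a ε deg+b₀ a<deg c≡ ε≤1

      b₀+κ : b₀ + κ ≡ K
      b₀+κ = m+[n∸m]≡n (≤-trans b₀≤a (<⇒≤ a<K))

      small : ∀ {w} → deg b + deg w ≤ c → deg w ≤ b₀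
      small {w} le = linear 4 (λ b w c b₀ → b :+ w :≤ c ⇒ c :≡ b :+ b₀ ⇒ ⊢ w :≤ b₀) (deg b) (deg w) c b₀
          le (sym deg+b₀)

      T-small : ∀ {w} → w ∈ T → deg w ≤ b₀
      T-small {w} w∈T = small (≤-trans (≤-reflexive (+-comm (deg b) (deg w))) (T-sum w∈T))
        where
        T-sum : w ∈ T → deg w + deg b ≤ c
        T-sum w∈T = let u~ , p = uncons-walk pT .proj₂ ; T₁ , T₂ , eqT , p₁ , p₂ = splitAt∈ p w∈T in
          bridge-tail (trans (cong (u ∷_) (trans eq (cong (_++ Y ++ v ∷ R) eqT)))
                         (cong (u ∷_) (trans (++-assoc T₁ (w ∷ T₂) (Y ++ v ∷ R))
                             (cong (T₁ ++_) (sym (++-assoc (w ∷ T₂) Y (v ∷ R)))))))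
            (u~ ∷ p₁) (p₂ ⋯ pY) (edge v~b) pR x~v
            (linear 4 (λ T₁ T₂ T t → T :≡ t ⇒ T₁ :+ (con 1 :+ T₂) :≡ T ⇒ ⊢ con 1 :+ (T₁ :+ con 0) :≤ t)
              (length T₁) (length T₂) (length T) t lenT (sym (trans (cong length eqT) (length-++ T₁))))

      eqR : ∀ g → ∑ g (u ∷ l) ≡ g u + (∑ g T + (∑ g Y + (g v + ∑ g R)))
      eqR g = cong (g u +_) (trans (cong (∑ g) eq) (∑-++₃ g T Y (v ∷ R)))

      C≡ : u ∷ l ≡ (u ∷ T ++ Y) ++ v ∷ R
      C≡ = trans (cong (u ∷_) eq) (cong (u ∷_) (sym (++-assoc T Y (v ∷ R))))

      R-after : ∀ R₁ {p q R₂} → R ≡ R₁ ++ p ∷ R₂ → Walk b R₁ p → p ~ q → Walk q R₂ u → x ~ p → ¬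
          x ~ q × deg q ≤ b₀
      R-after R₁ {p} {q} {R₂} eq′ r e r′ x~p =
        isolated (trans C≡ (trans (cong (λ m → (u ∷ T ++ Y) ++ v ∷ m) eq′)
            (sym (++-assoc (u ∷ T ++ Y) (v ∷ R₁) (p ∷ R₂)))))
          ((pT ⋯ pY) ⋯ (v~b ∷ r)) r′ x~p ,
        small (bridge-x {A = R₁} {B = R₂ ++ (u ∷ T) ++ Y} (λ g → trans (eqR g)
            (trans (cong (λ k → g u + (∑ g T + (∑ g Y + (g v + k))))
                (trans (cong (∑ g) eq′) (∑-++ g R₁ (p ∷ R₂))))
              (trans (arr (g u) (∑ g T) (∑ g Y) (g v) (∑ g R₁) (g p) (∑ g R₂))
                (cong (λ k → g v + (∑ g R₁ + (g p + k))) (sym (∑-++₃ g R₂ (u ∷ T) Y))))))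
          v~b r e (r′ ⋯ pT ⋯ pY) x~v x~p)
        where
        arr : ∀ u T Y v R₁ p R₂ → u + (T + (Y + (v + (R₁ + (p + R₂))))) ≡ v +
            (R₁ + (p + (R₂ + (u + T + Y))))
        arr = solve-∀

      Y-after : ∀ Y₁ {p q Y₂} → Y ≡ Y₁ ++ p ∷ Y₂ → Walk a′ Y₁ p → p ~ q → Walk q Y₂ v → x ~ p → ¬
          x ~ q × deg q ≤ b₀
      Y-after Y₁ {p} {q} {Y₂} eq′ r e r′ x~p =
        isolated {P = (u ∷ T) ++ Y₁} {S = Y₂ ++ v ∷ R} (trans
            (cong (u ∷_) (trans eq (trans (cong (λ m → T ++ m ++ v ∷ R) eq′)
               (trans (cong (T ++_) (++-assoc Y₁ (p ∷ Y₂) (v ∷ R)))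
                   (sym (++-assoc T Y₁ (p ∷ Y₂ ++ v ∷ R))))))) refl)
          (pT ⋯ r) (r′ ⋯ (v~b ∷ pR)) x~p ,
        small (bridge-x {A = R ++ (u ∷ T) ++ Y₁} {B = Y₂} (λ g → trans (eqR g)
            (trans (cong (λ k → g u + (∑ g T + (k + (g v + ∑ g R))))
                (trans (cong (∑ g) eq′) (∑-++ g Y₁ (p ∷ Y₂))))
              (trans (arr (g u) (∑ g T) (∑ g Y₁) (g p) (∑ g Y₂) (g v) (∑ g R))
                (cong (λ k → g v + (k + (g p + ∑ g Y₂))) (sym (∑-++₃ g R (u ∷ T) Y₁))))))
          v~b (pR ⋯ pT ⋯ r) e r′ x~v x~p)
        where
        arr : ∀ u T Y₁ p Y₂ v R → u + (T + (Y₁ + (p + Y₂) + (v + R))) ≡ v +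
            (R + (u + T + Y₁) + (p + Y₂))
        arr = solve-∀

      Y⊆C : ∀ {w} → w ∈ Y ++ v ∷ [] → w ∈ u ∷ l
      Y⊆C {w} w∈ = there (subst (w ∈_) (sym (trans eq (cong (T ++_) (sym (++-assoc Y (v ∷ []) R)))))
          (∈-++⁺ʳ T (∈-++⁺ˡ w∈)))

      R⊆C : ∀ {w} → w ∈ R ++ u ∷ [] → w ∈ u ∷ l
      R⊆C {w} w∈ with ∈-++⁻ R w∈
      ... | inj₁ w∈R         = there (subst (w ∈_) (sym eq) (∈-++⁺ʳ T (∈-++⁺ʳ Y (there w∈R))))
      ... | inj₂ (here refl) = here refl

      start∈ : ∀ {s m w} → Walk s m w → s ∈ m ++ w ∷ []
      start∈ []      = here refl
      start∈ (_ ∷ _) = here refl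

      R-stretch : κ * νR + (∑ deg R + deg⁺ u) ≤ length R * K + deg⁺ b
      R-stretch = stretch b₀ κ b₀+κ pR R⊆C R-after

      Y-stretch : κ * νY + (∑ deg Y + deg⁺ v) ≤ length Y * K + deg⁺ a′
      Y-stretch = stretch b₀ κ b₀+κ pY Y⊆C Y-after

      deg⁺b : deg⁺ b ≡ deg b
      deg⁺b = deg⁺-nonnbr (isolated C≡ (pT ⋯ pY) pR x~v)

      total : ∑ deg (u ∷ l) + κ * νR + κ * νY ≤ length R * K + deg b + length Y * K + t * b₀ + K
      total = linear 16 (λ C u u⁺ T Y v R νR νY rK yK b b⁺ tb a′ K →
          C :≡ u :+ (T :+ (Y :+ (v :+ R))) ⇒ νR :+ (R :+ u⁺) :≤ rK :+ b⁺ ⇒ νY :+ (Y :+ K) :≤ yK :+ a′ ⇒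
          b⁺ :≡ b ⇒ u :≤ u⁺ ⇒ v :≤ K ⇒ a′ :≤ K ⇒ T :≤ tb ⇒ ⊢ C :+ νR :+ νY :≤ rK :+ b :+ yK :+ tb :+ K)
        (∑ deg (u ∷ l)) (deg u) (deg⁺ u) (∑ deg T) (∑ deg Y) (deg v) (∑ deg R) (κ * νR) (κ * νY)
            (length R * K)
        (length Y * K) (deg b) (deg⁺ b) (t * b₀) (deg⁺ a′) K
        (eqR deg) R-stretch (subst (λ k → κ * νY + (∑ deg Y + k) ≤ length Y * K + deg⁺ a′)
            (deg⁺-nbr x~v) Y-stretch)
        deg⁺b (deg≤deg⁺ (here refl)) (deg≤K v (Y⊆C (∈-++⁺ʳ Y (here refl)))) (deg⁺≤K (Y⊆C (start∈ pY)))
        (subst (λ k → ∑ deg T ≤ k * b₀) lenT (∑-≤ T T-small))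

      -- The s vertices are b, the t vertices of T and the other ν - 1 successors. Here b and one
      -- vertex of T together cost deg b + b₀ = 2a + ε, and each of the s - 2 others costs at most
      -- b₀ ≤ a.
      goal : Goal
      goal = subst (λ k → ∑ deg (u ∷ l) + (ν + t) * K ≤ c * K + k + ε)
          (sym (trans (cong (λ k → (k + t) * a) ν≡) (expand νY νR (length τ) a)))
        (linear 21 (λ C νR νY rK yK b tb K b₀ s τK τa a ε cK YK RK Yb Rb Ya Ra →
          C :+ νR :+ νY :≤ rK :+ b :+ yK :+ (b₀ :+ tb) :+ K ⇒ s :≡ YK :+ RK :+ τK :+ K :+ K ⇒
          K :+ K :+ K :+ τK :+ yK :+ rK :≡ cK ⇒ YK :≡ νY :+ Yb ⇒ RK :≡ νR :+ Rb ⇒ Yb :≤ Ya ⇒ Rb :≤ Ra ⇒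
              tb :≤ τa ⇒
          b :+ b₀ :≡ a :+ a :+ ε ⇒ ⊢ C :+ s :≤ cK :+ (Ya :+ Ra :+ τa :+ a :+ a) :+ ε)
        (∑ deg (u ∷ l)) (κ * νR) (κ * νY) (length R * K) (length Y * K) (deg b) (length τ * b₀) K b₀
            ((ν + t) * K)
        (length τ * K) (length τ * a) a ε (c * K) (νY * K) (νR * K) (νY * b₀) (νR * b₀) (νY * a)
            (νR * a)
        total (trans (cong (λ k → (k + t) * K) ν≡) (expand νY νR (length τ) K))
        (trans (expand′ (length τ) (length Y) (length R) K) (cong (_* K) (sym (cong suc length-l))))
        (distr νY) (distr νR) (*-monoʳ-≤ νY b₀≤a) (*-monoʳ-≤ νR b₀≤a) (*-monoʳ-≤ (length τ) b₀≤a)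
            (trans deg+b₀ c≡))
        where
        ν≡ : ν ≡ νY + suc νR
        ν≡ = trans (cong (∑ (N x)) eq) (trans (∑-++₃ (N x) T Y (v ∷ R))
               (cong₂ (λ i j → i + (νY + (j + νR))) NT (N-adj x~v)))
        length-l : length l ≡ t + (length Y + suc (length R))
        length-l = trans (cong length eq) (trans (length-++ T) (cong₂ _+_ lenT (length-++ Y)))
        expand : ∀ y r s k → (y + suc r + suc s) * k ≡ y * k + r * k + s * k + k + k
        expand = solve-∀
        expand′ : ∀ s y r k → k + k + k + s * k + y * k + r * k ≡ suc (suc s + (y + suc r)) * k
        expand′ = solve-∀
        distr : ∀ m → m * K ≡ κ * m + m * b₀
        distr m = trans (cong (m *_) (sym b₀+κ)) (arr m b₀ κ)
          where
          arr : ∀ m b k → m * (b + k) ≡ k * m + m * b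
          arr = solve-∀

    -- The i-th vertex after u is paired with the (t + 1 − i)-th vertex after v.
    T-Q-sum : ∀ {T Y v Q Z a₁ a₂} → l ≡ T ++ Y ++ v ∷ Q ++ Z → length T ≡ t → length Q ≡ t →
              Walk u (u ∷ T) a₁ → Walk a₁ Y v → Walk v (v ∷ Q) a₂ → Walk a₂ Z u → x ~ v →
              ∑ deg T + ∑ deg Q ≤ t * c
    T-Q-sum {T} {Y} {v} {Q} {Z} {a₁} {a₂} eq lenT lenQ pT pY pQ pZ x~v = ∑-pair deg c t T Q lenT lenQ
        pair
      where
      pair : ∀ T₁ {s T₂} Q₁ {s′ Q₂} → T ≡ T₁ ++ s ∷ T₂ → Q ≡ Q₁ ++ s′ ∷ Q₂ → suc
          (length T₁ + length Q₁) ≡ t → deg s + deg s′ ≤ c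
      pair T₁ {s} {T₂} Q₁ {s′} {Q₂} refl refl len
        with w₁ , p₁ , p₂ ← split (u ∷ T₁) pT | w₂ , q₁ , q₂ ← split (v ∷ Q₁) pQ
        with refl ← head≡ p₂ | refl ← head≡ q₂ =
        bridge-tail (cong (u ∷_) (trans eq (trans (++-assoc T₁ (s ∷ T₂) _) (cong (T₁ ++_)
            (trans (sym (++-assoc (s ∷ T₂) Y _)) (cong (λ m → ((s ∷ T₂) ++ Y) ++ v ∷ m)
                (++-assoc Q₁ (s′ ∷ Q₂) Z)))))))
          p₁ (p₂ ⋯ pY) q₁ (q₂ ⋯ pZ) x~v (≤-reflexive len)

    module Layout {T Y Q Z : List V} {v a₁ a₂ : V} (eq : l ≡ T ++ Y ++ v ∷ Q ++ Z) (lenT : length T ≡ t)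
        (lenQ : length Q ≡ t)
        (NT : ∑ (N x) T ≡ 0) (NQZ : ∑ (N x) (Q ++ Z) ≡ 0) (pT : Walk u (u ∷ T) a₁) (pY : Walk a₁ Y v)
        (pQ : Walk v (v ∷ Q) a₂) (pZ : Walk a₂ Z u) (x~v : x ~ v) where

      νY : ℕ
      νY = ∑ (N x) Y

      ν≡ : ν ≡ νY + 1
      ν≡ = trans (cong (∑ (N x)) eq) (trans (∑-++₃ (N x) T Y (v ∷ Q ++ Z))
             (cong₂ (λ i j → i + (νY + j)) NT (cong₂ _+_ (N-adj x~v) NQZ)))

      c-split : c ≡ suc (t + (length Y + suc (t + length Z)))
      c-split = cong suc (trans (cong length eq) (trans (length-++ T) (cong₂ (λ i j → i + j) lenT
                  (trans (length-++ Y) (cong (λ k → length Y + suc k)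
                      (trans (length-++ Q) (cong (_+ length Z) lenQ)))))))

      inner-split : ∀ Y₁ {p Y₂} → Y ≡ Y₁ ++ p ∷ Y₂ → l ≡ T ++ Y₁ ++ p ∷ Y₂ ++ v ∷ Q ++ Z
      inner-split Y₁ {p} {Y₂} eq′ = trans eq (cong (T ++_)
          (trans (cong (_++ v ∷ Q ++ Z) eq′) (++-assoc Y₁ (p ∷ Y₂) _)))

      Y-isolated : ∀ Y₁ {p q Y₂} → Y ≡ Y₁ ++ p ∷ Y₂ → Walk a₁ Y₁ p → Walk q Y₂ v → x ~ p → ¬ x ~ q
      Y-isolated Y₁ {p} {q} {Y₂} eq′ r r′ = isolated {P = (u ∷ T) ++ Y₁}
        (cong (u ∷_) (trans (inner-split Y₁ eq′) (sym (++-assoc T Y₁ _)))) (pT ⋯ r) (r′ ⋯ pQ ⋯ pZ)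

      -- Neighbours of x are never consecutive, and the last vertex of Y is none because v follows
      -- it. In the telescoped sum, the term 1 of v makes up for that of a₁.
      2νY≤Y : νY + νY ≤ length Y
      2νY≤Y = linear 5 (λ νY v Y Y1 a → νY :+ (νY :+ v) :≤ Y1 :+ a ⇒ con 1 :≡ v ⇒ a :≤ con 1 ⇒
          Y1 :≡ Y ⇒ ⊢ νY :+ νY :≤ Y)
        νY (N x v) (length Y) (length Y * 1) (N x a₁)
        (∑-pairs (N x) (N x) 1 pY pair) (sym (N-adj x~v)) (N≤1 x a₁) (*-identityʳ (length Y))
        where
        pair : ∀ Y₁ {p q Y₂} → Y ≡ Y₁ ++ p ∷ Y₂ → Walk a₁ Y₁ p → p ~ q → Walk q Y₂ v → N x p + N x q ≤ 1
        pair Y₁ {p} {q} eq′ r _ r′ with x ~? p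
        ... | no _    = N≤1 x q
        ... | yes x~p = ≤-reflexive (cong (1 +_) (N-nonadj (Y-isolated Y₁ eq′ r r′ x~p)))

      2s≤c : (ν + t) + (ν + t) ≤ c
      2s≤c = linear 6 (λ ν νY t Y Z c → ν :≡ νY :+ con 1 ⇒ ν :≡ νY :+ con 1 ⇒ νY :+ νY :≤ Y ⇒ con
          1 :+ (t :+ (Y :+ (con 1 :+ (t :+ Z)))) :≡ c ⇒
                 ⊢ ν :+ t :+ (ν :+ t) :≤ c) ν νY t (length Y) (length Z) c ν≡ ν≡ 2νY≤Y (sym c-split)

      κ : ℕ
      κ = K ∸ a

      a+κ : a + κ ≡ K
      a+κ = m+[n∸m]≡n (<⇒≤ a<K)

      module _ (¬goal : ¬ Goal) where

        -- A successor of degree above a would already prove the goal by `BigSuccessor`; this is why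
        -- the failure of the goal is assumed.
        Y-after : ∀ Y₁ {p q Y₂} → Y ≡ Y₁ ++ p ∷ Y₂ → Walk a₁ Y₁ p → p ~ q → Walk q Y₂ v → x ~ p → ¬
            x ~ q × deg q ≤ a
        Y-after Y₁ eq′ r e r′ x~p = Y-isolated Y₁ eq′ r r′ x~p ,
          ≮⇒≥ λ a<deg → ¬goal (BigSuccessor.goal (inner-split Y₁ eq′) lenT NT pT r e (r′ ⋯ pQ ⋯ pZ) x~p
              a<deg)

        mid⊆C : ∀ {w} → w ∈ Y ++ v ∷ [] → w ∈ u ∷ l
        mid⊆C {w} w∈ = there (subst (w ∈_) (sym (trans eq (cong (T ++_) (sym (++-assoc Y (v ∷ []) _)))))
            (∈-++⁺ʳ T (∈-++⁺ˡ w∈)))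

        Z⊆C : ∀ {w} → w ∈ Z → w ∈ u ∷ l
        Z⊆C {w} w∈ = there (subst (w ∈_) (sym eq) (∈-++⁺ʳ T (∈-++⁺ʳ Y (there (∈-++⁺ʳ Q w∈)))))

        start∈ : ∀ {s m w} → Walk s m w → s ∈ m ++ w ∷ []
        start∈ []      = here refl
        start∈ (_ ∷ _) = here refl

        -- Compared with degree K everywhere, T and Q save 2t(K - a) - tε, and the successors in the
        -- stretch save νY(K - a). As s = νY + 1 + t, this exceeds the required s(K - a) - ε by (t -
        -- 1)(K - a - ε), which is not negative since a < K and ε ≤ 1.
        bound : Goal
        bound = subst (λ k → ∑ deg (u ∷ l) + (ν + t) * K ≤ c * K + k + ε)
            (sym (trans (cong (λ k → (k + t) * a) ν≡) (expand νY (length τ) a)))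
          (linear 24 (λ C s u T Y v Q Z yK zK cK tc κν YK Ya τK τa τε τaK K a ε DaY a₁ →
              C :≡ u :+ (T :+ (Y :+ (v :+ (Q :+ Z)))) ⇒ T :+ Q :≤ tc ⇒ κν :+ (Y :+ DaY) :≤ yK :+ a₁ ⇒
                  K :≡ DaY ⇒ a₁ :≤ K ⇒
              u :≤ K ⇒ v :≤ K ⇒ Z :≤ zK ⇒ s :≡ YK :+ τK :+ K :+ K ⇒
              K :+ K :+ K :+ K :+ τK :+ τK :+ yK :+ zK :≡ cK ⇒ YK :≡ κν :+ Ya ⇒
              tc :≡ τa :+ τa :+ τε :+ a :+ a :+ ε ⇒ τa :+ τε :≤ τK ⇒
              ⊢ C :+ s :≤ cK :+ (Ya :+ τa :+ a :+ a) :+ ε)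
            (∑ deg (u ∷ l)) ((ν + t) * K) (deg u) (∑ deg T) (∑ deg Y) (deg v) (∑ deg Q) (∑ deg Z)
                (length Y * K) (length Z * K)
            (c * K) (t * c) (κ * νY) (νY * K) (νY * a) (length τ * K) (length τ * a) (length τ * ε)
                (length τ * K) K a ε (deg⁺ v) (deg⁺ a₁)
            (cong (deg u +_) (trans (cong (∑ deg) eq) (trans (∑-++₃ deg T Y (v ∷ Q ++ Z))
              (cong (λ k → ∑ deg T + (∑ deg Y + (deg v + k))) (∑-++ deg Q Z)))))
            (T-Q-sum eq lenT lenQ pT pY pQ pZ x~v) (stretch a κ a+κ pY mid⊆C Y-after)
                (sym (deg⁺-nbr x~v))
            (deg⁺≤K (mid⊆C (start∈ pY))) (deg≤K u (here refl)) (deg≤K v (mid⊆C (∈-++⁺ʳ Y (here refl))))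
            (∑-≤ Z λ w∈Z → deg≤K _ (Z⊆C w∈Z)) (trans (cong (λ k → (k + t) * K) ν≡)
                (expand νY (length τ) K))
            (trans (expand′ (length τ) (length Y) (length Z) K) (cong (_* K) (sym c-split)))
            (trans (cong (νY *_) (sym a+κ)) (distr νY a κ))
            (trans (cong (t *_) c≡) (expand″ (length τ) a ε))
            (≤-trans (≤-reflexive (sym (*-distribˡ-+ (length τ) a ε)))
              (*-monoʳ-≤ (length τ) (≤-trans (+-monoʳ-≤ a ε≤1)
                  (≤-trans (≤-reflexive (+-comm a 1)) a<K)))))
          where
          expand : ∀ y s k → (y + 1 + suc s) * k ≡ y * k + s * k + k + k
          expand = solve-∀
          expand′ : ∀ s y z k → k + k + k + k + s * k + s * k + y * k + z * k ≡ suc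
              (suc s + (y + suc (suc s + z))) * k
          expand′ = solve-∀
          expand″ : ∀ s a e → suc s * (a + a + e) ≡ s * a + s * a + s * e + a + a + e
          expand″ = solve-∀
          distr : ∀ m b k → m * (b + k) ≡ k * m + m * b
          distr = solve-∀

    conclusion : Goal × (ν + t) + (ν + t) ≤ c
    conclusion = let m₁ , v , m₂ , eq , x~v , N₂ = lastNbr x l attached
                     _ , u~ , p = uncons-walk closed
                     _ , p₁ , p₂ = split-eq m₁ eq p
                 in located eq N₂ (u~ ∷ p₁) p₂ x~v (head≡ p₂)
      where
      laid-out : ∀ {T Y Q Z v w} → l ≡ T ++ Y ++ v ∷ Q ++ Z → length T ≡ t → length Q ≡ t → ∑ (N x)
          T ≡ 0 →
                 ∑ (N x) (Q ++ Z) ≡ 0 → Walk u ((u ∷ T) ++ Y) v → Walk v ((v ∷ Q) ++ Z) w → w ≡ u →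
                     x ~ v →
                 Goal × (ν + t) + (ν + t) ≤ c
      laid-out {T} {Y} {Q} {Z} {v} eq lenT lenQ NT NQZ p q refl x~v =
        let _ , pT , pY = split (u ∷ T) p
            _ , pQ , pZ = split (v ∷ Q) q
            module L = Layout eq lenT lenQ NT NQZ pT pY pQ pZ x~v
        -- The goal is a decidable inequality, so it may be proved from its own failure.
        in decidable-stable (_ ≤? _) (λ ¬goal → ¬goal (L.bound ¬goal)) , L.2s≤c
      located : ∀ {m₁ v m₂ w} → l ≡ m₁ ++ v ∷ m₂ → ∑ (N x) m₂ ≡ 0 → Walk u (u ∷ m₁) w → Walk w (v ∷ m₂)
          u → x ~ v → v ≡ w →
                Goal × (ν + t) + (ν + t) ≤ c
      located {m₁} {v} {m₂} eq N₂ p q x~v refl =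
        let T , Y , eq₁ , lenT , NT = free-start eq q x~v
            Q , Z , eq₂ , lenQ = splitLength t m₂ (gap-after eq p x~v)
        in laid-out {T} {Y} {Q} {Z} (trans eq (trans (cong₂ (λ i j → i ++ v ∷ j) eq₁ eq₂) (++-assoc T Y _))) lenT lenQ NT
             (trans (cong (∑ (N x)) (sym eq₂)) N₂) (subst (λ m → Walk u (u ∷ m) v) eq₁ p)
             (subst (λ m → Walk v (v ∷ m) u) eq₂ q) refl x~v

-- Arithmetic of the bound

-- The bound for m vertices and degree sum E = 2e, with K = k + 1: either
-- 2e ≤ Km or 2e ≤ 2a(m − a) + a(K − a) for some admissible a; the latter is
-- stated without subtraction, and is meaningful for m < a, too.
Good : ℕ → ℕ → ℕ → Set
Good K m E = E ≤ K * m ⊎ ∃[ a ] (K < a + a × a ≤ K × E + (a * a + a * a + a * a) ≤ a * m + a * m + a *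
    K)

-- Take a = K: each vertex off C costs at most 2K, and cK ≤ 2K(c - K) because c ≥ 2K.
good-large-cycle : ∀ {K c r d E EC} → K + K ≤ c → d ≤ K → EC ≤ c * K → 1 ≤ K →
    E ≤ EC + (r * d + r * d) → Good K (c + r) E
good-large-cycle {K} {c} {r} {d} {E} {EC} 2K≤c d≤K EC≤ 1≤K E≤ = inj₂ (K , +-monoˡ-≤ K 1≤K , ≤-refl ,
  linear 7 (λ E EC rd rK cK KK Km → E :≤ EC :+ (rd :+ rd) ⇒ rd :≤ rK ⇒ rd :≤ rK ⇒ EC :≤ cK ⇒
      KK :+ KK :≤ cK ⇒ cK :+ rK :≡ Km ⇒ cK :+ rK :≡ Km ⇒
      ⊢ E :+ (KK :+ KK :+ KK) :≤ Km :+ Km :+ KK)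
    E EC (r * d) (r * K) (c * K) (K * K) (K * (c + r)) E≤ (*-monoʳ-≤ r d≤K) (*-monoʳ-≤ r d≤K) EC≤
    (≤-trans (≤-reflexive (sym (*-distribʳ-+ K K K))) (*-monoˡ-≤ K 2K≤c)) (eq c r K) (eq c r K))
  where
  eq : ∀ c r K → c * K + r * K ≡ K * (c + r)
  eq = solve-∀

-- The estimates add up to cK + s(2r + a - K) + ε, and the sign of 2r + a - K decides which end of
-- the range of s is worse. If it is negative, s ≥ 1 absorbs ε; otherwise s is raised to a.
good-small-cycle : ∀ {K a ε c r s d E EC} → c ≡ a + a + ε → ε ≤ 1 → a < K → s + s ≤ c → d ≤ s → 1 ≤ s →
    K < d + d →
                   EC + s * K ≤ c * K + s * a + ε → E ≤ EC + (r * d + r * d) → Good K (c + r) E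
good-small-cycle {K} {a} {ε} {c} {r} {s} {d} {E} {EC} refl ε≤1 a<K 2s≤c d≤s 1≤s K<2d EC≤ E≤ with K ≤?
    r + r + a
... | no K≰ = inj₁ (linear 11 (λ E EC rd sK cK sr sa s ε rK Km →
        E :≤ EC :+ (rd :+ rd) ⇒ rd :≤ sr ⇒ rd :≤ sr ⇒ EC :+ sK :≤ cK :+ sa :+ ε ⇒
            sr :+ sr :+ sa :+ s :≤ sK ⇒ ε :≤ con 1 ⇒ con 1 :≤ s ⇒
        cK :+ rK :≡ Km ⇒ ⊢ E :≤ Km)
      E EC (r * d) (s * K) (c * K) (s * r) (s * a) s ε (r * K) (K * (c + r))
      E≤ rd≤sr rd≤sr EC≤ (≤-trans (≤-reflexive (eq₁ s r a)) (*-monoʳ-≤ s (≰⇒> K≰))) ε≤1 1≤s (eq₂ c r K))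
  where
  rd≤sr : r * d ≤ s * r
  rd≤sr = ≤-trans (*-monoʳ-≤ r d≤s) (≤-reflexive (*-comm r s))
  eq₁ : ∀ s r a → s * r + s * r + s * a + s ≡ s * suc (r + r + a)
  eq₁ = solve-∀
  eq₂ : ∀ c r K → c * K + r * K ≡ K * (c + r)
  eq₂ = solve-∀
... | yes K≤ = inj₂ (a , K<2a , <⇒≤ a<K , bound)
  where
  s≤a : s ≤ a
  s≤a = ≮⇒≥ λ a<s → <-irrefl refl (linear 3 (λ a s ε → con 1 :+ a :≤ s ⇒ con 1 :+ a :≤ s ⇒
      s :+ s :≤ a :+ a :+ ε ⇒ ε :≤ con 1 ⇒ ⊢ con 1 :≤ con 0)
          a s ε a<s a<s 2s≤c ε≤1)
  K<2a : K < a + a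
  K<2a = ≤-trans K<2d (d≤s′ ⊕ d≤s′)
    where
    d≤s′ : d ≤ a
    d≤s′ = ≤-trans d≤s s≤a
  p : ℕ
  p = r + r + a ∸ K
  K+p : K + p ≡ r + r + a
  K+p = m+[n∸m]≡n K≤
  -- With s raised to a, the slack is ε(2a - K - 1), which is not negative since K < 2a.
  bound : E + (a * a + a * a + a * a) ≤ a * (a + a + ε + r) + a * (a + a + ε + r) + a * K
  bound = linear 16 (λ E EC rd sr sK cK sa ε sp ap aK εK ra aa aε am →
      E :≤ EC :+ (rd :+ rd) ⇒ rd :≤ sr ⇒ rd :≤ sr ⇒ EC :+ sK :≤ cK :+ sa :+ ε ⇒
          sr :+ sr :+ sa :≡ sK :+ sp ⇒ sp :≤ ap ⇒
      aK :+ ap :≡ ra :+ ra :+ aa ⇒ cK :≡ aK :+ aK :+ εK ⇒ εK :+ ε :≤ aε :+ aε ⇒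
      aa :+ aa :+ aε :+ ra :≡ am ⇒ aa :+ aa :+ aε :+ ra :≡ am ⇒ ⊢ E :+ (aa :+ aa :+ aa) :≤ am :+ am :+
          aK)
    E EC (r * d) (s * r) (s * K) ((a + a + ε) * K) (s * a) ε (s * p) (a * p) (a * K) (ε * K) (r * a)
        (a * a) (a * ε) (a * (a + a + ε + r))
    E≤ rd≤sr rd≤sr EC≤ (trans (eq₁ s r a) (trans (cong (s *_) (sym K+p)) (*-distribˡ-+ s K p)))
        (*-monoˡ-≤ p s≤a)
    (trans (sym (*-distribˡ-+ a K p)) (trans (cong (a *_) K+p) (eq₃ a r)))
    (eq₂ a ε K) (≤-trans (≤-reflexive (eq₄ ε K)) (≤-trans (*-monoʳ-≤ ε K<2a) (≤-reflexive (eq₅ ε a))))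
        (eq₆ a ε r) (eq₆ a ε r)
    where
    rd≤sr : r * d ≤ s * r
    rd≤sr = ≤-trans (*-monoʳ-≤ r d≤s) (≤-reflexive (*-comm r s))
    eq₁ : ∀ s r a → s * r + s * r + s * a ≡ s * (r + r + a)
    eq₁ = solve-∀
    eq₂ : ∀ a ε K → (a + a + ε) * K ≡ a * K + a * K + ε * K
    eq₂ = solve-∀
    eq₃ : ∀ a r → a * (r + r + a) ≡ r * a + r * a + a * a
    eq₃ = solve-∀
    eq₄ : ∀ ε K → ε * K + ε ≡ ε * suc K
    eq₄ = solve-∀
    eq₅ : ∀ ε a → ε * (a + a) ≡ a * ε + a * ε
    eq₅ = solve-∀
    eq₆ : ∀ a ε r → a * a + a * a + a * ε + r * a ≡ a * (a + a + ε + r)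
    eq₆ = solve-∀

-- One vertex of the piece comes for free and the others cost 2a each. This amounts to aK + 2a ≤
-- 3a², the sum of a(K + 1) ≤ 2a² and a ≤ a².
absorb : ∀ {K} a {p E} → K < a + a → E + (a * a + a * a + a * a) ≤ a * suc p + a * suc p + a * K →
    E ≤ a * p + a * p
absorb zero ()
absorb {K} a@(suc a′) {p} {E} K<2a E≤ = linear 6 (λ E aa as aK ap a →
    E :+ (aa :+ aa :+ aa) :≤ as :+ as :+ aK ⇒
    a :+ aK :≤ aa :+ aa ⇒ a :≤ aa ⇒ as :≡ a :+ ap ⇒ as :≡ a :+ ap ⇒ ⊢ E :≤ ap :+ ap)
  E (a * a) (a * suc p) (a * K) (a * p) a E≤
  (≤-trans (≤-reflexive (sym (*-suc a K))) (≤-trans (*-monoʳ-≤ a K<2a)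
      (≤-reflexive (*-distribˡ-+ a a a))))
  (m≤m*n a a) (*-suc a p) (*-suc a p)

-- Up to 2a vertices the complete graph is small enough. Beyond that, (K + 1)(p + 1) ≤ 2a(p + 1),
-- and the surplus p + 1 > 2a pays for the vertex left out.
absorb′ : ∀ {K} a {p E} → K < a + a → E ≤ K * suc p → E ≤ suc p * p → E ≤ a * p + a * p
absorb′ {K} a {p} {E} K<2a E≤ E≤′ with suc p ≤? a + a
... | yes le = ≤-trans E≤′ (≤-trans (*-monoˡ-≤ p le) (≤-reflexive (*-distribʳ-+ p a a)))
... | no ≰   = linear 6 (λ E Kp p as ap a → E :≤ Kp ⇒ con 1 :+ p :+ Kp :≤ as :+ as ⇒ as :≡ a :+ ap ⇒
    as :≡ a :+ ap ⇒ con 1 :+ (a :+ a) :≤ con 1 :+ p ⇒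
      ⊢ E :≤ ap :+ ap)
    E (K * suc p) p (a * suc p) (a * p) a E≤ (≤-trans (*-monoˡ-≤ (suc p) K<2a)
        (≤-reflexive (*-distribʳ-+ (suc p) a a)))
    (*-suc a p) (*-suc a p) (≰⇒> ≰)

-- Each further vertex raises the term for a by 2a, so p vertices of total cost 2ap preserve the
-- form of the bound on F.
attach : ∀ {K} a p q E F → K < a + a → a ≤ K → E ≤ a * p + a * p → F + (a * a + a * a + a * a) ≤ a * suc
    q + a * suc q + a * K →
         Good K (suc (p + q)) (E + F)
attach {K} a p q E F K<2a a≤K E≤ F≤ = inj₂ (a , K<2a , a≤K ,
  linear 7 (λ E ap F aa am aq aK → E :≤ ap :+ ap ⇒ F :+ aa :≤ aq :+ aq :+ aK ⇒ ap :+ aq :≡ am ⇒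
      ap :+ aq :≡ am ⇒ ⊢ E :+ F :+ aa :≤ am :+ am :+ aK)
    E (a * p) F (a * a + a * a + a * a) (a * suc (p + q)) (a * suc q) (a * K) E≤ F≤ (eq a p q)
        (eq a p q))
  where
  eq : ∀ a p q → a * p + a * suc q ≡ a * suc (p + q)
  eq = solve-∀

swap-good : ∀ {K} p q E F → Good K (suc (q + p)) (F + E) → Good K (suc (p + q)) (E + F)
swap-good {K} p q E F = subst₂ (λ i j → Good K (suc i) j) (+-comm q p) (+-comm F E)

-- The pieces share one vertex, so the union has 1 + p + q vertices.
good-cut : ∀ {K p q E F} → Good K (suc p) E → Good K (suc q) F → E ≤ suc p * p → F ≤ suc q * q → Good K
    (suc (p + q)) (E + F)
good-cut {p = p} {q} {E} {F} (inj₂ (a , K<2a , a≤K , E≤)) (inj₂ (b , K<2b , b≤K , F≤)) Ep Fq with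
    ≤-total a b
... | inj₁ a≤b = attach b p q E F K<2b b≤K (≤-trans (absorb a K<2a E≤)
    (*-monoˡ-≤ p a≤b ⊕ *-monoˡ-≤ p a≤b)) F≤
... | inj₂ b≤a = swap-good p q E F (attach a q p F E K<2a a≤K
    (≤-trans (absorb b K<2b F≤) (*-monoˡ-≤ q b≤a ⊕ *-monoˡ-≤ q b≤a)) E≤)
good-cut {p = p} {q} {E} {F} (inj₁ E≤) (inj₂ (b , K<2b , b≤K , F≤)) Ep Fq = attach b p q E F K<2b b≤K
    (absorb′ b K<2b E≤ Ep) F≤
good-cut {p = p} {q} {E} {F} (inj₂ (a , K<2a , a≤K , E≤)) (inj₁ F≤) Ep Fq = swap-good p q E F
    (attach a q p F E K<2a a≤K (absorb′ a K<2a F≤ Fq) E≤)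
-- A piece with at most K vertices costs at most Kp (or Kq), as in the complete graph. If both
-- pieces are larger, there are at least 2K + 1 vertices and a = K works.
good-cut {K} {p} {q} {E} {F} (inj₁ E≤) (inj₁ F≤) Ep Fq with suc p ≤? K | suc q ≤? K
... | yes p<K | _ = inj₁ (≤-trans (≤-trans Ep (*-monoˡ-≤ p p<K) ⊕ F≤) (≤-reflexive (eq K p q)))
  where
  eq : ∀ K p q → K * p + K * suc q ≡ K * suc (p + q)
  eq = solve-∀
... | _ | yes q<K = inj₁ (≤-trans (E≤ ⊕ ≤-trans Fq (*-monoˡ-≤ q q<K)) (≤-reflexive (eq K p q)))
  where
  eq : ∀ K p q → K * suc p + K * q ≡ K * suc (p + q)
  eq = solve-∀
-- The choice a = K is not admissible for K = 0, where K < 2a fails.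
good-cut {zero} {p} {q} {E} {F} (inj₁ E≤) (inj₁ F≤) Ep Fq | no _ | no _ = inj₁
    (≤-trans (E≤ ⊕ F≤) ≤-refl)
good-cut {K@(suc _)} {p} {q} {E} {F} (inj₁ E≤) (inj₁ F≤) Ep Fq | no ≰p | no ≰q = inj₂
    (K , m<m+n K (s≤s z≤n) , ≤-refl ,
  linear 9 (λ E F Kp Kq KK K Km Ksp Ksq → E :≤ Ksp ⇒ F :≤ Ksq ⇒ KK :≤ Kp ⇒ KK :≤ Kq ⇒
      Kp :+ Kq :+ K :≡ Km ⇒ Kp :+ Kq :+ K :≡ Km ⇒
      Ksp :≡ K :+ Kp ⇒ Ksq :≡ K :+ Kq ⇒ ⊢ E :+ F :+ (KK :+ KK :+ KK) :≤ Km :+ Km :+ KK)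
    E F (K * p) (K * q) (K * K) K (K * suc (p + q)) (K * suc p) (K * suc q) E≤ F≤
    (*-monoʳ-≤ K (≤-pred (≰⇒> ≰p))) (*-monoʳ-≤ K (≤-pred (≰⇒> ≰q))) (eq K p q) (eq K p q) (*-suc K p)
        (*-suc K q))
  where
  eq : ∀ K p q → K * p + K * q + K ≡ K * suc (p + q)
  eq = solve-∀

-- Sums over `allFin`, and cycles as closed walks

∑-filter : ∀ {A : Set} {P : A → Set} (P? : Decidable P) l → length (filter P? l) ≡ ∑ (λ x → 𝟙 (P? x)) l
∑-filter P? []      = refl
∑-filter P? (x ∷ l) with P? x
... | yes _ = cong suc (∑-filter P? l)
... | no _  = ∑-filter P? l

∑-map : ∀ {A B : Set} (g : B → ℕ) (f : A → B) l → ∑ g (map f l) ≡ ∑ (g ∘ f) l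
∑-map g f []      = refl
∑-map g f (x ∷ l) = cong (g (f x) +_) (∑-map g f l)

∑-tabulate : ∀ {A : Set} {m} (g : A → ℕ) (f : Fin m → A) → ∑ g (tabulate f) ≡ ∑ (g ∘ f) (allFin m)
∑-tabulate {m = m} g f = trans (cong (∑ g) (sym (map-tabulate id f))) (∑-map g f (allFin m))

cnt-allFin : ∀ {m} (z : Fin m) → cnt z (allFin m) ≡ 1
cnt-allFin {suc m} zero = cong suc (trans (∑-tabulate {m = m} (δ zero) suc)
    (∑-≡0 (allFin m) λ {i} _ → 𝟙-no (zero ≟ suc i) λ ()))
cnt-allFin {suc m} (suc z) = trans (∑-tabulate {m = m} (δ (suc z)) suc)
    (trans (∑-cong (allFin m) λ {i} _ → δ-suc i) (cnt-allFin z))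
  where
  δ-suc : ∀ i → δ (suc z) (suc i) ≡ δ z i
  δ-suc i = refl

toℕ-next : ∀ {m} (i : Fin (suc m)) → toℕ (next i) ≡ suc (toℕ i) % suc m
toℕ-next {m} i = toℕ-fromℕ< (m%n<n (suc (toℕ i)) (suc m))

next-inject₁ : ∀ {m} (i : Fin m) → next (inject₁ i) ≡ suc i
next-inject₁ {m} i = toℕ-injective (trans (toℕ-next (inject₁ i))
    (trans (m<n⇒m%n≡m lt) (cong suc (toℕ-inject₁ i))))
  where
  lt : suc (toℕ (inject₁ i)) < suc m
  lt = s≤s (subst (_< m) (sym (toℕ-inject₁ i)) (toℕ<n i))

next-fromℕ : ∀ m → next (fromℕ m) ≡ zero
next-fromℕ m = toℕ-injective (trans (toℕ-next (fromℕ m))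
    (trans (cong (λ k → suc k % suc m) (toℕ-fromℕ m)) (n%n≡0 (suc m))))

prev : ∀ {m} → Fin (suc m) → Fin (suc m)
prev zero    = fromℕ _
prev (suc i) = inject₁ i

next-prev : ∀ {m} (i : Fin (suc m)) → next (prev i) ≡ i
next-prev zero    = next-fromℕ _
next-prev (suc i) = next-inject₁ i

prev-next : ∀ {m} (i : Fin (suc m)) → prev (next i) ≡ i
prev-next i with view i
... | ‵fromℕ     = cong prev (next-fromℕ _)
... | ‵inject₁ j = cong prev (next-inject₁ j)

next≢prev : ∀ {m} (i : Fin (3 + m)) → next i ≢ prev i
next≢prev i eq with view i
next≢prev _ eq | ‵fromℕ with () ← trans (sym (next-fromℕ _)) eq
next≢prev _ eq | ‵inject₁ zero with () ← trans (sym (next-inject₁ zero)) eq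
next≢prev _ eq | ‵inject₁ (suc j) = <⇒≢ (m<n⇒m<1+n (n<1+n (toℕ j)))
  (trans (sym (trans (toℕ-inject₁ _) (toℕ-inject₁ j))) (cong toℕ
      (trans (sym eq) (next-inject₁ (suc j)))))

module _ {n : ℕ} {G : Graph n} (C : Cycle G) where

  open Graph G
  open Cycle C
  open Walks G using (N; N-adj; N-nonadj)

  N-split : ∀ i j → N (vertex i) (vertex j) ≡ 𝟙 (chord? C i j) + (δ (next i) j + δ (prev i) j)
  N-split i j with next i ≟ j | prev i ≟ j
  ... | yes p | yes q = ⊥-elim (next≢prev i (trans p (sym q)))
  ... | yes refl | no _ = trans (N-adj (adjacent i)) (cong (_+ 1)
      (sym (𝟙-no (chord? C i j) λ (_ , ¬c) → ¬c (inj₁ refl))))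
  ... | no _ | yes refl = trans (N-adj (~-sym (subst (λ k → vertex j ~ vertex k) (next-prev i)
      (adjacent j))))
          (cong (_+ 1) (sym (𝟙-no (chord? C i j) λ (_ , ¬c) → ¬c (inj₂ (sym (next-prev i))))))
  ... | no ¬p | no ¬q = trans (𝟙-cong (vertex i ~? vertex j) (chord? C i j) (λ adj → adj , λ where
            (inj₁ e) → ¬p (sym e)
            (inj₂ e) → ¬q (trans (cong prev e) (prev-next j))) proj₁) (sym (+-identityʳ _))

  -- The successor and the predecessor are the only neighbours on C not joined by a chord. Hence K =
  -- k + 1: at most k - 1 chords allow at most k + 1 neighbours.
  chords+2 : ∀ i → chordsAt C i + 2 ≡ ∑ (λ j → N (vertex i) (vertex j)) (allFin (3 + m))
  chords+2 i = sym (trans (∑-cong (allFin (3 + m)) λ {j} _ → N-split i j)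
    (trans (∑-+ (λ j → 𝟙 (chord? C i j)) (λ j → δ (next i) j + δ (prev i) j) (allFin (3 + m)))
      (cong₂ _+_ (sym (∑-filter (chord? C i) (allFin (3 + m))))
        (trans (∑-+ (δ (next i)) (δ (prev i)) (allFin (3 + m)))
            (cong₂ _+_ (cnt-allFin (next i)) (cnt-allFin (prev i)))))))

lookup-injective : ∀ {n} (l : List (Fin n)) → (∀ z → cnt z l ≤ 1) → ∀ {i j} → lookup l i ≡ lookup l j →
    i ≡ j
lookup-injective (x ∷ l) nodup {zero}  {zero}  eq = refl
lookup-injective (x ∷ l) nodup {suc i} {suc j} eq =
  cong suc (lookup-injective l (λ z → ≤-trans (m≤n+m _ _) (nodup z)) eq)
lookup-injective (x ∷ l) nodup {zero} {suc j} eq = ⊥-elim (<-irrefl refl (≤-trans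
  (≤-reflexive (sym (δ-refl x)) ⊕ ∈⇒cnt (subst (_∈ l) (sym eq) (∈-lookup j))) (nodup x)))
lookup-injective (x ∷ l) nodup {suc i} {zero} eq = ⊥-elim (<-irrefl refl (≤-trans
  (≤-reflexive (sym (δ-refl x)) ⊕ ∈⇒cnt (subst (_∈ l) eq (∈-lookup i))) (nodup x)))

module ClosedWalks {n : ℕ} (G : Graph n) where

  open Graph G
  open Walks G

  walk-step : ∀ {u y l z} → Walk u (y ∷ l) z → ∀ i → lookup (y ∷ l) (inject₁ i) ~ lookup (y ∷ l) (suc i)
  walk-step (e ∷ (e′ ∷ p)) zero    = e
  walk-step (e ∷ (e′ ∷ p)) (suc i) = walk-step (e′ ∷ p) i

  walk-end : ∀ {u y l z} → Walk u (y ∷ l) z → lookup (y ∷ l) (fromℕ (length l)) ~ z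
  walk-end (e ∷ [])       = e
  walk-end (e ∷ (e′ ∷ p)) = walk-end (e′ ∷ p)

  closed⇒cycle : ∀ {x y z l} → Walk x (x ∷ y ∷ z ∷ l) x → (∀ v → cnt v (x ∷ y ∷ z ∷ l) ≤ 1) → Cycle G
  closed⇒cycle {x} {y} {z} {l} p nodup = record
    { m = length l ; vertex = lookup L ; injective = lookup-injective L nodup ; adjacent = adj }
    where
    L = x ∷ y ∷ z ∷ l
    adj : ∀ i → lookup L i ~ lookup L (next i)
    adj i with view i
    ... | ‵fromℕ     = subst (λ j → lookup L (fromℕ _) ~ lookup L j) (sym (next-fromℕ _)) (walk-end p)
    ... | ‵inject₁ j = subst (λ k → lookup L (inject₁ j) ~ lookup L k) (sym (next-inject₁ j))
        (walk-step p j)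

  -- Closed walks on one or two vertices are not cycles in the sense of `Cycle`, but satisfy the
  -- bound trivially. They are included since a longest closed walk may be a single edge.
  closed-degree : ∀ {k x l} → ¬ HasCycleWithChords k G → Walk x (x ∷ l) x → (∀ v → cnt v (x ∷ l) ≤ 1) →
      ∑ (N x) l ≤ suc k
  closed-degree {l = []}        free p nodup = z≤n
  closed-degree {l = y ∷ []}    free p nodup = ≤-trans (≤-reflexive (+-identityʳ _))
      (≤-trans (N≤1 _ y) (s≤s z≤n))
  closed-degree {k} {x} {l@(y ∷ z ∷ l′)} free p nodup = ≮⇒≥ λ k<deg → free
      (C , zero , ≤-pred (≤-pred (≤-trans k<deg
      (≤-reflexive (trans eq (+-comm (chordsAt C zero) 2))))))
    where
    C = closed⇒cycle p nodup
    eq : ∑ (N x) l ≡ chordsAt C zero + 2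
    eq = trans (cong (_+ ∑ (N x) l) (sym (N-irrefl x)))
        (trans (cong (∑ (N x)) (sym (tabulate-lookup (x ∷ l))))
           (trans (∑-tabulate (N x) (lookup (x ∷ l))) (sym (chords+2 C zero))))

  -- Closing a path at the last neighbour of its end vertex x keeps all neighbours of x.
  path-degree : ∀ {k x l w} → ¬ HasCycleWithChords k G → Walk x (x ∷ l) w → (∀ v → cnt v (x ∷ l) ≤ 1) →
      ∑ (N x) l ≤ suc k
  path-degree {k} {x} {l} free p nodup with 1 ≤? ∑ (N x) l
  ... | no ≰ = ≤-trans (≤-pred (≰⇒> ≰)) z≤n
  ... | yes 1≤ with l₁ , y , l₂ , refl , x~y , N₂ ← lastNbr x l 1≤ with w , q , r ← split (x ∷ l₁) p
      with refl ← head≡ r =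
    ≤-trans (≤-reflexive (trans (∑-++ (N x) l₁ (y ∷ l₂))
        (trans (cong (λ k → ∑ (N x) l₁ + (N x y + k)) N₂) (sym (∑-++ (N x) l₁ (y ∷ []))))))
      (closed-degree free (q ⋯ edge (~-sym x~y)) λ v → ≤-trans
        (linear 6 (λ X x l₁ y l₂ L → X :≡ l₁ :+ (y :+ con 0) ⇒
            l₁ :+ (y :+ l₂) :≡ L ⇒ ⊢ x :+ X :≤ x :+ L)
          (cnt v (l₁ ++ y ∷ [])) (δ v x) (cnt v l₁) (δ v y) (cnt v l₂) (cnt v (l₁ ++ y ∷ l₂))
          (∑-++ (δ v) l₁ (y ∷ [])) (sym (∑-++ (δ v) l₁ (y ∷ l₂))))
        (nodup v))

-- Duplicate-free lists of vertices

module _ {n : ℕ} where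

  NoDup : List (Fin n) → Set
  NoDup l = ∀ z → cnt z l ≤ 1

  _∈?_ : ∀ (z : Fin n) l → Dec (z ∈ l)
  z ∈? l with 1 ≤? cnt z l
  ... | yes le = yes (cnt⇒∈ l le)
  ... | no ≰   = no λ z∈l → ≰ (∈⇒cnt z∈l)

  ∉⇒cnt : ∀ {z : Fin n} {l} → z ∉ l → cnt z l ≡ 0
  ∉⇒cnt {z} {l} z∉l = n<1⇒n≡0 (≰⇒> λ le → z∉l (cnt⇒∈ l le))

  ∷-⊑ : ∀ {w : Fin n} {l U} → w ∈ U → w ∉ l → l ⊑ U → w ∷ l ⊑ U
  ∷-⊑ {w} {l} {U} w∈U w∉l l⊑U z with z ≟ w
  ... | yes refl = ≤-trans (≤-reflexive (cong suc (∉⇒cnt w∉l))) (∈⇒cnt w∈U)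
  ... | no _     = l⊑U z

  extract : ∀ {w : Fin n} {U} → w ∈ U → ∃[ U′ ] U ↭ w ∷ U′
  extract {w} w∈U with l , m , refl ← ∈-∃++ w∈U = l ++ m , shift w l m

  complement : ∀ (l : List (Fin n)) {U} → l ⊑ U → ∃[ R ] U ↭ l ++ R
  complement []      {U} _ = U , ↭-refl
  complement (w ∷ l) {U} l⊑U
    with U′ , p ← extract (cnt⇒∈ U (≤-trans (≤-trans (≤-reflexive (sym (δ-refl w))) (m≤m+n _ _))
        (l⊑U w)))
    with R , q ← complement l {U′} (λ z → +-cancelˡ-≤ (δ z w) _ _
        (≤-trans (l⊑U z) (≤-reflexive (∑-↭ (δ z) p))))
    = R , ↭-trans p (prep w q)

  ⊑-length : ∀ {l U : List (Fin n)} → l ⊑ U → length l ≤ length U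
  ⊑-length {l} {U} l⊑U with R , p ← complement l {U} l⊑U =
    ≤-trans (m≤m+n (length l) (length R)) (≤-reflexive (trans (sym (length-++ l)) (sym (↭-length p))))

-- Degree sums of induced subgraphs and deletion of vertices

module Edges {n : ℕ} (G : Graph n) where

  open Graph G
  open Walks G

  -- For a duplicate-free list, twice the number of edges of the induced subgraph.
  E₂ : List V → ℕ
  E₂ l = ∑ (λ v → ∑ (N v) l) l

  X : List V → List V → ℕ
  X l m = ∑ (λ v → ∑ (N v) m) l

  X-sym : ∀ l m → X l m ≡ X m l
  X-sym l m = trans (∑-swap N l m) (∑-cong m λ {y} _ → ∑-cong l λ {x} _ → N-sym x y)

  X-++ʳ : ∀ l m₁ m₂ → X l (m₁ ++ m₂) ≡ X l m₁ + X l m₂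
  X-++ʳ l m₁ m₂ = trans (∑-cong l λ {v} _ → ∑-++ (N v) m₁ m₂) (∑-+ _ _ l)

  E₂-++ : ∀ l m → E₂ (l ++ m) ≡ E₂ l + (X l m + X l m + E₂ m)
  E₂-++ l m = trans (∑-++ _ l m) (trans (cong₂ _+_ (X-++ʳ l l m)
      (trans (X-++ʳ m l m) (cong (_+ E₂ m) (X-sym m l))))
                (arr (E₂ l) (X l m) (E₂ m)))
    where
    arr : ∀ a x b → a + x + (x + b) ≡ a + (x + x + b)
    arr = solve-∀

  E₂-↭ : ∀ {l m} → l ↭ m → E₂ l ≡ E₂ m
  E₂-↭ {l} {m} p = trans (∑-cong l λ {v} _ → ∑-↭ (N v) p) (∑-↭ (λ v → ∑ (N v) m) p)

  degree< : ∀ {v l} → v ∈ l → ∑ (N v) l < length l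
  degree< {v} {l} v∈l = begin-strict
    ∑ (N v) l                     <⟨ m<m+n _ (∈⇒cnt v∈l) ⟩
    ∑ (N v) l + cnt v l           ≡⟨ ∑-+ (N v) (δ v) l ⟨
    ∑ (λ w → N v w + δ v w) l     ≤⟨ ∑-≤ l (λ {w} _ → pointwise w) ⟩
    length l * 1                  ≡⟨ *-identityʳ _ ⟩
    length l                      ∎
    where
    open ≤-Reasoning
    pointwise : ∀ w → N v w + δ v w ≤ 1
    pointwise w with v ≟ w
    ... | yes refl = ≤-reflexive (cong (_+ 1) (N-irrefl v))
    ... | no _     = ≤-trans (≤-reflexive (+-identityʳ _)) (N≤1 v w)

  E₂-complete : ∀ y l → E₂ (y ∷ l) ≤ suc (length l) * length l
  E₂-complete y l = ∑-≤ (y ∷ l) λ v∈ → ≤-pred (degree< v∈)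

  nbrs-⊆ : ∀ x l m → NoDup l → (∀ {w} → w ∈ l → x ~ w → w ∈ m) → ∑ (N x) l ≤ ∑ (N x) m
  nbrs-⊆ x []      m _ _ = z≤n
  nbrs-⊆ x (w ∷ l) m nodup l⊆m with x ~? w
  ... | no _ = nbrs-⊆ x l m (λ z → ≤-trans (m≤n+m _ (δ z w)) (nodup z)) λ w∈ → l⊆m (there w∈)
  ... | yes x~w with m′ , p ← extract (l⊆m (here refl) x~w) = ≤-trans
      (≤-trans (s≤s (nbrs-⊆ x l m′ (λ z → ≤-trans (m≤n+m _ (δ z w)) (nodup z)) l⊆m′))
          (≤-reflexive (cong (_+ ∑ (N x) m′) (sym (N-adj x~w)))))
      (≤-reflexive (sym (∑-↭ (N x) p)))
    where
    l⊆m′ : ∀ {v} → v ∈ l → x ~ v → v ∈ m′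
    l⊆m′ {v} v∈l x~v with ∈-resp-↭ p (l⊆m (there v∈l) x~v)
    ... | there v∈m′ = v∈m′
    ... | here refl = ⊥-elim (<-irrefl refl (≤-trans (≤-reflexive (sym (δ-refl v)) ⊕ ∈⇒cnt v∈l)
        (nodup v)))

  minimum : ∀ (f : V → ℕ) y l → ∃[ x ] ∃[ l′ ] (y ∷ l ↭ x ∷ l′ × (∀ {z} → z ∈ y ∷ l → f x ≤ f z))
  minimum f y [] = y , [] , ↭-refl , λ where (here refl) → ≤-refl
  minimum f y (z ∷ l) with x , l′ , p , min ← minimum f z l with ≤-total (f y) (f x)
  ... | inj₁ y≤x = y , z ∷ l , ↭-refl , λ where
        (here refl) → ≤-refl
        (there w∈)  → ≤-trans y≤x (min w∈)
  ... | inj₂ x≤y = x , y ∷ l′ , ↭-trans (prep y p) (shift x (y ∷ []) l′) , λ where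
        (here refl) → x≤y
        (there w∈)  → min w∈

  -- The vertices off C left at the moment when the smallest degree is d; x shows that some are
  -- left.
  Core : List V → List V → ℕ → Set
  Core C R d = ∃[ R′ ] ∃[ x ] (x ∈ R′ × R′ ⊑ R × (∀ {z} → z ∈ R′ → d ≤ ∑ (N z) C + ∑ (N z) R′))

  -- The degree sum that is lost when R is deleted from `C ++ R`.
  weight : List V → List V → ℕ
  weight C R = X C R + X C R + E₂ R

  weight-∷ : ∀ C {R x R′} → R ↭ x ∷ R′ → weight C R ≡ weight C
      R′ + ((∑ (N x) C + ∑ (N x) R) + (∑ (N x) C + ∑ (N x) R))
  weight-∷ C {R} {x} {R′} p = trans (cong₂ (λ i j → i + i + j) X-R E₂-R)
      (trans (arr (∑ (N x) C) (X C R′) (∑ (N x) R′) (E₂ R′))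
          (cong (λ k → weight C R′ + ((∑ (N x) C + k) + (∑ (N x) C + k))) (sym N-R)))
    where
    N-R : ∑ (N x) R ≡ ∑ (N x) R′
    N-R = trans (∑-↭ (N x) p) (cong (_+ ∑ (N x) R′) (N-irrefl x))
    X-R : X C R ≡ ∑ (N x) C + 0 + X C R′
    X-R = trans (∑-cong C λ {v} _ → ∑-↭ (N v) p) (trans (X-++ʳ C (x ∷ []) R′)
        (cong (_+ X C R′) (X-sym C (x ∷ []))))
    E₂-R : E₂ R ≡ (∑ (N x) R′ + 0) + (∑ (N x) R′ + 0) + E₂ R′
    E₂-R = trans (E₂-↭ p) (trans (E₂-++ (x ∷ []) R′) (cong
        (λ k → k + 0 + 0 + ((∑ (N x) R′ + 0) + (∑ (N x) R′ + 0) + E₂ R′)) (N-irrefl x)))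
    arr : ∀ c X r E → c + 0 + X + (c + 0 + X) + (r + 0 + (r + 0) + E) ≡ X + X + E + (c + r + (c + r))
    arr = solve-∀

  -- Delete vertices of R of smallest degree into C ∪ R one by one; d is the
  -- largest degree met.
  peel : ∀ C f R → length R ≤ f → ∃[ d ] (weight C R ≤ length R * d + length
      R * d × (d ≡ 0 ⊎ Core C R d))
  peel C f [] _ = 0 , ≤-trans (≤-reflexive (cong (λ k → k + k + 0) (X-sym C []))) z≤n , inj₁ refl
  peel C (suc f) (y ∷ R) (s≤s le) =
    let x , R′ , p , min = minimum (λ z → ∑ (N z) C + ∑ (N z) (y ∷ R)) y R
        len : length R ≡ length R′
        len = suc-injective (↭-length p)
        d , W≤ , core = peel C f R′ (≤-trans (≤-reflexive (sym len)) le)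
    in choose x R′ p min len d W≤ core (≤-total d _)
    where
    choose : ∀ x R′ → y ∷ R ↭ x ∷ R′ → (let dx = ∑ (N x) C + ∑ (N x) (y ∷ R) in
             (∀ {z} → z ∈ y ∷ R → dx ≤ ∑ (N z) C + ∑ (N z) (y ∷ R)) → length R ≡ length R′ →
             ∀ d → weight C R′ ≤ length R′ * d + length R′ * d → d ≡ 0 ⊎ Core C R′ d → d ≤ dx ⊎ dx ≤ d →
             ∃[ d ] (weight C (y ∷ R) ≤ length (y ∷ R) * d + length
                 (y ∷ R) * d × (d ≡ 0 ⊎ Core C (y ∷ R) d)))
    -- A new record: x has smallest degree in the current list, so this list is itself the core for
    -- `dx`.
    choose x R′ p min len d W≤ core (inj₁ d≤dx) = dx ,
      linear 5 (λ W W′ dx r r′ → W :≡ W′ :+ (dx :+ dx) ⇒ W′ :≤ r′ :+ r′ ⇒ r′ :≤ r ⇒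
          r′ :≤ r ⇒ ⊢ W :≤ dx :+ r :+ (dx :+ r))
        (weight C (y ∷ R)) (weight C R′) dx (length R * dx) (length R′ * d) (weight-∷ C p) W≤ r≤ r≤ ,
      inj₂ (y ∷ R , y , here refl , (λ _ → ≤-refl) , min)
      where
      dx : ℕ
      dx = ∑ (N x) C + ∑ (N x) (y ∷ R)
      r≤ : length R′ * d ≤ length R * dx
      r≤ = *-mono-≤ (≤-reflexive (sym len)) d≤dx
    choose x R′ p min len d W≤ core (inj₂ dx≤d) = d ,
      linear 6 (λ W W′ dx d r r′ → W :≡ W′ :+ (dx :+ dx) ⇒ W′ :≤ r′ :+ r′ ⇒ dx :≤ d ⇒ dx :≤ d ⇒
          r′ :≤ r ⇒ r′ :≤ r ⇒ ⊢ W :≤ d :+ r :+ (d :+ r))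
        (weight C (y ∷ R)) (weight C R′) (∑ (N x) C + ∑ (N x) (y ∷ R)) d (length R * d) (length R′ * d)
            (weight-∷ C p) W≤ dx≤d dx≤d r≤ r≤ ,
      enlarge core
      where
      r≤ : length R′ * d ≤ length R * d
      r≤ = *-monoˡ-≤ d (≤-reflexive (sym len))
      enlarge : d ≡ 0 ⊎ Core C R′ d → d ≡ 0 ⊎ Core C (y ∷ R) d
      enlarge (inj₁ eq) = inj₁ eq
      enlarge (inj₂ (S , z , z∈S , S⊑ , large)) =
        inj₂ (S , z , z∈S , (λ w → ≤-trans (S⊑ w) (≤-trans (m≤n+m _ (δ w x))
            (≤-reflexive (sym (∑-↭ (δ w) p))))) , large)

-- The upper bound

module Induction {n : ℕ} (G : Graph n) (k : ℕ) (1≤k : 1 ≤ k) (free : ¬ HasCycleWithChords k G) where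

  open Graph G
  open Walks G
  open ClosedWalks G
  open Edges G

  K : ℕ
  K = suc k

  -- Everything below derives ⊥ from the failure of the bound for U, so that choices
  -- such as that of a longest cycle can be made classically.
  module Step (U : List V) (nodup : NoDup U)
              (ih : ∀ U′ → NoDup U′ → length U′ < length U → ¬ ¬ Good K (length U′) (E₂ U′))
              (bad : ¬ Good K (length U) (E₂ U)) where

    ⊑⇒NoDup : ∀ l → l ⊑ U → NoDup l
    ⊑⇒NoDup l l⊑U z = ≤-trans (l⊑U z) (nodup z)

    -- Both sides together with y are smaller, hence good. They share only y, and no edge joins A to
    -- B, so their degree sums add up and `good-cut` applies.
    separated : ∀ {y A B} → U ↭ y ∷ A ++ B → 1 ≤ length A → 1 ≤ length B →
        (∀ {a b} → a ∈ A → b ∈ B → ¬ a ~ b) → ⊥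
    separated {y} {A} {B} p 1≤A 1≤B sep =
      ih (y ∷ A) (⊑⇒NoDup (y ∷ A) A⊑U) (≤-trans (s≤s (m<m+n _ 1≤B)) (≤-reflexive (sym len))) λ goodA →
      ih (y ∷ B) (⊑⇒NoDup (y ∷ B) B⊑U) (≤-trans (s≤s (m<n+m _ 1≤A)) (≤-reflexive (sym len))) λ goodB →
      bad (subst₂ (Good K) (sym len) (sym E-sum) (good-cut goodA goodB (E₂-complete y A)
          (E₂-complete y B)))
      where
      len : length U ≡ suc (length A + length B)
      len = trans (↭-length p) (cong suc (length-++ A))
      cnt-U : ∀ z → cnt z U ≡ δ z y + (cnt z A + cnt z B)
      cnt-U z = trans (∑-↭ (δ z) p) (cong (δ z y +_) (∑-++ (δ z) A B))
      A⊑U : y ∷ A ⊑ U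
      A⊑U z = ≤-trans (+-monoʳ-≤ (δ z y) (m≤m+n _ _)) (≤-reflexive (sym (cnt-U z)))
      B⊑U : y ∷ B ⊑ U
      B⊑U z = ≤-trans (+-monoʳ-≤ (δ z y) (m≤n+m _ _)) (≤-reflexive (sym (cnt-U z)))
      X-AB : X A B ≡ 0
      X-AB = ∑-≡0 A λ a∈A → ∑-≡0 B λ b∈B → N-nonadj (sep a∈A b∈B)
      E-∷ : ∀ l → E₂ (y ∷ l) ≡ ∑ (N y) l + ∑ (N y) l + E₂ l
      E-∷ l = trans (E₂-++ (y ∷ []) l) (trans (cong (λ i →
          i + 0 + 0 + (∑ (N y) l + 0 + (∑ (N y) l + 0) + E₂ l)) (N-irrefl y))
                (arr (∑ (N y) l) (E₂ l)))
        where
        arr : ∀ a b → 0 + (a + 0 + (a + 0) + b) ≡ a + a + b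
        arr = solve-∀
      E-sum : E₂ U ≡ E₂ (y ∷ A) + E₂ (y ∷ B)
      E-sum = trans (E₂-↭ p) (trans (E-∷ (A ++ B)) (trans
        (cong₂ (λ i j → i + i + j) (∑-++ (N y) A B) (trans (E₂-++ A B)
            (cong (λ i → E₂ A + (i + i + E₂ B)) X-AB)))
        (trans (arr (∑ (N y) A) (∑ (N y) B) (E₂ A) (E₂ B)) (sym (cong₂ _+_ (E-∷ A) (E-∷ B))))))
        where
        arr : ∀ a b A B → a + b + (a + b) + (A + B) ≡ a + a + A + (b + b + B)
        arr = solve-∀

    ++-length : ∀ A B → A ++ B ⊑ U → length A + length B ≤ length U
    ++-length A B le = ≤-trans (≤-reflexive (sym (length-++ A))) (⊑-length {l = A ++ B} {U} le)

    ++-disjoint : ∀ {z} A {B} → A ++ B ⊑ U → z ∈ A → z ∉ B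
    ++-disjoint {z} A {B} le z∈A z∈B = <-irrefl refl (≤-trans (∈⇒cnt z∈A ⊕ ∈⇒cnt z∈B)
      (≤-trans (≤-reflexive (sym (∑-++ (δ z) A B))) (≤-trans (le z) (nodup z))))

    -- In continuation-passing form: y does not separate Ω from the rest of U.
    escape : ∀ {y Ω} → y ∷ Ω ⊑ U → 1 ≤ length Ω → suc (length Ω) < length U →
             (∀ {v z} → v ∈ Ω → z ∈ U → z ≢ y → z ∉ Ω → v ~ z → ⊥) → ⊥
    escape {y} {Ω} yΩ⊑U 1≤Ω lt κ = go (complement (y ∷ Ω) yΩ⊑U)
      where
      go : ∃[ B ] U ↭ (y ∷ Ω) ++ B → ⊥
      go (B , p) = separated p 1≤Ω 1≤B λ {a} {b} a∈Ω b∈B a~b →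
          κ a∈Ω (∈-resp-↭ (↭-sym p) (there (∈-++⁺ʳ Ω b∈B)))
            (λ b≡y → disjoint b b∈B (≤-trans (≤-reflexive (trans (sym (δ-refl b)) (cong (δ b) b≡y)))
                (m≤m+n _ _)))
            (λ b∈Ω → disjoint b b∈B (≤-trans (∈⇒cnt b∈Ω) (m≤n+m _ _))) a~b
        where
        1≤B : 1 ≤ length B
        1≤B = +-cancelˡ-≤ (suc (length Ω)) 1 (length B)
            (≤-trans (≤-reflexive (+-comm (suc (length Ω)) 1))
                (≤-trans lt (≤-reflexive (trans (↭-length p) (length-++ (y ∷ Ω))))))
        disjoint : ∀ b → b ∈ B → ¬ 1 ≤ cnt b (y ∷ Ω)
        disjoint b b∈B le = <-irrefl refl (≤-trans (le ⊕ ∈⇒cnt b∈B)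
          (≤-trans (≤-reflexive (trans (sym (∑-++ (δ b) (y ∷ Ω) B)) (sym (∑-↭ (δ b) p)))) (nodup b)))

    module LongestCycle (C : List V) (u₀ : V) (closed₀ : Walk u₀ C u₀) (C⊑U : C ⊑ U)
        (2≤C : 2 ≤ length C)
                 (longest₀ : ∀ {v m} → Walk v m v → m ⊑ U → length m ≤ length C) where

      record Rooted (u : V) : Set where
        field
          l       : List V
          C↭      : C ↭ u ∷ l
          closed  : Walk u (u ∷ l) u

        cnt-C : ∀ z → cnt z (u ∷ l) ≡ cnt z C
        cnt-C z = sym (∑-↭ (δ z) C↭)

        longest : ∀ {v m} → Walk v m v → m ⊑ U → length m ≤ length (u ∷ l)
        longest p m⊑U = ≤-trans (longest₀ p m⊑U) (≤-reflexive (↭-length C↭))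

        E₂-C : E₂ C ≡ E₂ (u ∷ l)
        E₂-C = E₂-↭ C↭

        deg-C : ∀ w → ∑ (N w) (u ∷ l) ≡ ∑ (N w) C
        deg-C w = sym (∑-↭ (N w) C↭)

        deg-root : ∑ (N u) C ≤ K
        deg-root = ≤-trans (≤-reflexive (trans (sym (deg-C u)) (cong (_+ ∑ (N u) l) (N-irrefl u))))
          (closed-degree free closed λ z → ≤-trans (≤-reflexive (cnt-C z)) (⊑⇒NoDup C C⊑U z))

      root : ∀ {u} → u ∈ C → Rooted u
      root {u} u∈C = let l₁ , l₂ , eq , p , q = splitAt∈ closed₀ u∈C in record
        { l = l₂ ++ l₁
        ; C↭ = subst (_↭ u ∷ l₂ ++ l₁) (sym eq) (++-comm l₁ (u ∷ l₂))
        ; closed = q ⋯ p }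

      deg≤K : ∀ {w} → w ∈ C → ∑ (N w) C ≤ K
      deg≤K w∈C = Rooted.deg-root (root w∈C)

      E₂-C≤ : E₂ C ≤ length C * K
      E₂-C≤ = ∑-≤ C deg≤K

      module Peeled (R : List V) (U↭ : U ↭ C ++ R) (d : ℕ)
          (W≤ : weight C R ≤ length R * d + length R * d)
                    (K<2d : K < d + d) (R′ : List V) (x₀ : V) (x₀∈R′ : x₀ ∈ R′) (R′⊑R : R′ ⊑ R)
                    (degree≥d : ∀ {z} → z ∈ R′ → d ≤ ∑ (N z) C + ∑ (N z) R′) where

        c a ε : ℕ
        c = length C
        a = ⌊ c /2⌋
        ε = ⌈ c /2⌉ ∸ a

        ε≤1 : ε ≤ 1
        ε≤1 = ≤-trans (∸-monoˡ-≤ a (⌊n/2⌋-mono (n≤1+n (suc c)))) (≤-reflexive (m+n∸n≡m 1 a))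

        c≡ : c ≡ a + a + ε
        c≡ = trans (sym (⌊n/2⌋+⌈n/2⌉≡n c)) (trans (cong (a +_) (sym (m+[n∸m]≡n (⌊n/2⌋≤⌈n/2⌉ c))))
            (sym (+-assoc a a ε)))

        length-U : length U ≡ c + length R
        length-U = trans (↭-length U↭) (length-++ C)

        E₂≤ : E₂ U ≤ E₂ C + (length R * d + length R * d)
        E₂≤ = ≤-trans (≤-reflexive (trans (E₂-↭ U↭) (E₂-++ C R))) (+-monoʳ-≤ (E₂ C) W≤)

        cnt-U : ∀ z → cnt z U ≡ cnt z C + cnt z R
        cnt-U z = trans (∑-↭ (δ z) U↭) (∑-++ (δ z) C R)

        -- Apart from ν ≥ 1, only d ≤ s is required of the path, so x may lie outside `R′`; this
        -- admits the rerouted paths of `Detached`.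
        finish : ∀ {u} (r : Rooted u) x τ → d ≤ K → Walk x (x ∷ τ) u →
            (∀ z → cnt z (x ∷ τ) + cnt z C ≤ cnt z U) →
                 1 ≤ ∑ (N x) (Rooted.l r) → d ≤ ∑ (N x) (Rooted.l r) + length (x ∷ τ) → ⊥
        finish {u} r x τ d≤K p outside attached d≤s = decide (K ≤? a)
          where
          open Rooted r
          module Cfg = Config G U u l x τ closed longest p
            (λ z → ≤-trans (≤-reflexive (cong (cnt z (x ∷ τ) +_) (cnt-C z))) (outside z)) attached
          close : Good K (c + length R) (E₂ U) → ⊥
          close good = bad (subst (λ m → Good K m (E₂ U)) (sym length-U) good)
          decide : Dec (K ≤ a) → ⊥
          decide (yes K≤a) = close (good-large-cycle (≤-trans (K≤a ⊕ K≤a)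
              (≤-trans (m≤m+n (a + a) ε) (≤-reflexive (sym c≡))))
                               d≤K E₂-C≤ (s≤s z≤n) E₂≤)
          decide (no K≰a) = apply (Cfg.Count.conclusion K a ε ε≤1 (trans (sym (↭-length C↭)) c≡)
              (≰⇒> K≰a)
              (λ w w∈ → ≤-trans (≤-reflexive (deg-C w)) (deg≤K (∈-resp-↭ (↭-sym C↭) w∈))))
            where
            apply : (∑ (λ w → ∑ (N w) (u ∷ l)) (u ∷ l) + (Cfg.ν + Cfg.t) * K ≤ length
                (u ∷ l) * K + (Cfg.ν + Cfg.t) * a + ε
                     × (Cfg.ν + Cfg.t) + (Cfg.ν + Cfg.t) ≤ length (u ∷ l)) → ⊥
            apply (goal , 2s≤c) = close (good-small-cycle c≡ ε≤1 (≰⇒> K≰a)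
                (≤-trans 2s≤c (≤-reflexive (sym (↭-length C↭)))) d≤s
              (≤-trans attached (m≤m+n _ _)) K<2d
              (subst₂ (λ i j → i + (Cfg.ν + Cfg.t) * K ≤ j * K + (Cfg.ν + Cfg.t) * a + ε) (sym E₂-C)
                  (sym (↭-length C↭)) goal) E₂≤)

        record Tail : Set where
          field
            u x      : V
            τ        : List V
            u∈C      : u ∈ C
            x∈R′     : x ∈ R′
            walk     : Walk x (x ∷ τ) u
            outside  : (x ∷ τ) ++ C ⊑ U

        R′⊑U : R′ ++ C ⊑ U
        R′⊑U z = ≤-trans (≤-reflexive (∑-++ (δ z) R′ C)) (≤-trans (+-monoˡ-≤ _ (R′⊑R z))
          (≤-reflexive (trans (+-comm _ (cnt z C)) (sym (cnt-U z)))))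

        R′⊆U : ∀ {z} → z ∈ R′ → z ∈ U
        R′⊆U z∈R′ = ⊑⇒∈ {l = R′ ++ C} {U} R′⊑U (∈-++⁺ˡ z∈R′)

        -- The list contains v as its last vertex, whereas a walk omits its end; so the path is
        -- given by its continuations from v to any neighbour z.
        Reach : List V → V → Set
        Reach Ω v = ∃[ τ ] (x₀ ∷ τ ⊑ Ω × (∀ {z} → v ~ z → Walk x₀ (x₀ ∷ τ) z))

        u₀∈C : u₀ ∈ C
        u₀∈C = go closed₀ 2≤C
          where
          go : ∀ {v l} → Walk v l u₀ → 2 ≤ length l → v ∈ l
          go (_ ∷ _) _ = here refl

        -- Ω collects vertices reached from x₀ off C. Since u₀ does not separate Ω from the rest,
        -- some edge leaves Ω without meeting u₀: it ends on C, or its end joins Ω.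
        search : ∀ f Ω → length U ≤ f + length Ω → 1 ≤ length Ω → Ω ++ C ⊑ U →
            (∀ {v} → v ∈ Ω → Reach Ω v) → (Tail → ⊥) → ⊥
        search zero Ω le 1≤Ω inv _ _ = 1≰0 (linear 3 (λ U Ω C → U :≤ con 0 :+ Ω ⇒ Ω :+ C :≤ U ⇒ con
            2 :≤ C ⇒ ⊢ con 1 :≤ con 0)
          (length U) (length Ω) c le (++-length Ω C inv) 2≤C)
        search (suc f) Ω le 1≤Ω inv reach κ = escape {u₀} {Ω} inU 1≤Ω
            (linear 3 (λ U Ω C → Ω :+ C :≤ U ⇒ con 2 :≤ C ⇒ ⊢ con 1 :+ (con 1 :+ Ω) :≤ U) (length U)
                (length Ω) c (++-length Ω C inv) 2≤C) found
          where
          inU : u₀ ∷ Ω ⊑ U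
          inU z = ≤-trans (+-monoˡ-≤ _ (∈⇒≤∑ (δ z) u₀∈C))
              (≤-trans (≤-reflexive (trans (+-comm (cnt z C) (cnt z Ω)) (sym (∑-++ (δ z) Ω C))))
              (inv z))
          found : ∀ {v z} → v ∈ Ω → z ∈ U → z ≢ u₀ → z ∉ Ω → v ~ z → ⊥
          found {v} {z} v∈Ω z∈U _ z∉Ω v~z = step (reach v∈Ω) (z ∈? C)
            where
            step : Reach Ω v → Dec (z ∈ C) → ⊥
            step (τ , τ⊑Ω , walks) (yes z∈C) = κ record
              { u = z ; x = x₀ ; τ = τ ; u∈C = z∈C ; x∈R′ = x₀∈R′ ; walk = walks v~z
              ; outside = λ w → ≤-trans (≤-reflexive (∑-++ (δ w) (x₀ ∷ τ) C))
                  (≤-trans (+-monoˡ-≤ _ (τ⊑Ω w)) (≤-trans (≤-reflexive (sym (∑-++ (δ w) Ω C))) (inv w)))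
                      }
            step (τ , τ⊑Ω , walks) (no z∉C) = search f (z ∷ Ω)
                (≤-trans le (≤-reflexive (sym (+-suc f (length Ω))))) (s≤s z≤n)
              (∷-⊑ z∈U (λ z∈ → either (∈-++⁻ Ω z∈)) inv) reach′ κ
              where
              either : z ∈ Ω ⊎ z ∈ C → ⊥
              either (inj₁ z∈Ω) = z∉Ω z∈Ω
              either (inj₂ z∈C) = z∉C z∈C
              reach′ : ∀ {w} → w ∈ z ∷ Ω → Reach (z ∷ Ω) w
              reach′ (here refl) = τ ++ z ∷ [] ,
                (λ w → linear 4 (λ l τ z Ω → l :≡ τ :+ (z :+ con 0) ⇒ τ :≤ Ω ⇒ ⊢ l :≤ z :+ Ω)
                  (cnt w (x₀ ∷ τ ++ z ∷ [])) (cnt w (x₀ ∷ τ)) (δ w z) (cnt w Ω)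
                      (∑-++ (δ w) (x₀ ∷ τ) (z ∷ [])) (τ⊑Ω w)) ,
                λ z~w → walks v~z ⋯ edge z~w
              reach′ (there w∈Ω) = let σ , σ⊑Ω , walks′ = reach w∈Ω in
                σ , (λ w → ≤-trans (σ⊑Ω w) (m≤n+m _ (δ w z))) , walks′

        Saturated : Tail → Set
        Saturated T = ∀ {w} → w ∈ R′ → x ~ w → w ∈ x ∷ τ
          where open Tail T

        -- As long as x has a neighbour in `R′` off the path, this neighbour becomes the new end;
        -- `f` bounds the number of such extensions.
        saturate : ∀ f T → length U ≤ f + length (Tail.τ T) → (∀ T → Saturated T → ⊥) → ⊥
        saturate zero T le _ = 1≰0 (linear 3 (λ U τ C → U :≤ con 0 :+ τ ⇒ con 1 :+ τ :+ C :≤ U ⇒ ⊢ con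
            1 :≤ con 0)
          (length U) (length (Tail.τ T)) c le (++-length (Tail.x T ∷ Tail.τ T) C (Tail.outside T)))
        saturate (suc f) T le κ = κ T saturated
          where
          open Tail T
          saturated : Saturated T
          saturated {w} w∈R′ x~w = member (w ∈? (x ∷ τ))
            where
            member : Dec (w ∈ x ∷ τ) → w ∈ x ∷ τ
            member (yes w∈) = w∈
            member (no w∉)  = ⊥-elim (saturate f record
              { u = u ; x = w ; τ = x ∷ τ ; u∈C = u∈C ; x∈R′ = w∈R′ ; walk = ~-sym x~w ∷ walk
              ; outside = ∷-⊑ (R′⊆U w∈R′) (λ w∈ → either (∈-++⁻ (x ∷ τ) w∈)) outside }
              (≤-trans le (≤-reflexive (sym (+-suc f (length τ))))) κ)
              where
              either : w ∈ x ∷ τ ⊎ w ∈ C → ⊥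
              either (inj₁ w∈) = w∉ w∈
              either (inj₂ w∈C) = ++-disjoint R′ R′⊑U w∈R′ w∈C

        module Ear (T : Tail) (saturated : Saturated T) where

          open Tail T

          r : Rooted u
          r = root u∈C

          open Rooted r

          nodup-τ : NoDup (x ∷ τ)
          nodup-τ z = ≤-trans (m≤m+n _ (cnt z C)) (≤-trans (≤-reflexive (sym (∑-++ (δ z) (x ∷ τ) C)))
              (≤-trans (outside z) (nodup z)))

          d≤ : d ≤ ∑ (N x) C + ∑ (N x) τ
          d≤ = ≤-trans (degree≥d x∈R′) (+-monoʳ-≤ (∑ (N x) C) (≤-trans
            (nbrs-⊆ x R′ (x ∷ τ) (λ z → ≤-trans (m≤m+n _ (cnt z C))
                (≤-trans (≤-reflexive (sym (∑-++ (δ z) R′ C))) (≤-trans (R′⊑U z) (nodup z)))) saturated)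
            (≤-reflexive (cong (_+ ∑ (N x) τ) (N-irrefl x)))))

          -- The path followed by the whole cycle is again a path that starts at x, so `path-degree`
          -- counts all neighbours of x on both.
          d≤K : d ≤ K
          d≤K = ≤-trans d≤ (≤-trans (≤-reflexive (trans (+-comm (∑ (N x) C) _)
              (trans (cong (∑ (N x) τ +_) (sym (deg-C x))) (sym (∑-++ (N x) τ (u ∷ l))))))
            (path-degree free (walk ⋯ closed) λ z → ≤-trans
                (≤-reflexive (trans (∑-++ (δ z) (x ∷ τ) (u ∷ l))
              (trans (cong (cnt z (x ∷ τ) +_) (cnt-C z)) (sym (∑-++ (δ z) (x ∷ τ) C)))))
                  (≤-trans (outside z) (nodup z))))

          count : ∀ w m → ∑ (N w) m ≤ length m
          count w m = ≤-trans (∑-≤ m λ _ → N≤1 w _) (≤-reflexive (*-identityʳ _))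

          x-deg : ∑ (N x) C ≡ N x u + ∑ (N x) l
          x-deg = sym (deg-C x)

          attached : 1 ≤ ∑ (N x) l → ⊥
          attached le = finish r x τ d≤K walk (λ z → ≤-trans (≤-reflexive (sym (∑-++ (δ z) (x ∷ τ) C)))
              (outside z)) le
            (linear 6 (λ d C τ u l t → d :≤ C :+ τ ⇒ C :≡ u :+ l ⇒ u :≤ con 1 ⇒
                τ :≤ t ⇒ ⊢ d :≤ l :+ (con 1 :+ t))
              d (∑ (N x) C) (∑ (N x) τ) (N x u) (∑ (N x) l) (length τ) d≤ x-deg (N≤1 x u) (count x τ))

          -- Required on the ear: x and its neighbours on the tail.
          Req : V → Set
          Req w = w ≡ x ⊎ (w ∈ τ × x ~ w)

          -- As a walk omits its end, a required vertex may also be y itself. Passing through x and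
          -- its neighbours is what keeps a rerouted path as long as d demands.
          Covering : V → List V → V → Set
          Covering y Ω v = ∃[ λs ] (Walk v λs y × λs ⊑ Ω × (∀ {w} → Req w → w ∈ λs ⊎ w ≡ y))

          Req⊆ : ∀ {w} → Req w → w ∈ x ∷ τ
          Req⊆ (inj₁ refl)      = here refl
          Req⊆ (inj₂ (w∈τ , _)) = there w∈τ

          module Detached (Nl : ∑ (N x) l ≡ 0) where

            d≤1+τ : d ≤ suc (∑ (N x) τ)
            d≤1+τ = linear 5 (λ d C τ u l → d :≤ C :+ τ ⇒ C :≡ u :+ l ⇒ u :≤ con 1 ⇒ l :≡ con
                0 ⇒ ⊢ d :≤ con 1 :+ τ)
              d (∑ (N x) C) (∑ (N x) τ) (N x u) (∑ (N x) l) d≤ x-deg (N≤1 x u) Nl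

            walk-start : ∀ {y p} → Walk y p u → y ∈ p ++ C
            walk-start []      = u∈C
            walk-start (_ ∷ _) = here refl

            -- The covering path from v to y, continued along p to u, contains x and all its
            -- neighbours on the tail, so it has at least d vertices; and v has the neighbour z
            -- other than u on C.
            found : ∀ {y p Ω v z} → Walk y p u → Ω ++ p ++ C ⊑ U → v ∈ Ω → Covering y Ω v → z ∈ l →
                v ~ z → ⊥
            found {y} {p} {Ω} {v} {z} pw inv v∈Ω ([] , [] , _ , _) z∈l v~z = ++-disjoint Ω inv v∈Ω
                (walk-start pw)
            found {y} {p} {Ω} {v} {z} pw inv v∈Ω (v ∷ λ′ , λw@(_ ∷ _) , λ⊑Ω , cov) z∈l v~z =
              finish r v (λ′ ++ p) d≤K (λw ⋯ pw) out nbr (≤-trans d≤η (m≤n+m _ (∑ (N v) l)))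
              where
              η : List V
              η = v ∷ λ′ ++ p
              out : ∀ w → cnt w η + cnt w C ≤ cnt w U
              out w = linear 7 (λ η λs p C Ω X U → η :≡ λs :+ p ⇒ λs :≤ Ω ⇒ Ω :+ (p :+ C) :≡ X ⇒
                  X :≤ U ⇒ ⊢ η :+ C :≤ U)
                (cnt w η) (cnt w (v ∷ λ′)) (cnt w p) (cnt w C) (cnt w Ω) (cnt w (Ω ++ p ++ C)) (cnt w U)
                (∑-++ (δ w) (v ∷ λ′) p) (λ⊑Ω w) (sym (∑-++₃ (δ w) Ω p C)) (inv w)
              nbr : 1 ≤ ∑ (N v) l
              nbr = ≤-trans (≤-reflexive (sym (N-adj v~z))) (∈⇒≤∑ (N v) z∈l)
              Req⇒η : ∀ {w} → Req w → w ∈ η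
              Req⇒η {w} q = either (cov q)
                where
                either : w ∈ v ∷ λ′ ⊎ w ≡ y → w ∈ η
                either (inj₁ w∈)   = ∈-++⁺ˡ w∈
                either (inj₂ refl) with ∈-++⁻ p (walk-start pw)
                ... | inj₁ y∈p = ∈-++⁺ʳ (v ∷ λ′) y∈p
                ... | inj₂ y∈C = ⊥-elim (++-disjoint (x ∷ τ) outside (Req⊆ q) y∈C)
              d≤η : d ≤ length η
              d≤η = ≤-trans d≤1+τ (≤-trans (s≤s (nbrs-⊆ x τ η
                  (λ z → ≤-trans (m≤n+m _ (δ z x)) (nodup-τ z)) λ w∈τ x~w → Req⇒η (inj₂ (w∈τ , x~w))))
                      (degree< (Req⇒η (inj₁ refl))))

            -- The root y is joined to u ∈ C by the walk p, and each vertex of Ω is joined to y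
            -- inside Ω by a walk through all required vertices.  An edge that leaves Ω without
            -- using y ends on C, which yields the ear, or on p, which yields a root closer to u,
            -- or at a new vertex, which joins Ω.
            loop : ∀ f {y p Ω} → length U ≤ f + length Ω → 1 ≤ length Ω → Walk y p u → Ω ++ p ++ C ⊑ U →
                   (∀ {v} → v ∈ Ω → Covering y Ω v) → ⊥
            loop zero {y} {p} {Ω} le _ _ inv _ = 1≰0 (linear 5
                (λ U Ω p C pC → U :≤ con 0 :+ Ω ⇒ Ω :+ pC :≤ U ⇒ con 2 :≤ C ⇒ p :+ C :≡ pC ⇒ ⊢ con
                1 :≤ con 0)
              (length U) (length Ω) (length p) c (length (p ++ C)) le (++-length Ω (p ++ C) inv) 2≤C
                  (sym (length-++ p)))
            loop (suc f) {y} {p} {Ω} le 1≤Ω pw inv cover = escape {y} {Ω} inU 1≤Ω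
                (linear 5 (λ U Ω p C pC → Ω :+ pC :≤ U ⇒ con 2 :≤ C ⇒ p :+ C :≡ pC ⇒ ⊢ con
                    1 :+ (con 1 :+ Ω) :≤ U)
                  (length U) (length Ω) (length p) c (length (p ++ C)) (++-length Ω (p ++ C) inv) 2≤C
                      (sym (length-++ p)))
                step
              where
              inU : y ∷ Ω ⊑ U
              inU z = ≤-trans (+-monoˡ-≤ _ (∈⇒≤∑ (δ z) (walk-start pw)))
                (≤-trans (≤-reflexive (trans (+-comm (cnt z (p ++ C)) (cnt z Ω))
                    (sym (∑-++ (δ z) Ω (p ++ C))))) (inv z))

              -- z becomes the root and the bypassed part p₁ joins Ω. It is not empty since z ≠ y,
              -- so Ω grows.
              descend : ∀ {v z} p₁ p₂ → p ≡ p₁ ++ p₂ → Walk y p₁ z → Walk z p₂ u → z ≢ y → v ∈ Ω →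
                  v ~ z → ⊥
              descend p₁ p₂ eq [] q z≢y v∈Ω v~z = z≢y refl
              descend {v} {z} p₁@(y ∷ p₁′) p₂ eq q₁@(_ ∷ _) q₂ z≢y v∈Ω v~z = loop f {z} {p₂} {Ω ++ p₁}
                  (linear 5 (λ U f Ω p X → U :≤ con 1 :+ f :+ Ω ⇒
                      Ω :+ (con 1 :+ p) :≡ X ⇒ ⊢ U :≤ f :+ X)
                    (length U) f (length Ω) (length p₁′) (length (Ω ++ p₁)) le (sym (length-++ Ω)))
                  (≤-trans 1≤Ω (≤-trans (m≤m+n _ _) (≤-reflexive (sym (length-++ Ω)))))
                  q₂ (λ w → ≤-trans (≤-reflexive (cong (cnt w)
                      (trans (++-assoc Ω p₁ (p₂ ++ C)) (cong (Ω ++_)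
                       (trans (sym (++-assoc p₁ p₂ C)) (cong (_++ C) (sym eq))))))) (inv w)) cover′
                where
                above : ∀ {v′} → v′ ∈ Ω → Covering y Ω v′ → Covering z (Ω ++ p₁) v′
                above v′∈Ω (λs , λw , λ⊑Ω , cov) = λs ++ p₁ , λw ⋯ q₁ ,
                  (λ w → ≤-trans (≤-reflexive (∑-++ (δ w) λs p₁))
                      (≤-trans (+-monoˡ-≤ _ (λ⊑Ω w)) (≤-reflexive (sym (∑-++ (δ w) Ω p₁))))) ,
                  λ q → inj₁ (either (cov q))
                  where
                  either : ∀ {w} → w ∈ λs ⊎ w ≡ y → w ∈ λs ++ p₁
                  either (inj₁ w∈)   = ∈-++⁺ˡ w∈
                  either (inj₂ refl) = ∈-++⁺ʳ λs (here refl)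
                -- Go from v′ back along p₁ to the old root y, back along the covering path of v to
                -- v itself, and over the edge to z.
                below : ∀ {v′} → ∃[ m₁ ] ∃[ m₂ ] (p₁ ≡ m₁ ++ v′ ∷ m₂ × Walk y m₁ v′ × Walk v′ (v′ ∷ m₂)
                    z) →
                        Covering y Ω v → Covering z (Ω ++ p₁) v′
                below {v′} (m₁ , m₂ , eq₁ , w₁ , _) (λs , λw , λ⊑Ω , cov) =
                  let a , aw , _ , ∑a = reverse-walk w₁
                      b , bw , _ , ∑b = reverse-walk λw
                      total : ∀ g → ∑ g (a ++ b ++ v ∷ []) ≡ ∑ g m₁ + g v′ + ∑ g λs
                      total g = trans (∑-++₃ g a b (v ∷ []))
                          (arr (∑ g a) (∑ g b) (g v) (∑ g m₁) (g v′) (∑ g λs) (g y) (∑a g) (∑b g))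
                  in a ++ b ++ v ∷ [] , aw ⋯ bw ⋯ edge v~z ,
                     (λ w → linear 8 (λ X m₁ v′ m₂ λs Ω p₁ Y → X :≡ m₁ :+ v′ :+ λs ⇒ λs :≤ Ω ⇒
                         m₁ :+ (v′ :+ m₂) :≡ p₁ ⇒ Ω :+ p₁ :≡ Y ⇒ ⊢ X :≤ Y)
                       (cnt w (a ++ b ++ v ∷ [])) (cnt w m₁) (δ w v′) (cnt w m₂) (cnt w λs) (cnt w Ω)
                           (cnt w p₁) (cnt w (Ω ++ p₁))
                       (total (δ w)) (λ⊑Ω w) (sym (trans (cong (cnt w) eq₁) (∑-++ (δ w) m₁ (v′ ∷ m₂))))
                           (sym (∑-++ (δ w) Ω p₁))) ,
                     λ {w} q → inj₁ (cnt⇒∈ _ (≤-trans (positive (cov q))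
                         (≤-reflexive (sym (total (δ w))))))
                  where
                  arr : ∀ a b v m₁ v′ λs y → a + y ≡ m₁ + v′ → b + v ≡ λs + y →
                      a + (b + (v + 0)) ≡ m₁ + v′ + λs
                  arr a b v m₁ v′ λs y e₁ e₂ = +-cancelʳ-≡ y _ _
                      (trans (arr₁ a b v y) (trans (cong₂ _+_ e₁ e₂) (arr₂ (m₁ + v′) λs y)))
                    where
                    arr₁ : ∀ a b v y → a + (b + (v + 0)) + y ≡ a + y + (b + v)
                    arr₁ = solve-∀
                    arr₂ : ∀ m λs y → m + (λs + y) ≡ m + λs + y
                    arr₂ = solve-∀
                  y∈ : ∀ m₁ {m₂} → y ∷ p₁′ ≡ m₁ ++ v′ ∷ m₂ → 1 ≤ cnt y m₁ + δ y v′
                  y∈ []       refl = ≤-reflexive (sym (δ-refl y))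
                  y∈ (_ ∷ m₁) refl = ≤-trans (≤-reflexive (sym (δ-refl y)))
                      (≤-trans (m≤m+n _ _) (m≤m+n _ _))
                  positive : ∀ {w} → w ∈ λs ⊎ w ≡ y → 1 ≤ cnt w m₁ + δ w v′ + cnt w λs
                  positive (inj₁ w∈)   = ≤-trans (∈⇒cnt w∈) (m≤n+m _ _)
                  positive (inj₂ refl) = ≤-trans (y∈ m₁ eq₁) (m≤m+n _ _)
                cover′ : ∀ {v′} → v′ ∈ Ω ++ p₁ → Covering z (Ω ++ p₁) v′
                cover′ {v′} v′∈ = either (∈-++⁻ Ω v′∈)
                  where
                  either : v′ ∈ Ω ⊎ v′ ∈ p₁ → Covering z (Ω ++ p₁) v′
                  either (inj₁ v′∈Ω)  = above v′∈Ω (cover v′∈Ω)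
                  either (inj₂ v′∈p₁) = below (splitAt∈ q₁ v′∈p₁) (cover v∈Ω)

              step : ∀ {v z} → v ∈ Ω → z ∈ U → z ≢ y → z ∉ Ω → v ~ z → ⊥
              step {v} {z} v∈Ω z∈U z≢y z∉Ω v~z = decide (z ∈? p) (z ≟ u) (z ∈? l)
                where
                decide : Dec (z ∈ p) → Dec (z ≡ u) → Dec (z ∈ l) → ⊥
                decide (yes z∈p) _ _ = let p₁ , p₂ , eq , q₁ , q₂ = splitAt∈ pw z∈p in descend p₁ (z ∷ p₂) eq q₁ q₂ z≢y v∈Ω v~z
                decide (no _) (yes refl) _ = descend p [] (sym (++-identityʳ p)) pw [] z≢y v∈Ω v~z
                decide (no _) (no _) (yes z∈l) = found pw inv v∈Ω (cover v∈Ω) z∈l v~z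
                decide (no z∉p) (no z≢u) (no z∉l) = loop f {y} {p} {z ∷ Ω}
                    (≤-trans le (≤-reflexive (sym (+-suc f (length Ω))))) (s≤s z≤n) pw
                        (∷-⊑ z∈U fresh inv) cover′
                  where
                  fresh : z ∉ Ω ++ p ++ C
                  fresh z∈ with ∈-++⁻ Ω z∈
                  ... | inj₁ z∈Ω = z∉Ω z∈Ω
                  ... | inj₂ z∈′ with ∈-++⁻ p z∈′
                  ...   | inj₁ z∈p = z∉p z∈p
                  ...   | inj₂ z∈C with ∈-resp-↭ C↭ z∈C
                  ...     | here z≡u  = z≢u z≡u
                  ...     | there z∈l = z∉l z∈l
                  new : Covering y Ω v → Covering y (z ∷ Ω) z
                  new (λs , λw , λ⊑Ω , cov) = z ∷ λs , ~-sym v~z ∷ λw ,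
                      (λ w → +-monoʳ-≤ (δ w z) (λ⊑Ω w)) , λ q → either (cov q)
                    where
                    either : ∀ {w} → w ∈ λs ⊎ w ≡ y → w ∈ z ∷ λs ⊎ w ≡ y
                    either (inj₁ w∈) = inj₁ (there w∈)
                    either (inj₂ eq) = inj₂ eq
                  old : ∀ {v′} → Covering y Ω v′ → Covering y (z ∷ Ω) v′
                  old (λs , λw , λ⊑Ω , cov) = λs , λw , (λ w → ≤-trans (λ⊑Ω w) (m≤n+m _ (δ w z))) , cov
                  cover′ : ∀ {v′} → v′ ∈ z ∷ Ω → Covering y (z ∷ Ω) v′
                  cover′ (here refl)  = new (cover v∈Ω)
                  cover′ (there v′∈Ω) = old (cover v′∈Ω)

            firstNbr : ∀ m {s y} → Walk s m y → x ~ y →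
                       ∃[ m₁ ] ∃[ m₂ ] ∃[ w ] (m ≡ m₁ ++ m₂ × Walk w m₂ y × x ~ w × ∑ (N x) m₁ ≡ 0)
            firstNbr []      [] x~y = [] , [] , _ , refl , [] , x~y , refl
            firstNbr (s ∷ m) (e ∷ p) x~y with x ~? s
            ... | yes x~s = [] , s ∷ m , s , refl , e ∷ p , x~s , refl
            ... | no ¬x~s with m₁ , m₂ , w , refl , q , x~w , N₁ ← firstNbr m p x~y =
                  s ∷ m₁ , m₂ , w , refl , q , x~w , trans (cong (_+ ∑ (N x) m₁) (N-nonadj ¬x~s)) N₁

            -- The neighbour y of x nearest to the cycle along the tail is the first root.
            begin : ∀ {τ₁ y τ₂} → τ ≡ τ₁ ++ y ∷ τ₂ → Walk x (x ∷ τ₁) y → Walk y (y ∷ τ₂) u → x ~ y → ∑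
                (N x) τ₂ ≡ 0 → ⊥
            begin {τ₁} {y} {τ₂} eq p q x~y Nτ₂ = loop (length U) {y} {y ∷ τ₂} {x ∷ τ₁} (m≤m+n _ _)
                (s≤s z≤n) q inv λ v∈ → cover (splitAt∈ p v∈)
              where
              inv : (x ∷ τ₁) ++ (y ∷ τ₂) ++ C ⊑ U
              inv = subst (_⊑ U) (trans (cong (λ m → (x ∷ m) ++ C) eq) (++-assoc (x ∷ τ₁) (y ∷ τ₂) C))
                  outside
              cover : ∀ {v} → ∃[ m₁ ] ∃[ m₂ ] (x ∷ τ₁ ≡ m₁ ++ v ∷ m₂ × Walk x m₁ v × Walk v (v ∷ m₂) y)
                  → Covering y (x ∷ τ₁) v
              cover {v} (m₁ , m₂ , eq₁ , w₁ , w₂) =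
                let _ , _ , w₂′ = uncons-walk w₂
                    n₁ , n₂ , w₀ , eq₂ , w₃ , x~w₀ , N₁ = firstNbr m₂ w₂′ x~y
                    a , aw , _ , ∑a = reverse-walk w₁
                in covering n₁ n₂ w₀ eq₂ w₃ x~w₀ N₁ a aw ∑a
                where
                covering : ∀ n₁ n₂ w₀ → m₂ ≡ n₁ ++ n₂ → Walk w₀ n₂ y → x ~ w₀ → ∑ (N x) n₁ ≡ 0 → ∀ a →
                    Walk v a x →
                           (∀ g → ∑ g a + g x ≡ ∑ g m₁ + g v) → Covering y (x ∷ τ₁) v
                -- Go from v back to x, jump to the first neighbour of x after v, and continue to y.
                -- Only `n₁` is skipped, which contains no neighbour of x.
                covering n₁ n₂ w₀ eq₂ w₃ x~w₀ N₁ a aw ∑a = a ++ x ∷ n₂ , aw ⋯ (x~w₀ ∷ w₃) ,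
                    below , req
                  where
                  total : ∀ g → ∑ g (a ++ x ∷ n₂) ≡ ∑ g m₁ + (g v + ∑ g n₂)
                  total g = trans (∑-++ g a (x ∷ n₂)) (trans (sym (+-assoc (∑ g a) (g x) (∑ g n₂)))
                              (trans (cong (_+ ∑ g n₂) (∑a g)) (+-assoc (∑ g m₁) (g v) (∑ g n₂))))
                  whole : ∀ g → ∑ g (x ∷ τ₁) ≡ ∑ g m₁ + (g v + (∑ g n₁ + ∑ g n₂))
                  whole g = trans (cong (∑ g) eq₁) (trans (∑-++ g m₁ (v ∷ m₂))
                      (cong (λ k → ∑ g m₁ + (g v + k))
                              (trans (cong (∑ g) eq₂) (∑-++ g n₁ n₂))))
                  below : ∀ w → cnt w (a ++ x ∷ n₂) ≤ cnt w (x ∷ τ₁)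
                  below w = linear 6 (λ X Y m v n₁ n₂ → X :≡ m :+ (v :+ n₂) ⇒
                      m :+ (v :+ (n₁ :+ n₂)) :≡ Y ⇒ ⊢ X :≤ Y)
                    (cnt w (a ++ x ∷ n₂)) (cnt w (x ∷ τ₁)) (cnt w m₁) (δ w v) (cnt w n₁) (cnt w n₂)
                        (total (δ w)) (sym (whole (δ w)))
                  req : ∀ {w} → Req w → w ∈ a ++ x ∷ n₂ ⊎ w ≡ y
                  req (inj₁ refl) = inj₁ (∈-++⁺ʳ a (here refl))
                  req {w} (inj₂ (w∈τ , x~w)) = place (∈-++⁻ τ₁ (subst (w ∈_) eq w∈τ))
                    where
                    not-nbr : ∀ {m} → ∑ (N x) m ≡ 0 → w ∉ m
                    not-nbr {m} N0 w∈m = 1≰0 (≤-trans (≤-reflexive (sym (N-adj x~w)))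
                        (≤-trans (∈⇒≤∑ (N x) w∈m) (≤-reflexive N0)))
                    place : w ∈ τ₁ ⊎ w ∈ y ∷ τ₂ → w ∈ a ++ x ∷ n₂ ⊎ w ≡ y
                    place (inj₂ (here w≡y))   = inj₂ w≡y
                    place (inj₂ (there w∈τ₂)) = ⊥-elim (not-nbr {τ₂} Nτ₂ w∈τ₂)
                    place (inj₁ w∈τ₁) = inj₁ (cnt⇒∈ _ (linear 6
                        (λ X Y m v n₁ n₂ → con 1 :≤ Y ⇒ Y :≡ m :+ (v :+ (n₁ :+ n₂)) ⇒ n₁ :≡ con 0 ⇒
                        m :+ (v :+ n₂) :≡ X ⇒ ⊢ con 1 :≤ X)
                      (cnt w (a ++ x ∷ n₂)) (cnt w (x ∷ τ₁)) (cnt w m₁) (δ w v) (cnt w n₁) (cnt w n₂)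
                      (≤-trans (∈⇒cnt w∈τ₁) (m≤n+m _ (δ w x))) (whole (δ w))
                          (∉⇒cnt {l = n₁} (not-nbr {n₁} N₁)) (sym (total (δ w)))))

            impossible : ⊥
            impossible =
              let τ₁ , y , τ₂ , eq , x~y , N₂ = lastNbr x τ (≤-pred (≤-trans 2≤d d≤1+τ))
                  _ , p , q = split (x ∷ τ₁) (subst (λ m → Walk x (x ∷ m) u) eq walk)
              in start eq p q (head≡ q) x~y N₂
              where
              -- K ≥ 2 since k ≥ 1, and K < 2d. Hence x has a neighbour on the tail, as the first
              -- root requires.
              2≤d : 2 ≤ d
              2≤d = ≮⇒≥ λ { (s≤s d≤1) → 1≰0 (linear 2 (λ d k → con 1 :≤ k ⇒ con
                  1 :+ (con 1 :+ k) :≤ d :+ d ⇒ d :≤ con 1 ⇒ d :≤ con 1 ⇒ ⊢ con 1 :≤ con 0)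
                d k 1≤k K<2d d≤1 d≤1) }
              start : ∀ {τ₁ y τ₂ w} → τ ≡ τ₁ ++ y ∷ τ₂ → Walk x (x ∷ τ₁) w → Walk w (y ∷ τ₂) u → y ≡ w →
                  x ~ y → ∑ (N x) τ₂ ≡ 0 → ⊥
              start eq p q refl x~y N₂ = begin eq p q x~y N₂

          impossible : ⊥
          impossible = decide (1 ≤? ∑ (N x) l)
            where
            decide : Dec (1 ≤ ∑ (N x) l) → ⊥
            decide (yes 1≤)  = attached 1≤
            decide (no 1≰ν) = Detached.impossible (n<1⇒n≡0 (≰⇒> 1≰ν))

        impossible : ⊥
        impossible = search (length U) (x₀ ∷ []) (m≤m+n _ _) (s≤s z≤n)
          (∷-⊑ (R′⊆U x₀∈R′) (++-disjoint R′ R′⊑U x₀∈R′) C⊑U)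
          (λ where (here refl) → [] , (λ _ → ≤-refl) , λ e → edge e)
          λ T → saturate (length U) T (m≤m+n _ _) λ T sat → Ear.impossible T sat

      impossible : ⊥
      impossible = let R , U↭ = complement C {U} C⊑U
                       d , W≤ , core = peel C (length R) R ≤-refl
                   in decide R U↭ d W≤ core (d + d ≤? K)
        where
        decide : ∀ R → U ↭ C ++ R → ∀ d → weight C R ≤ length R * d + length R * d → d ≡ 0 ⊎ Core C R
            d → Dec (d + d ≤ K) → ⊥
        decide R U↭ d W≤ core (yes 2d≤K) = bad (inj₁ (begin
          E₂ U                                           ≡⟨ trans (E₂-↭ U↭) (E₂-++ C R) ⟩
          E₂ C + weight C R                              ≤⟨ +-mono-≤ E₂-C≤ W≤ ⟩
          length C * K + (length R * d + length R * d)   ≡⟨ cong (length C * K +_)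
              (*-distribˡ-+ (length R) d d) ⟨
          length C * K + length R * (d + d)              ≤⟨ +-monoʳ-≤ (length C * K)
              (*-monoʳ-≤ (length R) 2d≤K) ⟩
          length C * K + length R * K                    ≡⟨ *-distribʳ-+ K (length C) (length R) ⟨
          (length C + length R) * K                      ≡⟨ *-comm (length C + length R) K ⟩
          K * (length C + length R)                      ≡⟨ cong (K *_)
              (trans (↭-length U↭) (length-++ C)) ⟨
          K * length U                                   ∎))
          where open ≤-Reasoning
        decide R U↭ d W≤ (inj₁ refl) (no ≰) = ≰ z≤n
        decide R U↭ d W≤ (inj₂ (R′ , x₀ , x₀∈R′ , R′⊑R , large)) (no ≰) =
          Peeled.impossible R U↭ d W≤ (≰⇒> ≰) R′ x₀ x₀∈R′ R′⊑R large

    -- `f` bounds how often a longer closed walk can still be found. The ascent starts with an edge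
    -- walked back and forth, so the existence of a proper cycle need not be shown.
    grow : ∀ f {v} C → Walk v C v → C ⊑ U → 2 ≤ length C → length U ≤ f + length C → ⊥
    grow f {v} C closed C⊑U 2≤C le = LongestCycle.impossible C v closed C⊑U 2≤C λ {w} {m} p m⊑U → ≮⇒≥
        (longer f le p m⊑U)
      where
      longer : ∀ f → length U ≤ f + length C → ∀ {w m} → Walk w m w → m ⊑ U → length C < length m → ⊥
      longer zero le {m = m} p m⊑U lt = <-irrefl refl (≤-trans lt
          (≤-trans (⊑-length {l = m} {U} m⊑U) le))
      longer (suc f) le {m = m} p m⊑U lt = grow f m p m⊑U (≤-trans 2≤C (<⇒≤ lt))
        (≤-trans le (≤-trans (≤-reflexive (sym (+-suc f (length C)))) (+-monoʳ-≤ f lt)))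

    impossible : ⊥
    impossible = bad (inj₁ (≤-trans (≤-reflexive (∑-≡0 U λ v∈U → ∑-≡0 U λ w∈U → N-nonadj
        (no-edge v∈U w∈U))) z≤n))
      where
      no-edge : ∀ {v w} → v ∈ U → w ∈ U → ¬ v ~ w
      no-edge {v} {w} v∈U w∈U v~w = grow (length U) (v ∷ w ∷ []) (v~w ∷ edge (~-sym v~w))
        (∷-⊑ {l = w ∷ []} v∈U (λ { (here v≡w) → ~⇒≢ v~w v≡w }) (∷-⊑ {l = []} w∈U (λ ()) λ _ → z≤n))
            ≤-refl (m≤m+n _ _)

  good : ∀ f U → NoDup U → length U ≤ f → ¬ ¬ Good K (length U) (E₂ U)
  good zero [] _ _ bad = bad (inj₁ z≤n)
  good (suc f) U nodup le bad = Step.impossible U nodup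
    (λ U′ nodup′ lt → good f U′ nodup′ (≤-pred (≤-trans lt le))) bad

-- From degree sums to the stated bound on edges

∑-product : ∀ {A B : Set} (g : A × B → ℕ) l m → ∑ g (cartesianProduct l m) ≡ ∑
    (λ x → ∑ (λ y → g (x , y)) m) l
∑-product g []      m = refl
∑-product g (x ∷ l) m = trans (∑-++ g (map (x ,_) m) (cartesianProduct l m))
  (cong₂ _+_ (∑-map g (x ,_) m) (∑-product g l m))

module _ {n : ℕ} (G : Graph n) where

  open Graph G
  open Walks G
  open Edges G

  handshake : ∣E G ∣ + ∣E G ∣ ≡ E₂ (allFin n)
  handshake = sym (trans (∑-cong (allFin n) λ {u} _ → trans (∑-cong (allFin n) λ {v} _ → N-split′ u v)
      (∑-+ _ _ (allFin n)))
    (trans (∑-+ _ _ (allFin n)) (cong₂ _+_ (sym edges) (trans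
        (∑-swap (λ u v → e v u) (allFin n) (allFin n)) (sym edges)))))
    where
    e : V → V → ℕ
    e u v = 𝟙 ((u <?ᶠ v) ×-dec (u ~? v))
    edges : ∣E G ∣ ≡ ∑ (λ u → ∑ (e u) (allFin n)) (allFin n)
    edges = trans (∑-filter _ (cartesianProduct (allFin n) (allFin n)))
        (∑-product _ (allFin n) (allFin n))
    N-split′ : ∀ u v → N u v ≡ e u v + e v u
    N-split′ u v with <-cmpᶠ u v
    ... | tri< u<v _ v≮u = trans (𝟙-cong (u ~? v) ((u <?ᶠ v) ×-dec (u ~? v)) (u<v ,_) proj₂)
            (trans (sym (+-identityʳ _)) (cong (e u v +_)
                (sym (𝟙-no ((v <?ᶠ u) ×-dec (v ~? u)) λ (v<u , _) → v≮u v<u))))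
    ... | tri≈ u≮v refl _ = trans (N-irrefl u) (sym (cong (λ k → k + k)
        (𝟙-no ((u <?ᶠ u) ×-dec (u ~? u)) λ (u<u , _) → u≮v u<u)))
    ... | tri> u≮v _ v<u = trans (𝟙-cong (u ~? v) ((v <?ᶠ u) ×-dec (v ~? u)) (λ u~v → v<u , ~-sym u~v)
        (λ (_ , v~u) → ~-sym v~u))
            (cong (_+ e v u) (sym (𝟙-no ((u <?ᶠ v) ×-dec (u ~? v)) λ (u<v , _) → u≮v u<v)))

⌊x+x+y/2⌋ : ∀ x y → ⌊ x + x + y /2⌋ ≡ x + ⌊ y /2⌋
⌊x+x+y/2⌋ zero    y = refl
⌊x+x+y/2⌋ (suc x) y = trans (cong (λ m → ⌊ suc m + y /2⌋) (+-suc x x)) (cong suc (⌊x+x+y/2⌋ x y))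

half-≤ : ∀ {e m} → e + e ≤ m → e ≤ ⌊ m /2⌋
half-≤ {e} {m} le = ≤-trans (≤-reflexive (sym (trans (⌊x+x+y/2⌋ e 0) (+-identityʳ e))))
  (⌊n/2⌋-mono (≤-trans (≤-reflexive (+-identityʳ (e + e))) le))

value-at : ℕ → ℕ → ℕ → ℕ
value-at k n a = a * (n ∸ a) + ⌊ a * (k + 1 ∸ a) /2⌋

extremal : ℕ → ℕ → ℕ
extremal k n = ⌊ (k + 1) * n /2⌋ ⊔ max[ ⌊ k + 1 /2⌋ + 1 ⋯ k + 1 ] (value-at k n)

≤max : ∀ {lo hi a} f → lo ≤ a → a ≤ hi → f a ≤ max[ lo ⋯ hi ] f
≤max {lo} {hi} f lo≤a a≤hi = All-lookup (xs≤max 0 (map f (filter (lo ≤?_) (upTo (suc hi)))))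
  (∈-map⁺ f (∈-filter⁺ (lo ≤?_) (∈-upTo⁺ (s≤s a≤hi)) lo≤a))

half< : ∀ {k a} → suc k < a + a → ⌊ k + 1 /2⌋ + 1 ≤ a
half< {k} {a} lt = ≤-trans (≤-reflexive (+-comm ⌊ k + 1 /2⌋ 1)) (≰⇒> λ a≤ → <-irrefl refl (≤-trans lt
  (≤-trans (a≤ ⊕ a≤) (≤-trans (+-monoʳ-≤ ⌊ k + 1 /2⌋ (⌊n/2⌋≤⌈n/2⌉ (k + 1)))
      (≤-reflexive (trans (⌊n/2⌋+⌈n/2⌉≡n (k + 1)) (+-comm k 1)))))))

-- Since a ≤ k + 1 < n, the truncated subtractions are exact; halving and rounding down give the
-- terms of the theorem.
good⇒≤ : ∀ {k n e} → k + 2 ≤ n → Good (suc k) n (e + e) → e ≤ extremal k n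
good⇒≤ {k} {n} {e} k+2≤n (inj₁ le) = ≤-trans (half-≤ {e}
    (≤-trans le (≤-reflexive (cong (_* n) (+-comm 1 k))))) (m≤m⊔n _ _)
good⇒≤ {k} {n} {e} k+2≤n (inj₂ (a , lt , a≤K , le)) = ≤-trans e≤ (≤-trans
    (≤max (value-at k n) (half< lt) (≤-trans a≤K (≤-reflexive (+-comm 1 k))))
        (m≤n⊔m ⌊ (k + 1) * n /2⌋ _))
  where
  b j : ℕ
  b = n ∸ a
  j = k + 1 ∸ a
  a+b : n ≡ a + b
  a+b = sym (m+[n∸m]≡n (≤-trans a≤K (≤-trans (≤-trans (n≤1+n (suc k)) (≤-reflexive (+-comm 2 k)))
      k+2≤n)))
  a+j : suc k ≡ a + j
  a+j = trans (+-comm 1 k) (sym (m+[n∸m]≡n (≤-trans a≤K (≤-reflexive (+-comm 1 k)))))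
  e≤ : e ≤ value-at k n a
  e≤ = ≤-trans (half-≤ {e} (linear 6 (λ e aa an aK ab aj →
      e :+ e :+ (aa :+ aa :+ aa) :≤ an :+ an :+ aK ⇒ an :≡ aa :+ ab ⇒ an :≡ aa :+ ab ⇒ aK :≡ aa :+ aj ⇒
          ⊢ e :+ e :≤ ab :+ ab :+ aj)
        e (a * a) (a * n) (a * suc k) (a * b) (a * j) le
        (trans (cong (a *_) a+b) (*-distribˡ-+ a a b)) (trans (cong (a *_) a+b) (*-distribˡ-+ a a b))
        (trans (cong (a *_) a+j) (*-distribˡ-+ a a j))))
      (≤-reflexive (⌊x+x+y/2⌋ (a * b) (a * j)))

upper-bound : ∀ {k n} → 1 ≤ k → k + 2 ≤ n → (G : Graph n) → ¬ HasCycleWithChords k G → ∣E G ∣ ≤ extremal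
    k n
upper-bound {k} {n} 1≤k k+2≤n G free = decidable-stable (∣E G ∣ ≤? extremal k n) λ ¬le →
  Induction.good G k 1≤k free n (allFin n) (λ z → ≤-reflexive (cnt-allFin z)) (≤-reflexive len) λ good →
  ¬le (good⇒≤ k+2≤n (subst₂ (Good (suc k)) len (sym (handshake G)) good))
  where
  len : length (allFin n) ≡ n
  len = length-tabulate id

-- Extremal graphs

𝟙-exclusive : ∀ {P Q : Set} (p? : Dec P) (q? : Dec Q) → (P → ¬ Q) → 𝟙 p? + 𝟙 q? ≤ 1
𝟙-exclusive (yes p) q? f = ≤-reflexive (cong suc (𝟙-no q? (f p)))
𝟙-exclusive (no _)  q? f = 𝟙≤1 q?

𝟙-mono : ∀ {P Q : Set} (p? : Dec P) (q? : Dec Q) → (P → Q) → 𝟙 p? ≤ 𝟙 q?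
𝟙-mono (yes p) q? f = ≤-reflexive (sym (𝟙-yes q? (f p)))
𝟙-mono (no _)  q? f = z≤n

-- On ℕ, unlike on `Fin n`, ranges of summation can be split, shifted and reversed by plain
-- arithmetic.
S : ℕ → (ℕ → ℕ) → ℕ
S zero    f = 0
S (suc n) f = f 0 + S n (f ∘ suc)

∑-toℕ : ∀ n (f : ℕ → ℕ) → ∑ (f ∘ toℕ) (allFin n) ≡ S n f
∑-toℕ zero    f = refl
∑-toℕ (suc n) f = cong (f 0 +_) (trans (∑-tabulate {m = n} (f ∘ toℕ) suc) (∑-toℕ n (f ∘ suc)))

S-cong : ∀ n {f g : ℕ → ℕ} → (∀ j → j < n → f j ≡ g j) → S n f ≡ S n g
S-cong zero    eq = refl
S-cong (suc n) eq = cong₂ _+_ (eq 0 (s≤s z≤n)) (S-cong n λ j j<n → eq (suc j) (s≤s j<n))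

S-mono : ∀ n {f g : ℕ → ℕ} → (∀ j → j < n → f j ≤ g j) → S n f ≤ S n g
S-mono zero    le = z≤n
S-mono (suc n) le = le 0 (s≤s z≤n) ⊕ S-mono n λ j j<n → le (suc j) (s≤s j<n)

S-const : ∀ n c → S n (λ _ → c) ≡ n * c
S-const zero    c = refl
S-const (suc n) c = cong (c +_) (S-const n c)

S-0 : ∀ n {f : ℕ → ℕ} → (∀ j → j < n → f j ≡ 0) → S n f ≡ 0
S-0 n eq = trans (S-cong n eq) (trans (S-const n 0) (*-zeroʳ n))

S-1 : ∀ n {f : ℕ → ℕ} → (∀ j → j < n → f j ≡ 1) → S n f ≡ n
S-1 n eq = trans (S-cong n eq) (trans (S-const n 1) (*-identityʳ n))

S-+ : ∀ n (f g : ℕ → ℕ) → S n (λ j → f j + g j) ≡ S n f + S n g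
S-+ zero    f g = refl
S-+ (suc n) f g = trans (cong (f 0 + g 0 +_) (S-+ n (f ∘ suc) (g ∘ suc))) (arr (f 0) (g 0) _ _)
  where
  arr : ∀ a b c d → a + b + (c + d) ≡ a + c + (b + d)
  arr = solve-∀

S-* : ∀ n c (f : ℕ → ℕ) → S n (λ j → c * f j) ≡ c * S n f
S-* zero    c f = sym (*-zeroʳ c)
S-* (suc n) c f = trans (cong (c * f 0 +_) (S-* n c (f ∘ suc))) (sym (*-distribˡ-+ c (f 0) _))

S-split : ∀ m n f → S (m + n) f ≡ S m f + S n (λ j → f (m + j))
S-split zero    n f = refl
S-split (suc m) n f = trans (cong (f 0 +_) (S-split m n (f ∘ suc))) (sym (+-assoc (f 0) _ _))

S-last : ∀ n f → S (suc n) f ≡ S n f + f n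
S-last n f = trans (cong (λ m → S m f) (+-comm 1 n)) (trans (S-split n 1 f)
    (cong (S n f +_) (trans (+-identityʳ _) (cong f (+-identityʳ n)))))

S-reverse : ∀ n f → S n f ≡ S n (λ j → f (n ∸ suc j))
S-reverse zero    f = refl
S-reverse (suc n) f = trans (S-last n f) (trans (+-comm _ (f n)) (cong (f n +_) (S-reverse n f)))

S-swap : ∀ m n (f : ℕ → ℕ → ℕ) → S m (λ i → S n (f i)) ≡ S n (λ j → S m (λ i → f i j))
S-swap zero    n f = sym (S-0 n λ _ _ → refl)
S-swap (suc m) n f = trans (cong (S n (f 0) +_) (S-swap m n (f ∘ suc))) (sym (S-+ n (f 0) _))

S-δ≤1 : ∀ n c → S n (λ j → 𝟙 (j ≟ℕ c)) ≤ 1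
S-δ≤1 zero    c = z≤n
S-δ≤1 (suc n) zero    = ≤-reflexive (cong suc (S-0 n λ j _ → refl))
S-δ≤1 (suc n) (suc c) = S-δ≤1 n c

S-δ : ∀ {n c} → c < n → S n (λ j → 𝟙 (j ≟ℕ c)) ≡ 1
S-δ {suc n} {zero}  _         = cong suc (S-0 n λ j _ → refl)
S-δ {suc n} {suc c} (s≤s c<n) = S-δ c<n

∑-⊑ : ∀ {n} (g : Fin n → ℕ) l m → l ⊑ m → ∑ g l ≤ ∑ g m
∑-⊑ g l m l⊑m with R , p ← complement l {m} l⊑m =
  ≤-trans (m≤m+n (∑ g l) (∑ g R)) (≤-reflexive (trans (sym (∑-++ g l R)) (sym (∑-↭ g p))))

cnt-map-injective : ∀ {m n} (f : Fin m → Fin n) → Injective _≡_ _≡_ f → ∀ z → cnt z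
    (map f (allFin m)) ≤ 1
cnt-map-injective {m} f inj z with z ∈? map f (allFin m)
... | no z∉ = ≤-trans (≤-reflexive (∉⇒cnt z∉)) z≤n
... | yes z∈ with i , _ , refl ← ∈-map⁻ f z∈ = ≤-reflexive (trans (∑-map (δ (f i)) f (allFin m))
  (trans (∑-cong (allFin m) λ {j} _ → 𝟙-cong (f i ≟ f j) (i ≟ j) inj (cong f)) (cnt-allFin i)))

-- Adjacency on ℕ: the numbers below a are joined to all other ones, and carry
-- a circulant graph with distances 1, …, h, together with, if b ≡ 1, a matching
-- of i with i + ⌊a/2⌋; so all their degrees below a are r = 2h + b, except that one
-- vertex is missed by the matching if a is odd.
module Construction (a h b : ℕ) (b≤1 : b ≤ 1) (r<a : h + h + b < a) where

  q : ℕ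
  q = ⌊ a /2⌋

  2q≤a : q + q ≤ a
  2q≤a = ≤-trans (+-monoʳ-≤ q (⌊n/2⌋≤⌈n/2⌉ a)) (≤-reflexive (⌊n/2⌋+⌈n/2⌉≡n a))

  -- Cyclic distance between 1 and h modulo a: d ≤ h or a - d ≤ h.
  Dist : ℕ → Set
  Dist d = 1 ≤ d × (d ≤ h ⊎ a ≤ d + h)

  dist? : ∀ d → Dec (Dist d)
  dist? d = (1 ≤? d) ×-dec ((d ≤? h) ⊎-dec (a ≤? d + h))

  match? : ∀ i j → Dec (j ≡ i + q × i < q)
  match? i j = (j ≟ℕ i + q) ×-dec (i <? q)

  dist : ℕ → ℕ
  dist d = 𝟙 (dist? d)

  match reg F : ℕ → ℕ → ℕ
  match i j = 𝟙 (match? i j)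
  reg i j   = dist ∣ i - j ∣ + b * (match i j + match j i)

  low high : ℕ → ℕ
  low i  = 𝟙 (i <? a)
  high i = 𝟙 (a ≤? i)

  F i j = low i * high j + high i * low j + low i * low j * reg i j

  low-< : ∀ {i} → i < a → low i ≡ 1
  low-< = 𝟙-yes (_ <? a)

  low-≥ : ∀ {i} → a ≤ i → low i ≡ 0
  low-≥ a≤i = 𝟙-no (_ <? a) (≤⇒≯ a≤i)

  high-< : ∀ {i} → i < a → high i ≡ 0
  high-< i<a = 𝟙-no (a ≤? _) (<⇒≱ i<a)

  high-≥ : ∀ {i} → a ≤ i → high i ≡ 1
  high-≥ = 𝟙-yes (a ≤? _)

  F-< : ∀ {i} → i < a → ∀ j → F i j ≡ high j + low j * reg i j
  F-< {i} i<a j rewrite low-< i<a | high-< i<a = arr (high j) (low j) (reg i j)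
    where
    arr : ∀ h l r → 1 * h + 0 + 1 * l * r ≡ h + l * r
    arr = solve-∀

  F-≥ : ∀ {i} → a ≤ i → ∀ j → F i j ≡ low j
  F-≥ {i} a≤i j rewrite low-≥ a≤i | high-≥ a≤i = trans (+-identityʳ _) (*-identityˡ _)

  reg-sym : ∀ i j → reg i j ≡ reg j i
  reg-sym i j = cong₂ (λ d m → dist d + b * m) (∣-∣-comm i j) (+-comm (match i j) (match j i))

  F-sym : ∀ i j → F i j ≡ F j i
  F-sym i j = trans (cong (λ r → low i * high j + high i * low j + low i * low j * r) (reg-sym i j))
                    (arr (low i) (high j) (high i) (low j) (reg j i))
    where
    arr : ∀ li hj hi lj r → li * hj + hi * lj + li * lj * r ≡ lj * hi + hj * li + lj * li * r
    arr = solve-∀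

  match-diag : ∀ i → match i i ≡ 0
  match-diag i = 𝟙-no (match? i i) λ (i≡i+q , i<q) →
    <-irrefl i≡i+q (m<m+n i (≤-trans (s≤s z≤n) i<q))

  reg-diag : ∀ i → reg i i ≡ 0
  reg-diag i = cong₂ _+_ (trans (cong dist (∣n-n∣≡0 i)) (𝟙-no (dist? 0) λ ()))
    (trans (cong (λ m → b * (m + m)) (match-diag i)) (*-zeroʳ b))

  F-irrefl : ∀ i → F i i ≢ 1
  F-irrefl i eq with i <? a
  ... | yes i<a with () ← trans (sym eq) (trans (F-< i<a i)
      (cong₂ _+_ (high-< i<a) (trans (cong (low i *_) (reg-diag i)) (*-zeroʳ (low i)))))
  ... | no i≮a with () ← trans (sym eq) (trans (F-≥ (≮⇒≥ i≮a) i) (low-≥ (≮⇒≥ i≮a)))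

  -- This keeps the matching apart from the circulant edges: both q and a - q ≥ q exceed h.
  h<q : b ≡ 1 → h < q
  h<q refl = ≤-trans (≤-reflexive (sym (trans (cong ⌊_/2⌋ (arr h))
      (trans (⌊x+x+y/2⌋ (suc h) 0) (+-identityʳ _))))) (⌊n/2⌋-mono r<a)
    where
    arr : ∀ h → suc (h + h + 1) ≡ suc h + suc h + 0
    arr = solve-∀

  match-exclusive : ∀ i j → match i j + match j i ≤ 1
  match-exclusive i j = 𝟙-exclusive (match? i j) (match? j i) λ { (refl , i<q) (i≡ , _) →
    <-irrefl i≡ (≤-trans (m<m+n i (≤-trans (s≤s z≤n) i<q)) (m≤m+n (i + q) q)) }

  match-dist : b ≡ 1 → ∀ i j → 1 ≤ match i j → dist ∣ i - j ∣ ≡ 0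
  match-dist b≡1 i j m with refl , i<q ← 𝟙-pos (match? i j) m =
    𝟙-no (dist? ∣ i - i + q ∣) λ (_ , c) → absurd (subst (λ d → d ≤ h ⊎ a ≤ d + h)
        (trans (∣-∣-comm i (i + q)) (trans (cong (∣_- i ∣) (+-comm i q)) (∣m+n-n∣≡m q i))) c)
    where
    ∣m+n-n∣≡m : ∀ m n → ∣ m + n - n ∣ ≡ m
    ∣m+n-n∣≡m m n = trans (m≤n⇒∣m-n∣≡n∸m′ (m≤n+m n m)) (m+n∸n≡m m n)
      where
      m≤n⇒∣m-n∣≡n∸m′ : n ≤ m + n → ∣ m + n - n ∣ ≡ m + n ∸ n
      m≤n⇒∣m-n∣≡n∸m′ le = trans (∣-∣-comm (m + n) n) (m≤n⇒∣m-n∣≡n∸m le)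
    absurd : ¬ (q ≤ h ⊎ a ≤ q + h)
    absurd (inj₁ q≤h) = <⇒≱ (h<q b≡1) q≤h
    absurd (inj₂ a≤)  = <⇒≱ (+-monoʳ-< q (h<q b≡1)) (≤-trans 2q≤a a≤)

  reg≤1 : ∀ i j → reg i j ≤ 1
  reg≤1 i j = go b refl b≤1
    where
    M : ℕ
    M = match i j + match j i
    go : ∀ c → b ≡ c → c ≤ 1 → dist ∣ i - j ∣ + b * M ≤ 1
    go zero refl _ = ≤-trans (≤-reflexive (+-identityʳ _)) (𝟙≤1 (dist? ∣ i - j ∣))
    go (suc zero) refl _ with 1 ≤? match i j | 1 ≤? match j i
    ... | yes m | _     = ≤-trans (≤-reflexive (cong (_+ (M + 0)) (match-dist refl i j m)))
        (≤-trans (≤-reflexive (+-identityʳ M)) (match-exclusive i j))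
    ... | no _  | yes m = ≤-trans (≤-reflexive (cong (_+ (M + 0))
        (trans (cong dist (∣-∣-comm i j)) (match-dist refl j i m))))
                            (≤-trans (≤-reflexive (+-identityʳ M)) (match-exclusive i j))
    ... | no m  | no m′ = ≤-trans (≤-reflexive (trans (cong (λ k → dist ∣ i - j ∣ + (k + 0))
        (cong₂ _+_ (n<1⇒n≡0 (≰⇒> m)) (n<1⇒n≡0 (≰⇒> m′)))) (+-identityʳ _)))
                            (𝟙≤1 (dist? ∣ i - j ∣))
    go (suc (suc _)) _ (s≤s ())

  F≤1 : ∀ i j → F i j ≤ 1
  F≤1 i j with ≤-<-connex a i | ≤-<-connex a j
  ... | inj₁ a≤i | _        = ≤-trans (≤-reflexive (F-≥ a≤i j)) (𝟙≤1 (j <? a))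
  ... | inj₂ i<a | inj₁ a≤j = ≤-reflexive (trans (F-< i<a j)
      (cong₂ (λ x y → x + y * reg i j) (high-≥ a≤j) (low-≥ a≤j)))
  ... | inj₂ i<a | inj₂ j<a = ≤-trans (≤-reflexive (trans (F-< i<a j)
      (trans (cong₂ (λ x y → x + y * reg i j) (high-< j<a) (low-< j<a)) (+-identityʳ _)))) (reg≤1 i j)

  dist-flip : ∀ d → 1 ≤ d → d < a → dist (a ∸ d) ≡ dist d
  dist-flip d 1≤d d<a = 𝟙-cong (dist? (a ∸ d)) (dist? d) (λ (_ , c) → 1≤d , to c)
      (λ (_ , c) → m<n⇒0<n∸m d<a , from c)
    where
    e : ℕ
    e = a ∸ d
    e+d : e + d ≡ a
    e+d = m∸n+n≡m (<⇒≤ d<a)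
    to : e ≤ h ⊎ a ≤ e + h → d ≤ h ⊎ a ≤ d + h
    to (inj₁ e≤h) = inj₂ (≤-trans (≤-reflexive (sym (trans (+-comm d e) e+d))) (+-monoʳ-≤ d e≤h))
    to (inj₂ le)  = inj₁ (+-cancelˡ-≤ e d h (≤-trans (≤-reflexive e+d) le))
    from : d ≤ h ⊎ a ≤ d + h → e ≤ h ⊎ a ≤ e + h
    from (inj₁ d≤h) = inj₂ (≤-trans (≤-reflexive (sym e+d)) (+-monoʳ-≤ e d≤h))
    from (inj₂ le)  = inj₁ (+-cancelˡ-≤ d e h (≤-trans (≤-reflexive (trans (+-comm d e) e+d)) le))

  -- There are h short distances, then w excluded ones, then h long ones.
  dist-total : ∀ a′ → a ≡ suc a′ → S a′ (λ t → dist (suc t)) ≡ h + h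
  dist-total a′ refl = trans (cong (λ m → S m (dist ∘ suc)) eq) (trans (S-split h (w + h) _) (cong₂ _+_
      (S-1 h λ t t<h → 𝟙-yes (dist? (suc t)) (s≤s z≤n , inj₁ t<h))
      (trans (S-split w h _) (cong₂ _+_
        (S-0 w λ t t<w → 𝟙-no (dist? (suc (h + t))) λ (_ , c) → middle t t<w c)
        (S-1 h λ t t<h → 𝟙-yes (dist? (suc (h + (w + t))))
            (s≤s z≤n , inj₂ (s≤s (≤-trans (≤-reflexive eq)
          (≤-trans (+-monoʳ-≤ h (+-monoˡ-≤ h (m≤m+n w t)))
              (≤-reflexive (sym (+-assoc h (w + t) h)))))))))))) 
    where
    w : ℕ
    w = a′ ∸ (h + h)
    2h≤a′ : h + h ≤ a′
    2h≤a′ = ≤-trans (m≤m+n (h + h) b) (≤-pred r<a)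
    eq : a′ ≡ h + (w + h)
    eq = trans (sym (m∸n+n≡m 2h≤a′)) (arr w h)
      where
      arr : ∀ w h → w + (h + h) ≡ h + (w + h)
      arr = solve-∀
    middle : ∀ t → t < w → ¬ (suc (h + t) ≤ h ⊎ suc a′ ≤ suc (h + t) + h)
    middle t t<w (inj₁ le) = <⇒≱ (s≤s (m≤m+n h t)) le
    middle t t<w (inj₂ (s≤s le)) = <⇒≱ (≤-trans (s≤s (≤-reflexive (+-assoc h t h)))
      (≤-trans (≤-reflexive (sym (+-suc h (t + h)))) (≤-trans (+-monoʳ-≤ h (+-monoˡ-≤ h t<w))
          (≤-reflexive (sym eq))))) le

  -- The distances to smaller j are 1, ..., i. Reflecting the others by d ↦ a - d turns them into i
  -- + 1, ..., a - 1, so each positive distance below a occurs once.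
  dist-row : ∀ i → i < a → S a (λ j → dist ∣ i - j ∣) ≡ h + h
  dist-row i i<a = go (a ∸ suc i) (sym (m+[n∸m]≡n i<a))
    where
    go : ∀ m → a ≡ suc i + m → S a (λ j → dist ∣ i - j ∣) ≡ h + h
    go m a≡ = trans (trans (cong (λ k → S k (λ j → dist ∣ i - j ∣)) (trans a≡ (sym (+-suc i m))))
        (trans (S-split i (suc m) _)
        (cong₂ _+_ before (cong₂ _+_ diagonal after))))
            (trans (sym (S-split i m (dist ∘ suc))) (dist-total (i + m) a≡))
      where
      before : S i (λ j → dist ∣ i - j ∣) ≡ S i (dist ∘ suc)
      before = trans (S-cong i λ j j<i → cong dist (trans (∣-∣-comm i j) (m≤n⇒∣m-n∣≡n∸m (<⇒≤ j<i))))
        (trans (S-reverse i _) (S-cong i λ j j<i → cong dist (m∸[m∸n]≡n j<i)))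
      diagonal : dist ∣ i - i + 0 ∣ ≡ 0
      diagonal = trans (cong dist (trans (cong (∣ i -_∣) (+-identityʳ i)) (∣n-n∣≡0 i)))
          (𝟙-no (dist? 0) λ ())
      after : S m (λ j → dist ∣ i - i + suc j ∣) ≡ S m (λ j → dist (suc (i + j)))
      after = trans (S-cong m λ j _ → cong dist (∣m-m+n∣≡n i (suc j)))
          (trans (S-reverse m _) (S-cong m λ j j<m →
          trans (cong dist (reflect j j<m)) (dist-flip (suc (i + j)) (s≤s z≤n)
            (≤-trans (s≤s (≤-trans (≤-reflexive (sym (+-suc i j))) (+-monoʳ-≤ i j<m)))
                (≤-reflexive (sym a≡))))))
        where
        reflect : ∀ j → j < m → suc (m ∸ suc j) ≡ a ∸ suc (i + j)
        reflect j j<m = trans (sym (+-∸-assoc 1 j<m)) (trans (sym ([m+n]∸[m+o]≡n∸o i m j))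
            (cong (_∸ suc (i + j)) (sym a≡)))

  match-row : ∀ i → S a (match i) ≡ 𝟙 (i <? q)
  match-row i = go (i <? q)
    where
    go : (p : Dec (i < q)) → S a (match i) ≡ 𝟙 p
    go (yes i<q) = trans (S-cong a λ j _ → 𝟙-cong (match? i j) (j ≟ℕ i + q) proj₁ (_, i<q))
                     (S-δ (≤-trans (+-monoˡ-< q i<q) 2q≤a))
    go (no i≮q)  = S-0 a λ j _ → 𝟙-no (match? i j) λ (_ , i<q) → i≮q i<q

  match-column : ∀ i → S a (λ j → match j i) ≤ 𝟙 (q ≤? i)
  match-column i = go (q ≤? i)
    where
    go : (p : Dec (q ≤ i)) → S a (λ j → match j i) ≤ 𝟙 p
    go (yes q≤i) = ≤-trans (S-mono a λ j _ → 𝟙-mono (match? j i)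
        (j ≟ℕ i ∸ q) λ { (refl , _) → sym (m+n∸n≡m j q) }) (S-δ≤1 a (i ∸ q))
    go (no q≰i)  = ≤-reflexive (S-0 a λ j _ → 𝟙-no (match? j i) λ (i≡ , _) → q≰i
        (≤-trans (m≤n+m q j) (≤-reflexive (sym i≡))))

  reg-row : ∀ i → i < a → S a (reg i) ≡ (h + h) + b * (S a (match i) + S a (λ j → match j i))
  reg-row i i<a = trans (S-+ a _ _) (cong₂ _+_ (dist-row i i<a)
      (trans (S-* a b _) (cong (b *_) (S-+ a _ _))))

  -- i is matched with a larger number only if i < q, and with a smaller one only if q ≤ i.
  reg-row≤ : ∀ i → i < a → S a (reg i) ≤ h + h + b
  reg-row≤ i i<a = ≤-trans (≤-reflexive (reg-row i i<a))
      (+-monoʳ-≤ (h + h) (≤-trans (*-monoʳ-≤ b le) (≤-reflexive (*-identityʳ b))))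
    where
    le : S a (match i) + S a (λ j → match j i) ≤ 1
    le = ≤-trans (≤-reflexive (match-row i) ⊕ match-column i) (𝟙-exclusive (i <? q) (q ≤? i) <⇒≱)

  reg-total : S a (λ i → S a (reg i)) ≡ a * (h + h) + b * (q + q)
  reg-total = trans (S-cong a reg-row) (trans (S-+ a _ _)
      (cong₂ _+_ (S-const a (h + h)) (trans (S-* a b _) (cong (b *_)
      (trans (S-+ a _ _) (cong₂ _+_ rows (trans (S-swap a a (λ i j → match j i)) rows)))))))
    where
    rows : S a (λ i → S a (match i)) ≡ q
    rows = trans (S-cong a λ i _ → match-row i) (trans (cong (λ m → S m (λ i → 𝟙 (i <? q)))
        (sym (m+[n∸m]≡n (≤-trans (m≤m+n q q) 2q≤a))))
      (trans (S-split q (a ∸ q) _) (trans (cong₂ _+_ (S-1 q λ i i<q → 𝟙-yes (i <? q) i<q)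
        (S-0 (a ∸ q) λ j _ → 𝟙-no (q + j <? q) (≤⇒≯ (m≤m+n q j)))) (+-identityʳ q))))

  module _ (n : ℕ) (a≤n : a ≤ n) where

    n≡ : n ≡ a + (n ∸ a)
    n≡ = sym (m+[n∸m]≡n a≤n)

    S-parts : ∀ f → S n f ≡ S a f + S (n ∸ a) (λ j → f (a + j))
    S-parts f = trans (cong (λ m → S m f) n≡) (S-split a (n ∸ a) f)

    low-total : S n low ≡ a
    low-total = trans (S-parts low) (trans (cong₂ _+_ (S-1 a λ _ → low-<)
        (S-0 (n ∸ a) λ j _ → low-≥ (m≤m+n a j))) (+-identityʳ a))

    low-reg : ∀ i → S n (λ j → low j * reg i j) ≡ S a (reg i)
    low-reg i = trans (S-parts _) (trans (cong₂ _+_ (S-cong a λ j j<a → trans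
        (cong (_* reg i j) (low-< j<a)) (*-identityˡ _))
      (S-0 (n ∸ a) λ j _ → cong (_* reg i (a + j)) (low-≥ (m≤m+n a j)))) (+-identityʳ _))

    high-total : S n high ≡ n ∸ a
    high-total = trans (S-parts high) (cong₂ _+_ (S-0 a λ _ → high-<)
        (S-1 (n ∸ a) λ j _ → high-≥ (m≤m+n a j)))

    F-total : S n (λ i → S n (F i)) ≡ a * (n ∸ a) + a * (n ∸ a) + (a * (h + h) + b * (q + q))
    F-total = trans (S-parts _) (trans (cong₂ _+_
        (trans (S-cong a λ i i<a → trans (S-cong n λ j _ → F-< i<a j)
            (trans (S-+ n _ _) (cong₂ _+_ high-total (low-reg i))))
          (trans (S-+ a _ _) (cong₂ _+_ (S-const a (n ∸ a)) reg-total)))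
        (trans (S-cong (n ∸ a) λ i _ → trans (S-cong n λ j _ → F-≥ (m≤m+n a i) j) low-total)
            (S-const (n ∸ a) a)))
      (arr a (n ∸ a) (a * (h + h) + b * (q + q))))
      where
      arr : ∀ a m r → a * m + r + m * a ≡ a * m + a * m + r
      arr = solve-∀

    G : Graph n
    G = record
      { _~_      = λ u v → F (toℕ u) (toℕ v) ≡ 1
      ; ~-sym    = λ {u} {v} eq → trans (F-sym (toℕ v) (toℕ u)) eq
      ; ~-irrefl = λ { {u} refl → F-irrefl (toℕ u) }
      ; _~?_     = λ u v → F (toℕ u) (toℕ v) ≟ℕ 1 }

    open Walks G using (N)

    N≡F : ∀ u v → N u v ≡ F (toℕ u) (toℕ v)
    N≡F u v = go (F (toℕ u) (toℕ v)) (F≤1 _ _)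
      where
      go : ∀ m → m ≤ 1 → 𝟙 (m ≟ℕ 1) ≡ m
      go zero       _ = refl
      go (suc zero) _ = refl
      go (suc (suc _)) (s≤s ())

    -- The floor reflects the matching, which has b⌊a/2⌋ edges and misses one vertex if b = 1 and a
    -- is odd.
    edge-count : ∣E G ∣ ≡ a * (n ∸ a) + ⌊ a * (h + h + b) /2⌋
    edge-count = +-double-injective (trans (handshake G)
        (trans (∑-cong (allFin n) λ {u} _ → trans (∑-cong (allFin n) λ {v} _ → N≡F u v)
        (∑-toℕ n (F (toℕ u))))
        (trans (∑-toℕ n (λ i → S n (F i))) (trans F-total (arr′ (a * (n ∸ a)) _ _ half)))))
      where
      +-double-injective : ∀ {x y} → x + x ≡ y + y → x ≡ y
      +-double-injective {x} {y} eq = trans (sym (half x)) (trans (cong ⌊_/2⌋ eq) (half y))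
        where
        half : ∀ x → ⌊ x + x /2⌋ ≡ x
        half x = trans (cong ⌊_/2⌋ (sym (+-identityʳ (x + x)))) (trans (⌊x+x+y/2⌋ x 0) (+-identityʳ x))
      half : a * (h + h) + b * (q + q) ≡ ⌊ a * (h + h + b) /2⌋ + ⌊ a * (h + h + b) /2⌋
      half = trans (arr a h b q) (sym (cong (λ m → m + m)
          (trans (cong ⌊_/2⌋ (arr″ a h b)) (trans (⌊x+x+y/2⌋ (a * h) (a * b))
          (cong (a * h +_) (go b b≤1))))))
        where
        arr : ∀ a h b q → a * (h + h) + b * (q + q) ≡ (a * h + b * q) + (a * h + b * q)
        arr = solve-∀
        arr″ : ∀ a h b → a * (h + h + b) ≡ a * h + a * h + a * b
        arr″ = solve-∀
        go : ∀ b → b ≤ 1 → ⌊ a * b /2⌋ ≡ b * q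
        go zero       _ = cong ⌊_/2⌋ (*-zeroʳ a)
        go (suc zero) _ = trans (cong ⌊_/2⌋ (*-identityʳ a)) (sym (+-identityʳ q))
        go (suc (suc _)) (s≤s ())
      arr′ : ∀ x y z → y ≡ z + z → x + x + y ≡ (x + z) + (x + z)
      arr′ x _ z refl = rearrange x z
        where
        rearrange : ∀ x z → x + x + (z + z) ≡ (x + z) + (x + z)
        rearrange = solve-∀

    module OnCycle (C : Cycle G) where

      open Cycle C

      positions : List (Fin (3 + m))
      positions = allFin (3 + m)

      ∑-cycle≤ : ∀ f → ∑ (λ j → f (toℕ (vertex j))) positions ≤ S n f
      ∑-cycle≤ f = ≤-trans (≤-reflexive (sym (∑-map (f ∘ toℕ) vertex positions)))
        (≤-trans (∑-⊑ (f ∘ toℕ) (map vertex positions) (allFin n) λ z → ≤-trans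
            (cnt-map-injective vertex injective z)
          (≤-reflexive (sym (cnt-allFin z)))) (≤-reflexive (∑-toℕ n f)))

      low-count : ∑ (λ j → low (toℕ (vertex j))) positions ≤ a
      low-count = ≤-trans (∑-cycle≤ low) (≤-reflexive low-total)

      next-injective : Injective _≡_ _≡_ (next {2 + m})
      next-injective {i} {j} eq = trans (sym (prev-next i)) (trans (cong prev eq) (prev-next j))

      -- The high vertices are independent, so each one on C is followed by a low one.
      high-count : ∑ (λ j → high (toℕ (vertex j))) positions ≤ a
      high-count = ≤-trans (∑-mono positions λ {j} _ → followed j)
          (≤-trans (≤-reflexive (sym (∑-map low-at next positions)))
        (≤-trans (∑-⊑ low-at (map next positions) positions λ z → ≤-trans
            (cnt-map-injective next next-injective z)
          (≤-reflexive (sym (cnt-allFin z)))) low-count))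
        where
        low-at : Fin (3 + m) → ℕ
        low-at j = low (toℕ (vertex j))
        followed : ∀ j → high (toℕ (vertex j)) ≤ low (toℕ (vertex (next j)))
        followed j with ≤-<-connex a (toℕ (vertex j))
        ... | inj₁ a≤ = ≤-trans (𝟙≤1 (a ≤? _)) (≤-reflexive (trans (sym (adjacent j)) (F-≥ a≤ _)))
        ... | inj₂ <a = ≤-trans (≤-reflexive (high-< <a)) z≤n

      cycle-degree : ∀ {K} → (n ≡ a × h + h + b ≤ K) ⊎ a + (h + h + b) ≤ K → ∀ i → ∑
          (λ j → N (vertex i) (vertex j)) positions ≤ K
      cycle-degree {K} cond i = ≤-trans (≤-reflexive (∑-cong positions λ {j} _ → N≡F (vertex i)
          (vertex j))) (bound cond (≤-<-connex a (toℕ (vertex i))))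
        where
        bound : (n ≡ a × h + h + b ≤ K) ⊎ a + (h + h + b) ≤ K → a ≤ toℕ (vertex i) ⊎ toℕ
            (vertex i) < a →
                ∑ (λ j → F (toℕ (vertex i)) (toℕ (vertex j))) positions ≤ K
        bound (inj₁ (n≡a , _)) (inj₁ a≤) = ⊥-elim (<⇒≱ (toℕ<n (vertex i))
            (≤-trans (≤-reflexive n≡a) a≤))
        bound (inj₂ r≤K) (inj₁ a≤) = ≤-trans (≤-reflexive (∑-cong positions λ _ → F-≥ a≤ _))
            (≤-trans low-count (≤-trans (m≤m+n a _) r≤K))
        bound cond′ (inj₂ <a) = ≤-trans (≤-reflexive (trans (∑-cong positions λ _ → F-< <a _)
            (∑-+ highs-at regs-at positions)))
            (≤-trans (+-monoʳ-≤ (∑ highs-at positions) (≤-trans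
                (∑-cycle≤ (λ j → low j * reg (toℕ (vertex i)) j))
                (≤-trans (≤-reflexive (low-reg _)) (reg-row≤ _ <a)))) (highs cond′))
          where
          highs-at regs-at : Fin (3 + m) → ℕ
          highs-at j = high (toℕ (vertex j))
          regs-at j = low (toℕ (vertex j)) * reg (toℕ (vertex i)) (toℕ (vertex j))
          highs : (n ≡ a × h + h + b ≤ K) ⊎ a + (h + h + b) ≤ K → ∑ (λ j → high (toℕ (vertex j)))
              positions + (h + h + b) ≤ K
          highs (inj₁ (n≡a , r≤K)) = ≤-trans (≤-reflexive
              (cong (_+ (h + h + b)) (∑-≡0 positions λ {j} _ →
            high-< (≤-trans (toℕ<n (vertex j)) (≤-reflexive n≡a))))) r≤K
          highs (inj₂ r≤K) = ≤-trans (+-monoˡ-≤ (h + h + b) high-count) r≤K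

    G-free : ∀ {k} → (n ≡ a × h + h + b ≤ suc k) ⊎ a + (h + h + b) ≤ suc k → ¬ HasCycleWithChords k G
    G-free {k} cond (C , i , k≤) = <-irrefl refl (≤-trans (≤-reflexive (+-comm 2 k))
        (≤-trans (+-monoˡ-≤ 2 k≤)
      (≤-trans (≤-reflexive (chords+2 C i)) (OnCycle.cycle-degree C cond i))))

-- With n = a no high vertices exist and r bounds all degrees. Otherwise a low vertex has at most a
-- high and r low neighbours on a cycle.
attained : ∀ {k n a r} → r < a → a ≤ n → (n ≡ a × r ≤ suc k) ⊎ a + r ≤ suc k →
           Σ (Graph n) λ G → ¬ HasCycleWithChords k G × ∣E G ∣ ≡ a * (n ∸ a) + ⌊ a * r /2⌋
attained {k} {n} {a} {r} r<a a≤n cond = G n a≤n , G-free n a≤n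
    (subst (λ s → (n ≡ a × s ≤ suc k) ⊎ a + s ≤ suc k) r≡ cond) ,
    trans (edge-count n a≤n) (cong (λ s → a * (n ∸ a) + ⌊ a * s /2⌋) (sym r≡))
  where
  h b : ℕ
  h = ⌊ r /2⌋
  b = ⌈ r /2⌉ ∸ h
  r≡ : r ≡ h + h + b
  r≡ = trans (sym (⌊n/2⌋+⌈n/2⌉≡n r)) (trans (cong (h +_) (sym (m+[n∸m]≡n (⌊n/2⌋≤⌈n/2⌉ r))))
      (sym (+-assoc h h b)))
  open Construction a h b (≤-trans (∸-monoˡ-≤ h (⌊n/2⌋-mono (n≤1+n (suc r))))
      (≤-reflexive (m+n∸n≡m 1 h)))
                    (subst (_< a) r≡ r<a)

max-attained : ∀ lo hi f → max[ lo ⋯ hi ] f ≡ 0 ⊎ ∃[ a ] (lo ≤ a × a ≤ hi × max[ lo ⋯ hi ] f ≡ f a)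
max-attained lo hi f with argmax-sel (λ x → x) 0 (map f (filter (lo ≤?_) (upTo (suc hi))))
... | inj₁ eq = inj₁ eq
... | inj₂ ∈m with a , a∈ , eq ← ∈-map⁻ f ∈m with a∈upTo , lo≤a ← ∈-filter⁻ (lo ≤?_) a∈ = inj₂
    (a , lo≤a , ≤-pred (∈-upTo⁻ a∈upTo) , eq)

extremal-attained : ∀ {k n} → k + 2 ≤ n → Σ (Graph n) λ G → ¬ HasCycleWithChords k G × ∣E G ∣ ≡ extremal
    k n
extremal-attained {k} {n} k+2≤n = cases (⊔-sel x y) (max-attained (⌊ k + 1 /2⌋ + 1) (k + 1)
    (value-at k n))
  where
  x y : ℕ
  x = ⌊ (k + 1) * n /2⌋
  y = max[ ⌊ k + 1 /2⌋ + 1 ⋯ k + 1 ] (value-at k n)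
  Attained : ℕ → Set₁
  Attained e = Σ (Graph n) λ G → ¬ HasCycleWithChords k G × ∣E G ∣ ≡ e
  k+1<n : k + 1 < n
  k+1<n = ≤-trans (≤-reflexive (sym (+-suc k 1))) k+2≤n
  regular : Attained x
  regular = subst Attained (trans (cong (λ m → n * m + ⌊ n * (k + 1) /2⌋) (n∸n≡0 n))
      (trans (cong (_+ ⌊ n * (k + 1) /2⌋) (*-zeroʳ n)) (cong ⌊_/2⌋ (*-comm n (k + 1)))))
    (attained k+1<n ≤-refl (inj₁ (refl , ≤-reflexive (+-comm k 1))))
  split-graph : ∀ a → ⌊ k + 1 /2⌋ + 1 ≤ a → a ≤ k + 1 → Attained (value-at k n a)
  split-graph a lo≤a a≤k+1 = attained r<a (≤-trans a≤k+1 (<⇒≤ k+1<n))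
      (inj₂ (≤-reflexive (trans (m+[n∸m]≡n a≤k+1) (+-comm k 1))))
    where
    -- The range of a starts just above half of k + 1, which leaves room for degree k + 1 - a within
    -- a class of size a.
    r<a : k + 1 ∸ a < a
    r<a = +-cancelˡ-< a _ _ (≤-trans (s≤s (≤-reflexive (m+[n∸m]≡n a≤k+1)))
        (≰⇒> λ 2a≤ → <-irrefl refl (≤-trans (≤-trans (≤-reflexive (+-comm 1 _)) lo≤a)
        (half-≤ {a} 2a≤))))
  cases : x ⊔ y ≡ x ⊎ x ⊔ y ≡ y → y ≡ 0 ⊎ ∃[ a ] (⌊ k + 1 /2⌋ + 1 ≤ a × a ≤ k + 1 × y ≡ value-at k n a)
      → Attained (x ⊔ y)
  cases (inj₁ eq) _ = subst Attained (sym eq) regular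
  -- A maximum equal to the default value 0 need not be attained by any a; then the other term is
  -- the larger one.
  cases (inj₂ eq) (inj₁ y≡0) = subst Attained (trans (sym (⊔-identityʳ x)) (cong (x ⊔_) (sym y≡0)))
      regular
  cases (inj₂ eq) (inj₂ (a , lo≤a , a≤hi , y≡)) = subst Attained (sym (trans eq y≡))
      (split-graph a lo≤a a≤hi)

theorem1p3 : ∀ (k n : ℕ) → 1 ≤ k → k + 2 ≤ n →
    g[ k , n ]≡ (⌊ (k + 1) * n /2⌋
    ⊔ max[ ⌊ k + 1 /2⌋ + 1 ⋯ k + 1 ] (λ a → a * (n ∸ a) + ⌊ a * (k + 1 ∸ a) /2⌋))
theorem1p3 k n 1≤k k+2≤n = extremal-attained k+2≤n , upper-bound 1≤k k+2≤n
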